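{- Let $x,y>1$ be fixed. Let $G=(V,E)$ be a finite simple graph with $|V|=n$ and tree-width $\mathrm{tw}(G)$. For the single site flip chain on $G$ associated with the weights $$w(G[S])=(x-1)^{\mathrm{rk}_2(S)}(y-1)^{|S|-\mathrm{rk}_2(S)},\qquad S\subseteq V,$$ of the bivariate interlace polynomial $q(G;x,y)=\sum_{S\subseteq V}(x-1)^{\mathrm{rk}_2(S)}(y-1)^{|S|-\mathrm{rk}_2(S)}$, the mixing time satisfies $$\tau(\varepsilon)=O\left(n^{2+8(\mathrm{tw}(G)+1)|\log_2((x-1)/(y-1))|}\,\log(1/\varepsilon)\right).$$
   Context: All graphs are finite and simple. For $S\subseteq V$, $G[S]$ is the subgraph of $G$ induced by $S$ and $\mathrm{rk}_2(S)$ is the rank over $\mathbb{F}_2$ of the adjacency matrix of $G[S]$. Single site flip chain on $G=(V,E)$ with positive weights $w(G[S])$: the state space is $\Omega'=2^V$. From $X_t\subseteq V$, pick $v\in V$ uniformly at random, let $S=X_t\oplus\{v\}$ ($\oplus$ is symmetric difference), and set $X_{t+1}=S$ with probability $\frac12\min\{1,w(G[S])/w(G[X_t])\}$ and $X_{t+1}=X_t$ otherwise. Its unique stationary distribution $\pi'$ satisfies $\pi'(S)\propto w(G[S])$. Mixing time. $\|\nu-\nu'\|_{TV}=\frac12\sum_{H\in\Omega'}|\nu(H)-\nu'(H)|$, and with $P'$ the transition matrix, $\tau(\varepsilon)=\max_{H\in\Omega'}\min\{t: \|P'^t(H,\cdot)-\pi'\|_{TV}\le\varepsilon\}$. In the bound,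 $0<\varepsilon\le1/2$, and the implied constant may depend on $x$, $y$ and $\mathrm{tw}(G)$, but not otherwise on $G$ and not on $\varepsilon$. -}

module Defs where

open import Algebra.Bundles using (CommutativeRing; Semiring)
open import Algebra.Structures using (IsCommutativeRing)
import Algebra.Construct.NaturalChoice.Max as Max
import Algebra.Construct.NaturalChoice.Min as Min
import Algebra.Definitions.RawSemiring as RawSemiringDefinitions
import Algebra.Properties.Ring as RingProperties
import Algebra.Properties.Semiring.Exp as ExpProperties
import Algebra.Properties.Semiring.Mult as MultProperties
open import Data.Bool.Base using (Bool; true; false; _∧_; _xor_)
open import Data.Bool.Properties using (xor-∧-commutativeRing) renaming (_≟_ to _≟ᴮ_)
open import Data.Empty using (⊥-elim)
open import Data.Fin.Base using (Fin; zero; suc)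
open import Data.Fin.Properties using (all?)
open import Data.Fin.Subset
  using (Subset; inside; outside; _∈_; _⊆_; ∣_∣; ⁅_⁆; Nonempty)
open import Data.Fin.Subset.Properties using (_⊆?_; nonempty?; anySubset?)
open import Data.List.Base as List using (List; _∷_; _++_; [_]; foldr; filter)
open import Data.List.Extrema.Nat using (max)
open import Data.List.Relation.Unary.Linked using (Linked)
open import Data.List.Relation.Unary.Unique.Propositional using (Unique)
open import Data.Nat.Base as ℕ using (ℕ; zero; suc; _∸_; NonZero)
import Data.Nat.Properties as ℕₚ
open import Data.Product.Base using (∃; _×_; _,_; proj₁; proj₂; Σ-syntax; ∃-syntax)
open import Data.Sum.Base using (inj₁; inj₂)
open import Data.Vec.Base as Vec using (Vec; lookup; tabulate; zipWith)
open import Data.Vec.Properties using (≡-dec)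
import Data.Vec.Functional as Vector
open import Function.Base using (_∘_)
open import Level using (0ℓ)
open import Relation.Binary.Bundles using (DecTotalOrder)
open import Relation.Binary.Construct.Closure.ReflexiveTransitive using (Star)
import Relation.Binary.Construct.NonStrictToStrict as Strict
open import Relation.Binary.Core using (Rel)
open import Relation.Binary.PropositionalEquality using (_≡_)
import Relation.Binary.Reasoning.PartialOrder as PosetReasoning
open import Relation.Binary.Structures using (IsDecTotalOrder)
open import Relation.Nullary using (¬_; Dec; yes; no)
open import Relation.Nullary.Decidable using (_×-dec_; ¬?)
open import Relation.Unary using (Pred)

-- The reals are treated axiomatically, as a Dedekind-complete ordered field,
-- which determines them up to isomorphism.  Suprema are required to be
-- approximable by members of the set; classically this is the same as being
-- a least upper bound.  Together with the decidability of ≤ it makes the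
-- theory classical: taking P z = z ≈ 0# ⊎ (z ≈ 1# × A) decides any A : Set.

record CompleteOrderedField : Set₁ where
  infix  8 _⁻¹
  infix  8 -_
  infixl 7 _*_
  infixl 6 _+_
  infix  4 _≈_ _≤_
  field
    Carrier         : Set
    _≈_ _≤_         : Rel Carrier 0ℓ
    _+_ _*_         : Carrier → Carrier → Carrier
    -_              : Carrier → Carrier
    0# 1#           : Carrier
    -- Total for convenience; the value at 0# is immaterial.
    _⁻¹             : Carrier → Carrier

    isCommutativeRing : IsCommutativeRing _≈_ _+_ _*_ -_ 0# 1#
    0≉1               : ¬ 0# ≈ 1#
    ⁻¹-cong           : ∀ {x y} → x ≈ y → x ⁻¹ ≈ y ⁻¹
    ⁻¹-inverseʳ       : ∀ {x} → ¬ x ≈ 0# → x * x ⁻¹ ≈ 1#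

    isDecTotalOrder : IsDecTotalOrder _≈_ _≤_
    +-monoˡ-≤       : ∀ z {x y} → x ≤ y → x + z ≤ y + z
    *-nonNeg        : ∀ {x y} → 0# ≤ x → 0# ≤ y → 0# ≤ x * y

  open Strict _≈_ _≤_ public using (_<_)

  UpperBound : Pred Carrier 0ℓ → Carrier → Set
  UpperBound P u = ∀ {z} → P z → z ≤ u

  Supremum : Pred Carrier 0ℓ → Carrier → Set
  Supremum P s = UpperBound P s × (∀ {e} → e < s → ∃[ z ] P z × e < z)

  field
    complete : (P : Pred Carrier 0ℓ) → ∃ P → ∃ (UpperBound P) → ∃ (Supremum P)

  commutativeRing : CommutativeRing 0ℓ 0ℓ
  commutativeRing = record { isCommutativeRing = isCommutativeRing }

  decTotalOrder : DecTotalOrder 0ℓ 0ℓ 0ℓ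
  decTotalOrder = record { isDecTotalOrder = isDecTotalOrder }

module RealOperations (ℝ : CompleteOrderedField) where
  open CompleteOrderedField ℝ public
  open CommutativeRing commutativeRing public
    using (_-_; ring; semiring; commutativeSemiring;
           +-cong; +-congˡ; +-congʳ; +-comm; +-assoc; +-identityˡ; +-identityʳ;
           -‿inverseˡ; -‿inverseʳ; *-cong; *-congˡ; *-congʳ; *-comm; *-assoc;
           *-identityˡ; *-identityʳ; distribʳ; distribˡ; zeroˡ; zeroʳ)
  open DecTotalOrder decTotalOrder public
    using (total; antisym; totalOrder; poset; _≤?_; _≟_; module Eq)
    renaming (refl to ≤-refl; reflexive to ≤-reflexive; trans to ≤-trans)
  open Max totalOrder public using (_⊔_)
  open Min totalOrder public using (_⊓_)
  open RawSemiringDefinitions (Semiring.rawSemiring semiring) public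
    using (_^_; sum) renaming (_×_ to _·_)
  open RingProperties ring using (-‿distribˡ-*; -‿involutive)
  open ExpProperties semiring using (^-homo-*; ^-assocʳ)
  open MultProperties semiring using (×-homo-+; ×1-homo-*)
  open PosetReasoning poset

  infixl 7 _/_

  fromℕ : ℕ → Carrier
  fromℕ n = n · 1#

  _/_ : Carrier → Carrier → Carrier
  x / y = x * y ⁻¹

  2# ½ : Carrier
  2# = fromℕ 2
  ½  = 2# ⁻¹

  abs : Carrier → Carrier
  abs x = x ⊔ (- x)

  <⇒≱ : ∀ {x y} → x < y → ¬ y ≤ x
  <⇒≱ (x≤y , x≉y) y≤x = x≉y (antisym x≤y y≤x)

  ≰⇒> : ∀ {x y} → ¬ x ≤ y → y < x
  ≰⇒> {x} {y} x≰y with total x y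
  ... | inj₁ x≤y = ⊥-elim (x≰y x≤y)
  ... | inj₂ y≤x = y≤x , λ y≈x → x≰y (≤-reflexive (Eq.sym y≈x))

  <-≤-trans : ∀ {x y z} → x < y → y ≤ z → x < z
  <-≤-trans x<y@(x≤y , _) y≤z =
    ≤-trans x≤y y≤z , λ x≈z → <⇒≱ x<y (≤-trans y≤z (≤-reflexive (Eq.sym x≈z)))

  >⇒≉0 : ∀ {x} → 0# < x → ¬ x ≈ 0#
  >⇒≉0 (_ , 0≉x) x≈0 = 0≉x (Eq.sym x≈0)

  +-mono-≤ : ∀ {w x y z} → w ≤ x → y ≤ z → w + y ≤ x + z
  +-mono-≤ {w} {x} {y} {z} w≤x y≤z = begin
    w + y ≤⟨ +-monoˡ-≤ y w≤x ⟩
    x + y ≈⟨ +-comm x y ⟩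
    y + x ≤⟨ +-monoˡ-≤ x y≤z ⟩
    z + x ≈⟨ +-comm z x ⟩
    x + z ∎

  x+z-z≈x : ∀ x z → x + z + - z ≈ x
  x+z-z≈x x z =
    Eq.trans (+-assoc x z (- z)) (Eq.trans (+-congˡ (-‿inverseʳ z)) (+-identityʳ x))

  x-z+z≈x : ∀ x z → x + - z + z ≈ x
  x-z+z≈x x z =
    Eq.trans (+-assoc x (- z) z) (Eq.trans (+-congˡ (-‿inverseˡ z)) (+-identityʳ x))

  +-cancelʳ-≤ : ∀ z {x y} → x + z ≤ y + z → x ≤ y
  +-cancelʳ-≤ z {x} {y} p = begin
    x           ≈⟨ x+z-z≈x x z ⟨
    x + z + - z ≤⟨ +-monoˡ-≤ (- z) p ⟩
    y + z + - z ≈⟨ x+z-z≈x y z ⟩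
    y           ∎

  x≤y⇒0≤y-x : ∀ {x y} → x ≤ y → 0# ≤ y + - x
  x≤y⇒0≤y-x {x} {y} x≤y = begin
    0#      ≈⟨ -‿inverseʳ x ⟨
    x + - x ≤⟨ +-monoˡ-≤ (- x) x≤y ⟩
    y + - x ∎

  x<y⇒0<y-x : ∀ {x y} → x < y → 0# < y + - x
  x<y⇒0<y-x {x} {y} x<y = ≰⇒> λ y-x≤0 → <⇒≱ x<y (begin
    y           ≈⟨ x-z+z≈x y x ⟨
    y + - x + x ≤⟨ +-monoˡ-≤ x y-x≤0 ⟩
    0# + x      ≈⟨ +-identityˡ x ⟩
    x           ∎)

  *-monoˡ-≤ : ∀ {z x y} → 0# ≤ z → x ≤ y → x * z ≤ y * z
  *-monoˡ-≤ {z} {x} {y} 0≤z x≤y = +-cancelʳ-≤ (- (x * z)) (begin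
    x * z + - (x * z) ≈⟨ -‿inverseʳ (x * z) ⟩
    0#                ≤⟨ *-nonNeg (x≤y⇒0≤y-x x≤y) 0≤z ⟩
    (y + - x) * z     ≈⟨ distribʳ z y (- x) ⟩
    y * z + - x * z   ≈⟨ +-congˡ (-‿distribˡ-* x z) ⟨
    y * z + - (x * z) ∎)

  *-mono-≤ : ∀ {w x y z} → 0# ≤ w → 0# ≤ y → w ≤ x → y ≤ z → w * y ≤ x * z
  *-mono-≤ {w} {x} {y} {z} 0≤w 0≤y w≤x y≤z = begin
    w * y ≤⟨ *-monoˡ-≤ 0≤y w≤x ⟩
    x * y ≈⟨ *-comm x y ⟩
    y * x ≤⟨ *-monoˡ-≤ (≤-trans 0≤w w≤x) y≤z ⟩
    z * x ≈⟨ *-comm z x ⟩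
    x * z ∎

  *-cancelʳ-≈ : ∀ {z x y} → ¬ z ≈ 0# → x * z ≈ y * z → x ≈ y
  *-cancelʳ-≈ {z} {x} {y} z≉0 p = begin-equality
    x              ≈⟨ *-identityʳ x ⟨
    x * 1#         ≈⟨ *-congˡ (⁻¹-inverseʳ z≉0) ⟨
    x * (z * z ⁻¹) ≈⟨ *-assoc x z (z ⁻¹) ⟨
    x * z * z ⁻¹   ≈⟨ *-congʳ p ⟩
    y * z * z ⁻¹   ≈⟨ *-assoc y z (z ⁻¹) ⟩
    y * (z * z ⁻¹) ≈⟨ *-congˡ (⁻¹-inverseʳ z≉0) ⟩
    y * 1#         ≈⟨ *-identityʳ y ⟩
    y              ∎

  *-cancelʳ-≤ : ∀ {z x y} → 0# < z → x * z ≤ y * z → x ≤ y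
  *-cancelʳ-≤ {z} {x} {y} 0<z p with total x y
  ... | inj₁ x≤y = x≤y
  ... | inj₂ y≤x = ≤-reflexive
    (*-cancelʳ-≈ (>⇒≉0 0<z) (antisym p (*-monoˡ-≤ (proj₁ 0<z) y≤x)))

  *-pos : ∀ {x y} → 0# < x → 0# < y → 0# < x * y
  *-pos {x} {y} 0<x 0<y = ≰⇒> λ xy≤0 → <⇒≱ 0<x
    (*-cancelʳ-≤ 0<y (≤-trans xy≤0 (≤-reflexive (Eq.sym (zeroˡ y)))))

  0≤1 : 0# ≤ 1#
  0≤1 with total 0# 1#
  ... | inj₁ p = p
  ... | inj₂ 1≤0 = begin
    0#            ≤⟨ *-nonNeg 0≤-1 0≤-1 ⟩
    - 1# * - 1#   ≈⟨ -‿distribˡ-* 1# (- 1#) ⟨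
    - (1# * - 1#) ≈⟨ CommutativeRing.-‿cong commutativeRing (*-identityˡ (- 1#)) ⟩
    - (- 1#)      ≈⟨ -‿involutive 1# ⟩
    1#            ∎
    where
    0≤-1 : 0# ≤ - 1#
    0≤-1 = ≤-trans (x≤y⇒0≤y-x 1≤0) (≤-reflexive (+-identityˡ (- 1#)))

  0<1 : 0# < 1#
  0<1 = 0≤1 , 0≉1

  ⁻¹-pos : ∀ {x} → 0# < x → 0# < x ⁻¹
  ⁻¹-pos {x} 0<x = ≰⇒> λ x⁻¹≤0 → <⇒≱ 0<1 (begin
    1#       ≈⟨ ⁻¹-inverseʳ (>⇒≉0 0<x) ⟨
    x * x ⁻¹ ≈⟨ *-comm x (x ⁻¹) ⟩
    x ⁻¹ * x ≤⟨ *-monoˡ-≤ (proj₁ 0<x) x⁻¹≤0 ⟩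
    0# * x   ≈⟨ zeroˡ x ⟩
    0#       ∎)

  /-pos : ∀ {x y} → 0# < x → 0# < y → 0# < x / y
  /-pos 0<x 0<y = *-pos 0<x (⁻¹-pos 0<y)

  x<x+1 : ∀ x → x < x + 1#
  x<x+1 x = ≰⇒> λ x+1≤x → <⇒≱ 0<1 (+-cancelʳ-≤ x (begin
    1# + x ≈⟨ +-comm 1# x ⟩
    x + 1# ≤⟨ x+1≤x ⟩
    x      ≈⟨ +-identityˡ x ⟨
    0# + x ∎))

  fromℕ-suc : ∀ n → fromℕ n + 1# ≈ fromℕ (suc n)
  fromℕ-suc n = +-comm (fromℕ n) 1#

  fromℕ-nonNeg : ∀ n → 0# ≤ fromℕ n
  fromℕ-nonNeg zero    = ≤-refl
  fromℕ-nonNeg (suc n) = begin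
    0#           ≈⟨ +-identityˡ 0# ⟨
    0# + 0#      ≤⟨ +-mono-≤ 0≤1 (fromℕ-nonNeg n) ⟩
    1# + fromℕ n ∎

  fromℕ-mono-≤ : ∀ {m n} → m ℕ.≤ n → fromℕ m ≤ fromℕ n
  fromℕ-mono-≤ {n = n} ℕ.z≤n   = fromℕ-nonNeg n
  fromℕ-mono-≤         (ℕ.s≤s p) = +-mono-≤ ≤-refl (fromℕ-mono-≤ p)

  fromℕ-cancel-≤ : ∀ {m n} → fromℕ m ≤ fromℕ n → m ℕ.≤ n
  fromℕ-cancel-≤ {m} {n} p with m ℕₚ.≤? n
  ... | yes m≤n = m≤n
  ... | no  m≰n = ⊥-elim (<⇒≱ (x<x+1 (fromℕ n)) (begin
    fromℕ n + 1#  ≈⟨ fromℕ-suc n ⟩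
    fromℕ (suc n) ≤⟨ fromℕ-mono-≤ (ℕₚ.≰⇒> m≰n) ⟩
    fromℕ m       ≤⟨ p ⟩
    fromℕ n       ∎))

  1≤fromℕ : ∀ n .{{_ : NonZero n}} → 1# ≤ fromℕ n
  1≤fromℕ (suc n) = begin
    1#           ≈⟨ +-identityʳ 1# ⟨
    1# + 0#      ≤⟨ +-mono-≤ ≤-refl (fromℕ-nonNeg n) ⟩
    1# + fromℕ n ∎

  0<fromℕ-suc : ∀ n → 0# < fromℕ (suc n)
  0<fromℕ-suc n = <-≤-trans 0<1 (1≤fromℕ (suc n))

  archimedean : ∀ x → ∃[ n ] x ≤ fromℕ n
  archimedean x with total x 0#
  ... | inj₁ x≤0 = 0 , x≤0
  ... | inj₂ 0≤x = bound
    where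
    P : Pred Carrier 0ℓ
    P z = z ≤ x × ∃[ n ] z ≤ fromℕ n

    sup : ∃ (Supremum P)
    sup = complete P (0# , 0≤x , 0 , ≤-refl) (x , proj₁)

    s : Carrier
    s = proj₁ sup

    s-1<s : s + - 1# < s
    s-1<s = <-≤-trans (x<x+1 (s + - 1#)) (≤-reflexive (x-z+z≈x s 1#))

    bound : ∃[ n ] x ≤ fromℕ n
    bound with proj₂ (proj₂ sup) s-1<s
    ... | z , (_ , n , z≤n) , s-1<z with x ≤? fromℕ (suc n)
    ...   | yes x≤1+n = suc n , x≤1+n
    ...   | no  x≰1+n = ⊥-elim (<⇒≱ s-1<z (begin
      z                ≤⟨ z≤n ⟩
      fromℕ n          ≈⟨ x+z-z≈x (fromℕ n) 1# ⟨
      fromℕ n + 1# + - 1#  ≈⟨ +-congʳ (fromℕ-suc n) ⟩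
      fromℕ (suc n) + - 1# ≤⟨ +-monoˡ-≤ (- 1#) (proj₁ (proj₂ sup)
                               (proj₁ (≰⇒> x≰1+n) , suc n , ≤-refl)) ⟩
      s + - 1#         ∎))

  ^-nonNeg : ∀ {x} n → 0# ≤ x → 0# ≤ x ^ n
  ^-nonNeg zero    0≤x = 0≤1
  ^-nonNeg (suc n) 0≤x = *-nonNeg 0≤x (^-nonNeg n 0≤x)

  ^-pos : ∀ {x} n → 0# < x → 0# < x ^ n
  ^-pos zero    0<x = 0<1
  ^-pos (suc n) 0<x = *-pos 0<x (^-pos n 0<x)

  ^-monoˡ-≤ : ∀ {x y} n → 0# ≤ x → x ≤ y → x ^ n ≤ y ^ n
  ^-monoˡ-≤ zero    0≤x x≤y = ≤-refl
  ^-monoˡ-≤ (suc n) 0≤x x≤y = *-mono-≤ 0≤x (^-nonNeg n 0≤x) x≤y (^-monoˡ-≤ n 0≤x x≤y)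

  1≤^ : ∀ {x} n → 1# ≤ x → 1# ≤ x ^ n
  1≤^     zero    1≤x = ≤-refl
  1≤^ {x} (suc n) 1≤x = begin
    1#        ≈⟨ *-identityʳ 1# ⟨
    1# * 1#   ≤⟨ *-mono-≤ 0≤1 0≤1 1≤x (1≤^ n 1≤x) ⟩
    x * x ^ n ∎

  ^-monoʳ-≤ : ∀ {x m n} → 1# ≤ x → m ℕ.≤ n → x ^ m ≤ x ^ n
  ^-monoʳ-≤ {n = n}     1≤x ℕ.z≤n     = 1≤^ n 1≤x
  ^-monoʳ-≤ {m = suc m} 1≤x (ℕ.s≤s p) = *-mono-≤ (≤-trans 0≤1 1≤x)
    (^-nonNeg m (≤-trans 0≤1 1≤x)) ≤-refl (^-monoʳ-≤ 1≤x p)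

  ^-cancelˡ-≤ : ∀ {x y} n → 0# < y → x ^ suc n ≤ y ^ suc n → x ≤ y
  ^-cancelˡ-≤ {x} {y} n 0<y p with total x y
  ... | inj₁ x≤y = x≤y
  ... | inj₂ y≤x = *-cancelʳ-≤ (^-pos n 0<y) (begin
    x * y ^ n ≤⟨ *-mono-≤ (≤-trans (proj₁ 0<y) y≤x) (^-nonNeg n (proj₁ 0<y))
                   ≤-refl (^-monoˡ-≤ n (proj₁ 0<y) y≤x) ⟩
    x * x ^ n ≤⟨ p ⟩
    y * y ^ n ∎)

  1≤2 : 1# ≤ 2#
  1≤2 = 1≤fromℕ 2

  0<2 : 0# < 2#
  0<2 = <-≤-trans 0<1 1≤2

  2*x≈x+x : ∀ x → 2# * x ≈ x + x
  2*x≈x+x x = begin-equality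
    (1# + (1# + 0#)) * x ≈⟨ *-congʳ (+-congˡ (+-identityʳ 1#)) ⟩
    (1# + 1#) * x        ≈⟨ distribʳ x 1# 1# ⟩
    1# * x + 1# * x      ≈⟨ +-cong (*-identityˡ x) (*-identityˡ x) ⟩
    x + x                ∎

  fromℕ≤2^ : ∀ n → fromℕ n ≤ 2# ^ n
  fromℕ≤2^ zero    = 0≤1
  fromℕ≤2^ (suc n) = begin
    1# + fromℕ n    ≤⟨ +-mono-≤ (1≤^ n 1≤2) (fromℕ≤2^ n) ⟩
    2# ^ n + 2# ^ n ≈⟨ 2*x≈x+x (2# ^ n) ⟨
    2# * 2# ^ n     ∎

  2^-cancel-≤ : ∀ {m n} → 2# ^ m ≤ 2# ^ n → m ℕ.≤ n
  2^-cancel-≤ {m} {n} p with m ℕₚ.≤? n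
  ... | yes m≤n = m≤n
  ... | no  m≰n = ⊥-elim (<⇒≱ (^-pos n 0<2) (+-cancelʳ-≤ (2# ^ n) (begin
    2# ^ n + 2# ^ n ≈⟨ 2*x≈x+x (2# ^ n) ⟨
    2# ^ suc n      ≤⟨ ^-monoʳ-≤ 1≤2 (ℕₚ.≰⇒> m≰n) ⟩
    2# ^ m          ≤⟨ p ⟩
    2# ^ n          ≈⟨ +-identityˡ (2# ^ n) ⟨
    0# + 2# ^ n     ∎)))

  ^-*-+ : ∀ x m q b → (x ^ m) ^ q * x ^ b ≈ x ^ (m ℕ.* q ℕ.+ b)
  ^-*-+ x m q b = begin-equality
    (x ^ m) ^ q * x ^ b   ≈⟨ *-congʳ (^-assocʳ x m q) ⟩
    x ^ (m ℕ.* q) * x ^ b ≈⟨ ^-homo-* x (m ℕ.* q) b ⟨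
    x ^ (m ℕ.* q ℕ.+ b)   ∎

  fromℕ-*-+ : ∀ m q b → fromℕ (m ℕ.* q ℕ.+ b) ≈ fromℕ m * fromℕ q + fromℕ b
  fromℕ-*-+ m q b = begin-equality
    fromℕ (m ℕ.* q ℕ.+ b)       ≈⟨ ×-homo-+ 1# (m ℕ.* q) b ⟩
    fromℕ (m ℕ.* q) + fromℕ b   ≈⟨ +-congʳ (×1-homo-* m q) ⟩
    fromℕ m * fromℕ q + fromℕ b ∎

  -- log₂ r = sup { s rational : 2 ^ s ≤ r }.  A rational is presented as
  -- s = (a - b) / (1 + q), so that 2 ^ s ≤ r reads 2ᵃ ≤ r¹⁺ᵠ 2ᵇ.

  Log₂Below : Carrier → Pred Carrier 0ℓ
  Log₂Below r s = ∃[ a ] ∃[ b ] ∃[ q ]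
      s * fromℕ (suc q) + fromℕ b ≈ fromℕ a
    × 2# ^ a ≤ r ^ suc q * 2# ^ b

  log₂-sup : ∀ r → 0# < r → ∃ (Supremum (Log₂Below r))
  log₂-sup r 0<r = complete (Log₂Below r) nonempty bounded
    where
    nonempty : ∃ (Log₂Below r)
    nonempty with archimedean (r ⁻¹)
    ... | b , r⁻¹≤b = - fromℕ b , 0 , b , 0 , eq , le
      where
      eq : - fromℕ b * fromℕ 1 + fromℕ b ≈ 0#
      eq = begin-equality
        - fromℕ b * (1# + 0#) + fromℕ b ≈⟨ +-congʳ (*-congˡ (+-identityʳ 1#)) ⟩
        - fromℕ b * 1# + fromℕ b        ≈⟨ +-congʳ (*-identityʳ (- fromℕ b)) ⟩
        - fromℕ b + fromℕ b             ≈⟨ -‿inverseˡ (fromℕ b) ⟩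
        0#                              ∎
      le : 1# ≤ r ^ 1 * 2# ^ b
      le = begin
        1#           ≈⟨ ⁻¹-inverseʳ (>⇒≉0 0<r) ⟨
        r * r ⁻¹     ≤⟨ *-mono-≤ (proj₁ 0<r) (proj₁ (⁻¹-pos 0<r)) ≤-refl
                          (≤-trans r⁻¹≤b (fromℕ≤2^ b)) ⟩
        r * 2# ^ b   ≈⟨ *-congʳ (*-identityʳ r) ⟨
        r ^ 1 * 2# ^ b ∎

    bounded : ∃ (UpperBound (Log₂Below r))
    bounded with archimedean r
    ... | m , r≤m = fromℕ m , λ {s} → λ { (a , b , q , eq , le) →
      let a≤mq+b = 2^-cancel-≤ {a} {m ℕ.* suc q ℕ.+ b} (begin
            2# ^ a                       ≤⟨ le ⟩
            r ^ suc q * 2# ^ b           ≤⟨ *-monoˡ-≤ (proj₁ (^-pos b 0<2))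
              (^-monoˡ-≤ (suc q) (proj₁ 0<r) (≤-trans r≤m (fromℕ≤2^ m))) ⟩
            (2# ^ m) ^ suc q * 2# ^ b    ≈⟨ ^-*-+ 2# m (suc q) b ⟩
            2# ^ (m ℕ.* suc q ℕ.+ b)     ∎)
      in *-cancelʳ-≤ (0<fromℕ-suc q) (+-cancelʳ-≤ (fromℕ b) (begin
            s * fromℕ (suc q) + fromℕ b       ≈⟨ eq ⟩
            fromℕ a                           ≤⟨ fromℕ-mono-≤ a≤mq+b ⟩
            fromℕ (m ℕ.* suc q ℕ.+ b)         ≈⟨ fromℕ-*-+ m (suc q) b ⟩
            fromℕ m * fromℕ (suc q) + fromℕ b ∎)) }

  log₂ : ∀ r → 0# < r → Carrier
  log₂ r 0<r = proj₁ (log₂-sup r 0<r)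

  -- For x ≥ 1, x ^ t = sup { x ^ s : s rational, s ≤ t }.  With
  -- s = (a - b) / (1 + q), a number z ≥ 0 is at most x ^ s exactly if
  -- z¹⁺ᵠ xᵇ ≤ xᵃ.

  PowBelow : Carrier → Carrier → Pred Carrier 0ℓ
  PowBelow x t z = ∃[ a ] ∃[ b ] ∃[ q ]
      fromℕ a ≤ t * fromℕ (suc q) + fromℕ b
    × 0# ≤ z
    × z ^ suc q * x ^ b ≤ x ^ a

  pow-sup : ∀ x → 1# ≤ x → ∀ t → ∃ (Supremum (PowBelow x t))
  pow-sup x 1≤x t = complete (PowBelow x t) nonempty bounded
    where
    0<x : 0# < x
    0<x = <-≤-trans 0<1 1≤x

    nonempty : ∃ (PowBelow x t)
    nonempty with archimedean (- t)
    ... | b , -t≤b = 0# , 0 , b , 0 , le , ≤-refl , le′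
      where
      le : 0# ≤ t * fromℕ 1 + fromℕ b
      le = begin
        0#                     ≈⟨ -‿inverseʳ t ⟨
        t + - t                ≤⟨ +-mono-≤ ≤-refl -t≤b ⟩
        t + fromℕ b            ≈⟨ +-congʳ (*-identityʳ t) ⟨
        t * 1# + fromℕ b       ≈⟨ +-congʳ (*-congˡ (+-identityʳ 1#)) ⟨
        t * fromℕ 1 + fromℕ b  ∎
      le′ : 0# ^ 1 * x ^ b ≤ 1#
      le′ = begin
        0# * 1# * x ^ b ≈⟨ *-congʳ (zeroˡ 1#) ⟩
        0# * x ^ b      ≈⟨ zeroˡ (x ^ b) ⟩
        0#              ≤⟨ 0≤1 ⟩
        1#              ∎

    bounded : ∃ (UpperBound (PowBelow x t))
    bounded with archimedean t
    ... | m , t≤m = x ^ m , λ {z} → λ { (a , b , q , le , 0≤z , le′) →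
      let a≤mq+b = fromℕ-cancel-≤ {a} {m ℕ.* suc q ℕ.+ b} (begin
            fromℕ a                           ≤⟨ le ⟩
            t * fromℕ (suc q) + fromℕ b       ≤⟨ +-monoˡ-≤ (fromℕ b)
              (*-monoˡ-≤ (fromℕ-nonNeg (suc q)) t≤m) ⟩
            fromℕ m * fromℕ (suc q) + fromℕ b ≈⟨ fromℕ-*-+ m (suc q) b ⟨
            fromℕ (m ℕ.* suc q ℕ.+ b)         ∎)
      in ^-cancelˡ-≤ q (^-pos m 0<x) (*-cancelʳ-≤ (^-pos b 0<x) (begin
            z ^ suc q * x ^ b          ≤⟨ le′ ⟩
            x ^ a                      ≤⟨ ^-monoʳ-≤ 1≤x a≤mq+b ⟩
            x ^ (m ℕ.* suc q ℕ.+ b)    ≈⟨ ^-*-+ x m (suc q) b ⟨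
            (x ^ m) ^ suc q * x ^ b    ∎)) }

  pow : ∀ x → 1# ≤ x → Carrier → Carrier
  pow x 1≤x t = proj₁ (pow-sup x 1≤x t)

subsets : ∀ n → List (Subset n)
subsets zero    = [ Vec.[] ]
subsets (suc n) = List.map (outside Vec.∷_) (subsets n)
               ++ List.map (inside Vec.∷_) (subsets n)

infixl 6 _⊕_

_⊕_ : ∀ {n} → Subset n → Subset n → Subset n
_⊕_ = zipWith _xor_

members : ∀ {n} (S : Subset n) → Vec (Fin n) ∣ S ∣
members Vec.[]              = Vec.[]
members (inside  Vec.∷ S) = zero Vec.∷ Vec.map suc (members S)
members (outside Vec.∷ S) = Vec.map suc (members S)

-- 𝔽₂ is Bool with xor and ∧.

open RawSemiringDefinitions (Semiring.rawSemiring (CommutativeRing.semiring xor-∧-commutativeRing))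
  using () renaming (sum to sum₂)

Matrix₂ : ℕ → ℕ → Set
Matrix₂ m n = Fin m → Fin n → Bool

-- A coefficient vector over 𝔽₂ is identified with its support.
combination : ∀ {m n} → Matrix₂ m n → Subset m → Fin n → Bool
combination M c j = sum₂ (λ i → lookup c i ∧ M i j)

DependentRows : ∀ {m n} → Matrix₂ m n → Subset m → Set
DependentRows M T = ∃[ c ] c ⊆ T × Nonempty c × (∀ j → combination M c j ≡ false)

dependentRows? : ∀ {m n} (M : Matrix₂ m n) (T : Subset m) → Dec (DependentRows M T)
dependentRows? M T = anySubset? λ c →
  c ⊆? T ×-dec nonempty? c ×-dec all? λ j → combination M c j ≟ᴮ false

rank₂ : ∀ {m n} → Matrix₂ m n → ℕ
rank₂ {m} M = max 0 (List.map ∣_∣ (filter (¬? ∘ dependentRows? M) (subsets m)))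

record Graph (n : ℕ) : Set where
  field
    adjacency : Matrix₂ n n
    symmetric : ∀ u v → adjacency u v ≡ adjacency v u
    loopless  : ∀ v → adjacency v v ≡ false

  Adjacent : Rel (Fin n) 0ℓ
  Adjacent u v = adjacency u v ≡ true

open Graph

induced : ∀ {n} → Graph n → (S : Subset n) → Graph ∣ S ∣
induced G S = record
  { adjacency = λ i j → adjacency G (lookup (members S) i) (lookup (members S) j)
  ; symmetric = λ i j → symmetric G (lookup (members S) i) (lookup (members S) j)
  ; loopless  = λ i → loopless G (lookup (members S) i)
  }

Connected : ∀ {n} → Graph n → Set
Connected G = ∀ u v → Star (Adjacent G) u v

Acyclic : ∀ {n} → Graph n → Set
Acyclic G = ∀ u v w rest → let path = u ∷ v ∷ w ∷ rest in
  Unique path → ¬ Linked (Adjacent G) (path ++ [ u ])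

IsTree : ∀ {n} → Graph n → Set
IsTree {n} T = NonZero n × Connected T × Acyclic T

record TreeDecomposition {n} (G : Graph n) : Set where
  field
    nodes         : ℕ
    tree          : Graph nodes
    isTree        : IsTree tree
    bag           : Fin nodes → Subset n
    coversVertex  : ∀ v → ∃[ t ] v ∈ bag t
    coversEdge    : ∀ u v → Adjacent G u v → ∃[ t ] u ∈ bag t × v ∈ bag t
    bagsConnected : ∀ v → Connected (induced tree (tabulate λ t → lookup (bag t) v))

  width : ℕ
  width = Vector.foldr ℕ._⊔_ 0 (λ t → ∣ bag t ∣) ∸ 1

open TreeDecomposition using (width)

HasTreeWidth : ∀ {n} → Graph n → ℕ → Set
HasTreeWidth G k = (Σ[ D ∈ TreeDecomposition G ] width D ≡ k)
                 × ((D : TreeDecomposition G) → k ℕ.≤ width D)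

module Chains (ℝ : CompleteOrderedField) where
  open RealOperations ℝ

  ∑ : ∀ {n} → (Subset n → Carrier) → Carrier
  ∑ {n} f = foldr (λ S acc → f S + acc) 0# (subsets n)

  Distribution : ℕ → Set
  Distribution n = Subset n → Carrier

  Kernel : ℕ → Set
  Kernel n = Subset n → Distribution n

  IsDistribution : ∀ {n} → Distribution n → Set
  IsDistribution ν = (∀ S → 0# ≤ ν S) × ∑ ν ≈ 1#

  point : ∀ {n} → Kernel n
  point X Y with ≡-dec _≟ᴮ_ X Y
  ... | yes _ = 1#
  ... | no  _ = 0#

  IsStationary : ∀ {n} → Kernel n → Distribution n → Set
  IsStationary P π = IsDistribution π × (∀ Y → ∑ (λ X → π X * P X Y) ≈ π Y)

  iterate : ∀ {n} → Kernel n → ℕ → Kernel n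
  iterate P zero    = point
  iterate P (suc t) = λ X Y → ∑ (λ Z → iterate P t X Z * P Z Y)

  totalVariation : ∀ {n} → Distribution n → Distribution n → Carrier
  totalVariation ν ν′ = ½ * ∑ (λ S → abs (ν S - ν′ S))

  IsLeast : Pred ℕ 0ℓ → ℕ → Set
  IsLeast Q t = Q t × (∀ t′ → Q t′ → t ℕ.≤ t′)

  -- τ is the mixing time at ε; the function hit gives, for each initial
  -- state H, the first time at which the chain is ε-close to π.
  IsMixingTime : ∀ {n} → Kernel n → Distribution n → Carrier → ℕ → Set
  IsMixingTime {n} P π ε τ = Σ[ hit ∈ (Subset n → ℕ) ]
      (∀ H → IsLeast (λ t → totalVariation (iterate P t H) π ≤ ε) (hit H))
    × τ ≡ max 0 (List.map hit (subsets n))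

  -- The weights are given as a function of the induced subgraph.
  flipChain : ∀ {n} → (∀ {m} → Graph m → Carrier) → Graph n → Kernel n
  flipChain {n} w G X Y =
    fromℕ n ⁻¹ * sum (λ v → let S = X ⊕ ⁅ v ⁆
                                p = ½ * (1# ⊓ (w (induced G S) / w (induced G X)))
                            in p * point S Y + (1# - p) * point X Y)

  interlaceWeight : Carrier → Carrier → ∀ {m} → Graph m → Carrier
  interlaceWeight x y {m} H = (x - 1#) ^ rk * (y - 1#) ^ (m ∸ rk)
    where rk = rank₂ (adjacency H)

  ratio-pos : ∀ {x y} → 1# < x → 1# < y → 0# < (x - 1#) / (y - 1#)
  ratio-pos 1<x 1<y = /-pos (x<y⇒0<y-x 1<x) (x<y⇒0<y-x 1<y)

-- The weight factorises over subsets without edges between them, and removing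
-- a vertex changes the rank by at most 2, so decoupling a vertex from the rest
-- changes the weight by a factor in [1, r²] or [r², 1], where r = (x-1)/(y-1).
-- A Poincaré inequality passes to products with the same constant and loses
-- only such a factor when a vertex is decoupled; hence a graph of treedepth d
-- has a Poincaré constant of max(r, 1/r)^(2d).  Splitting recursively along
-- balanced bags of a tree decomposition of width k gives treedepth at most
-- (k + 1)(1 + log₂ n), so the gap of the lazy chain is polynomial in 1/n and
-- contracts the variance of the density, which is at most exponential in n at
-- the start.

module Submission where

open import Defs
open import Algebra.Bundles using (CommutativeRing)
import Algebra.Construct.NaturalChoice.Max as NaturalMax
import Algebra.Construct.NaturalChoice.Min as NaturalMin
import Algebra.Properties.AbelianGroup as AbelianGroupProperties
import Algebra.Properties.CommutativeMonoid.Sum as CMSum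
import Algebra.Properties.CommutativeSemiring.Exp as CommutativeExp
import Algebra.Properties.Monoid.Sum as MonoidSum
import Algebra.Properties.Ring as RingProperties
import Algebra.Properties.Semiring.Exp as Exp
import Algebra.Properties.Semiring.Mult as MultProperties
import Algebra.Properties.Semiring.Sum as SemiringSum
import Algebra.Solver.Ring as RingSolver
open import Algebra.Solver.Ring.AlmostCommutativeRing
  using (fromCommutativeRing; _-Raw-AlmostCommutative⟶_)
open import Data.Bool.Base using (Bool; true; false; _∧_; not; _xor_; if_then_else_)
open import Data.Bool.Properties
  using (xor-∧-commutativeRing; ∧-distribʳ-xor; xor-identityʳ) renaming (_≟_ to _≟ᴮ_)
open import Data.Empty using (⊥-elim)
open import Data.Fin.Base as Fin using (Fin; zero; suc)
open import Data.Fin.Properties using (all?; any?; pigeonhole) renaming (_≟_ to _≟ᶠ_)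
open import Data.Fin.Subset
  using (Subset; ∣_∣; ⁅_⁆; _∩_; ∁; _⊆_; Nonempty) renaming (⊥ to ∅; ⊤ to ⊤ˢ)
open import Data.Fin.Subset.Properties using (anySubset?; ∣⊥∣≡0; ∣⊤∣≡n; ∣p∣≤n; ∣⁅x⁆∣≡1)
open import Data.Integer.Base as ℤ using (ℤ; -[1+_])
import Data.Integer.Properties as ℤₚ
open import Data.List.Base as List using (List)
open import Data.List.Extrema.Nat using (max; argmax-sel; v≤max⁺; max≤v⁺)
open import Data.List.Membership.Propositional using () renaming (_∈_ to _∈ᴸ_)
open import Data.List.Membership.Propositional.Properties
  using (∈-lookup; ∈-++⁺ˡ; ∈-++⁺ʳ; ∈-map⁺; ∈-map⁻; ∈-filter⁺; ∈-filter⁻)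
open import Data.List.Relation.Unary.All as All using (All)
import Data.List.Relation.Unary.All.Properties as Allₚ
open import Data.List.Relation.Unary.Any as Any using (here; there)
open import Data.List.Relation.Unary.Unique.Propositional using (Unique)
open import Data.Maybe.Base using (Maybe; just; nothing)
open import Data.Nat.Base as ℕ using (ℕ; zero; suc; _∸_; NonZero)
import Data.Nat.Properties as ℕₚ
import Data.Nat.Solver as ℕSolver
open import Data.Product.Base using (∃; ∃-syntax; Σ-syntax; _×_; _,_; proj₁; proj₂)
import Data.Sign.Base as Sign
open import Data.Sum.Base using (_⊎_; inj₁; inj₂; [_,_]′)
open import Data.Unit.Base using (⊤; tt)
open import Data.Vec.Base as Vec using (lookup; tabulate; _[_]≔_)
import Data.Vec.Functional as Vector
import Data.Vec.Properties as Vecₚ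
open import Function.Base using (_∘_)
open import Relation.Binary.PropositionalEquality as ≡ using (_≡_; _≢_; refl; subst)
import Relation.Binary.Reasoning.PartialOrder as PosetReasoning
open import Relation.Nullary using (¬_; Dec; yes; no)
open import Relation.Nullary.Decidable using (_×-dec_; _→-dec_; ¬?; decidable-stable)

-- Where the exponent comes from: one factor n is the 1/n chance of selecting a site, the other is
-- the logarithm of the initial variance. Treedepth alone would give 2 (k + 1) log₂ max(r, 1/r),
-- with 2 in place of 8; the remaining factor 4 is spent on rounding. Logarithms and real powers are
-- bare suprema over rationals, so the final comparison goes through a single rational between a
-- quarter of the logarithm and the logarithm itself.
--
-- The Poincaré inequality is kept unnormalised and with a free centre: the normalising constants of
-- two weights never have to be compared, and a change of weight does not move the centre. The
-- decomposition tree is only known to be connected and acyclic, so a balanced bag is not picked at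
-- a centroid but reached by stripping leaves; what has been stripped need not be small, only of
-- small treedepth. The stationary distribution is an arbitrary given one; the contraction of the
-- variance itself identifies it, without a separate ergodicity argument.

-- Subsets under symmetric difference.

module Subsets where

  open import Data.Nat.Base using (_+_; _≤_; z≤n; s≤s)
  open import Data.Vec.Base using ([]; _∷_)
  open ≡ using (sym; trans; cong; cong₂)

  private variable
    n : ℕ

  infix 4 _⊑_

  _⊑_ : Subset n → Subset n → Set
  S ⊑ U = ∀ v → lookup S v ≡ true → lookup U v ≡ true

  ⊆⇒⊑ : {S U : Subset n} → S ⊆ U → S ⊑ U
  ⊆⇒⊑ S⊆U v p = Vecₚ.[]=⇒lookup (S⊆U (Vecₚ.lookup⇒[]= v _ p))

  ⊑⇒⊆ : {S U : Subset n} → S ⊑ U → S ⊆ U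
  ⊑⇒⊆ S⊑U {v} p = Vecₚ.lookup⇒[]= v _ (S⊑U v (Vecₚ.[]=⇒lookup p))

  Disjoint : Subset n → Subset n → Set
  Disjoint S U = ∀ v → lookup S v ≡ true → lookup U v ≡ false

  true≢false : ∀ {b} {A : Set} → b ≡ true → b ≡ false → A
  true≢false refl ()

  ≢true⇒false : ∀ {b} → (b ≡ true → b ≡ false) → b ≡ false
  ≢true⇒false {false} f = refl
  ≢true⇒false {true}  f = f refl

  bool-case : ∀ b → b ≡ true ⊎ b ≡ false
  bool-case true  = inj₁ refl
  bool-case false = inj₂ refl

  lookup-⊕ : ∀ (S U : Subset n) v → lookup (S ⊕ U) v ≡ (lookup S v xor lookup U v)
  lookup-⊕ S U v = Vecₚ.lookup-zipWith _xor_ v S U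

  lookup-∩ : ∀ (S U : Subset n) v → lookup (S ∩ U) v ≡ lookup S v ∧ lookup U v
  lookup-∩ S U v = Vecₚ.lookup-zipWith _∧_ v S U

  lookup-∅ : ∀ (v : Fin n) → lookup ∅ v ≡ false
  lookup-∅ v = Vecₚ.lookup-replicate v false

  lookup-⁅x⁆ : ∀ (v : Fin n) → lookup ⁅ v ⁆ v ≡ true
  lookup-⁅x⁆ zero    = refl
  lookup-⁅x⁆ (suc v) = lookup-⁅x⁆ v

  lookup-⁅⁆⇒≡ : ∀ (u v : Fin n) → lookup ⁅ v ⁆ u ≡ true → u ≡ v
  lookup-⁅⁆⇒≡ zero    zero    p = refl
  lookup-⁅⁆⇒≡ (suc u) zero    p = true≢false p (lookup-∅ u)
  lookup-⁅⁆⇒≡ (suc u) (suc v) p = cong suc (lookup-⁅⁆⇒≡ u v p)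

  lookup-ext : ∀ {S U : Subset n} → (∀ v → lookup S v ≡ lookup U v) → S ≡ U
  lookup-ext {S = []}    {[]}    eq = refl
  lookup-ext {S = a ∷ S} {b ∷ U} eq = cong₂ _∷_ (eq zero) (lookup-ext λ v → eq (suc v))

  ⊕-comm : ∀ (S U : Subset n) → S ⊕ U ≡ U ⊕ S
  ⊕-comm = Vecₚ.zipWith-comm λ { false false → refl ; false true → refl ; true false → refl ; true true → refl }

  ⊕-assoc : ∀ (S U V : Subset n) → (S ⊕ U) ⊕ V ≡ S ⊕ (U ⊕ V)
  ⊕-assoc = Vecₚ.zipWith-assoc λ { false b c → refl ; true false c → refl ; true true false → refl ; true true true → refl }

  ⊕-identityʳ : ∀ (S : Subset n) → S ⊕ ∅ ≡ S
  ⊕-identityʳ = Vecₚ.zipWith-identityʳ λ { false → refl ; true → refl }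

  ⊕-self : ∀ (S : Subset n) → S ⊕ S ≡ ∅
  ⊕-self []          = refl
  ⊕-self (false ∷ S) = cong (false ∷_) (⊕-self S)
  ⊕-self (true ∷ S)  = cong (false ∷_) (⊕-self S)

  ⊕-involutive : ∀ (S U : Subset n) → S ⊕ U ⊕ U ≡ S
  ⊕-involutive S U = trans (⊕-assoc S U U) (trans (cong (S ⊕_) (⊕-self U)) (⊕-identityʳ S))

  ⊕-swapʳ : ∀ (S U V : Subset n) → S ⊕ U ⊕ V ≡ S ⊕ V ⊕ U
  ⊕-swapʳ S U V = trans (⊕-assoc S U V) (trans (cong (S ⊕_) (⊕-comm U V)) (sym (⊕-assoc S V U)))

  ∣⊕∣ : ∀ (S U : Subset n) → Disjoint S U → ∣ S ⊕ U ∣ ≡ ∣ S ∣ + ∣ U ∣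
  ∣⊕∣ []          []          d = refl
  ∣⊕∣ (false ∷ S) (false ∷ U) d = ∣⊕∣ S U (λ v → d (suc v))
  ∣⊕∣ (false ∷ S) (true ∷ U)  d = trans (cong suc (∣⊕∣ S U (λ v → d (suc v)))) (sym (ℕₚ.+-suc _ _))
  ∣⊕∣ (true ∷ S)  (false ∷ U) d = cong suc (∣⊕∣ S U (λ v → d (suc v)))
  ∣⊕∣ (true ∷ S)  (true ∷ U)  d = true≢false refl (d zero refl)

  ⊑⇒∣∣≤ : ∀ (S U : Subset n) → S ⊑ U → ∣ S ∣ ≤ ∣ U ∣
  ⊑⇒∣∣≤ []          []          p = z≤n
  ⊑⇒∣∣≤ (false ∷ S) (false ∷ U) p = ⊑⇒∣∣≤ S U (λ v → p (suc v))
  ⊑⇒∣∣≤ (false ∷ S) (true ∷ U)  p = ℕₚ.m≤n⇒m≤1+n (⊑⇒∣∣≤ S U (λ v → p (suc v)))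
  ⊑⇒∣∣≤ (true ∷ S)  (false ∷ U) p = true≢false (p zero refl) refl
  ⊑⇒∣∣≤ (true ∷ S)  (true ∷ U)  p = s≤s (⊑⇒∣∣≤ S U (λ v → p (suc v)))

  ∣∣≤1+remove : ∀ (S : Subset n) v → ∣ S ∣ ≤ suc ∣ S [ v ]≔ false ∣
  ∣∣≤1+remove (false ∷ S) zero    = ℕₚ.n≤1+n _
  ∣∣≤1+remove (true ∷ S)  zero    = ℕₚ.≤-refl
  ∣∣≤1+remove (false ∷ S) (suc v) = ∣∣≤1+remove S v
  ∣∣≤1+remove (true ∷ S)  (suc v) = s≤s (∣∣≤1+remove S v)

  lookup-remove : ∀ (S : Subset n) v → lookup (S [ v ]≔ false) v ≡ false
  lookup-remove S v = Vecₚ.lookup∘updateAt v S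

  remove-⊑ : ∀ (S : Subset n) v → S [ v ]≔ false ⊑ S
  remove-⊑ (b ∷ S) zero    zero    ()
  remove-⊑ (b ∷ S) zero    (suc u) p = p
  remove-⊑ (b ∷ S) (suc v) zero    p = p
  remove-⊑ (b ∷ S) (suc v) (suc u) p = remove-⊑ S v u p

  ∩-⊑ˡ : ∀ (S U : Subset n) → S ∩ U ⊑ S
  ∩-⊑ˡ S U v p with lookup S v | lookup-∩ S U v
  ... | true  | eq = refl
  ... | false | eq = true≢false p eq

  ∩-⊑ʳ : ∀ (S U : Subset n) → S ∩ U ⊑ U
  ∩-⊑ʳ S U v p with lookup S v | lookup U v | lookup-∩ S U v
  ... | _     | true  | eq = refl
  ... | true  | false | eq = true≢false p eq
  ... | false | false | eq = true≢false p eq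

  ∈⊕⁻ : ∀ (S U : Subset n) v → lookup (S ⊕ U) v ≡ true → lookup S v ≡ true ⊎ lookup U v ≡ true
  ∈⊕⁻ S U v p with lookup S v | lookup U v | lookup-⊕ S U v
  ... | true  | _     | eq = inj₁ refl
  ... | false | true  | eq = inj₂ refl
  ... | false | false | eq = true≢false p eq

  ∈⊕⁺ˡ : ∀ {S U : Subset n} → Disjoint S U → S ⊑ S ⊕ U
  ∈⊕⁺ˡ {S = S} {U} d v p rewrite lookup-⊕ S U v | p | d v p = refl

  Disjoint-sym : ∀ {S U : Subset n} → Disjoint S U → Disjoint U S
  Disjoint-sym d v p = ≢true⇒false λ q → true≢false p (d v q)

  ∈⊕⁺ʳ : ∀ {S U : Subset n} → Disjoint S U → U ⊑ S ⊕ U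
  ∈⊕⁺ʳ {S = S} {U} d = subst (U ⊑_) (⊕-comm U S) (∈⊕⁺ˡ {S = U} {S} (Disjoint-sym {S = S} {U} d))

  Disjoint-⊑ : ∀ {S U S′ U′ : Subset n} → S′ ⊑ S → U′ ⊑ U → Disjoint S U → Disjoint S′ U′
  Disjoint-⊑ p q d v s = ≢true⇒false λ u → true≢false (q v u) (d v (p v s))

  Disjoint-⁅⁆ : ∀ {S : Subset n} {v} → lookup S v ≡ false → Disjoint S ⁅ v ⁆
  Disjoint-⁅⁆ {S = S} {v} p u s = ≢true⇒false λ q →
    true≢false s (subst (λ w → lookup S w ≡ false) (sym (lookup-⁅⁆⇒≡ u v q)) p)

-- Rank over 𝔽₂ of induced subgraphs.

module Rank where

  open Subsets
  open import Data.Nat.Base using (_+_; _≤_; s≤s)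
  open import Data.Vec.Base using ([]; _∷_)
  open ≡ using (sym; trans; cong; cong₂)

  private
    variable
      m n : ℕ

  open CMSum (CommutativeRing.+-commutativeMonoid xor-∧-commutativeRing)
    using () renaming (sum to sum₂; sum-cong-≗ to sum₂-cong; ∑-distrib-+ to sum₂-xor; sum-replicate-zero to sum₂-zero)

  combination-⊕ : ∀ (M : Matrix₂ m n) c d j →
    combination M (c ⊕ d) j ≡ (combination M c j xor combination M d j)
  combination-⊕ M c d j = trans
    (sum₂-cong λ i → trans (cong (_∧ M i j) (lookup-⊕ c d i)) (∧-distribʳ-xor (M i j) (lookup c i) (lookup d i)))
    (sum₂-xor (λ i → lookup c i ∧ M i j) (λ i → lookup d i ∧ M i j))

  Vanishing : Matrix₂ m n → Subset m → Subset n → Set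
  Vanishing M c J = ∀ j → lookup J j ≡ true → combination M c j ≡ false

  -- Rows and columns stay indexed by the whole vertex set, and J only restricts which columns are
  -- tested. Induced subgraphs on different sets can then be compared without reindexing.
  Independent : Matrix₂ m n → Subset m → Subset n → Set
  Independent M T J = ∀ c → c ⊑ T → Vanishing M c J → ∀ i → lookup c i ≡ false

  module _ {m n} (M : Matrix₂ m n) where

    Dependence : Subset m → Subset n → Subset m → Set
    Dependence T J c = c ⊑ T × Vanishing M c J × ∃[ i ] lookup c i ≡ true

    dependence? : ∀ T J → Dec (∃ (Dependence T J))
    dependence? T J = anySubset? λ c →
      all? (λ i → (lookup c i ≟ᴮ true) →-dec (lookup T i ≟ᴮ true))
      ×-dec all? (λ j → (lookup J j ≟ᴮ true) →-dec (combination M c j ≟ᴮ false))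
      ×-dec any? (λ i → lookup c i ≟ᴮ true)

    -- If c witnesses a dependence on J, drop a row of c.  Were there another
    -- dependence c′ of the remaining rows, then one of c, c′ and c ⊕ c′ would
    -- vanish at the extra column as well.
    independent-dropColumn : ∀ {T J J⁺} j → (∀ j′ → lookup J⁺ j′ ≡ true → lookup J j′ ≡ true ⊎ j′ ≡ j) →
      Independent M T J⁺ → ∃[ T′ ] T′ ⊑ T × Independent M T′ J × ∣ T ∣ ≤ suc ∣ T′ ∣
    independent-dropColumn {T} {J} {J⁺} j J⁺⊆ ind with dependence? T J
    ... | no ¬dep = T , (λ _ p → p) ,
      (λ c c⊑T van i → ≢true⇒false λ p → ⊥-elim (¬dep (c , c⊑T , van , i , p))) , ℕₚ.n≤1+n _
    ... | yes (c , c⊑T , van , t , c∋t) =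
      T′ , remove-⊑ T t , independent , ∣∣≤1+remove T t
      where
      T′ = T [ t ]≔ false

      extend : ∀ d → Vanishing M d J → combination M d j ≡ false → Vanishing M d J⁺
      extend d van z j′ p with J⁺⊆ j′ p
      ... | inj₁ q    = van j′ q
      ... | inj₂ refl = z

      independent : Independent M T′ J
      independent c′ c′⊑T′ van′ i
        with combination M c j in e | combination M c′ j in e′
      ... | false | _     = true≢false c∋t (ind c c⊑T (extend c van e) t)
      ... | true  | false = ind c′ (λ v p → remove-⊑ T t v (c′⊑T′ v p)) (extend c′ van′ e′) i
      ... | true  | true  = true≢false sum∋t (ind (c ⊕ c′) sum⊑T (extend (c ⊕ c′) sumVan
          (trans (combination-⊕ M c c′ j) (cong₂ _xor_ e e′))) t)
        where
        sum⊑T : c ⊕ c′ ⊑ T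
        sum⊑T v p with ∈⊕⁻ c c′ v p
        ... | inj₁ q = c⊑T v q
        ... | inj₂ q = remove-⊑ T t v (c′⊑T′ v q)
        sumVan : Vanishing M (c ⊕ c′) J
        sumVan j′ p = trans (combination-⊕ M c c′ j′) (cong₂ _xor_ (van j′ p) (van′ j′ p))
        sum∋t : lookup (c ⊕ c′) t ≡ true
        sum∋t = trans (lookup-⊕ c c′ t) (cong₂ _xor_ c∋t
          (≢true⇒false λ p → true≢false (c′⊑T′ t p) (lookup-remove T t)))

  ∈subsets : ∀ (S : Subset n) → S ∈ᴸ subsets n
  ∈subsets []                    = here refl
  ∈subsets (_∷_ {n} false S) = ∈-++⁺ˡ (∈-map⁺ (false ∷_) (∈subsets S))
  ∈subsets (_∷_ {n} true  S) =
    ∈-++⁺ʳ (List.map (false ∷_) (subsets n)) (∈-map⁺ (true ∷_) (∈subsets S))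

  -- With `compress`, translates between the coordinates of `induced` (positions in the list of
  -- members of S) and subsets of S in the ambient vertex set.
  expand : ∀ (S : Subset n) → Subset ∣ S ∣ → Subset n
  expand []          c       = []
  expand (false ∷ S) c       = false ∷ expand S c
  expand (true ∷ S)  (b ∷ c) = b ∷ expand S c

  compress : ∀ (S : Subset n) → Subset n → Subset ∣ S ∣
  compress []          T       = []
  compress (false ∷ S) (b ∷ T) = compress S T
  compress (true ∷ S)  (b ∷ T) = b ∷ compress S T

  ∣expand∣ : ∀ (S : Subset n) c → ∣ expand S c ∣ ≡ ∣ c ∣
  ∣expand∣ []          []          = refl
  ∣expand∣ (false ∷ S) c           = ∣expand∣ S c
  ∣expand∣ (true ∷ S)  (false ∷ c) = ∣expand∣ S c
  ∣expand∣ (true ∷ S)  (true ∷ c)  = cong suc (∣expand∣ S c)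

  expand-⊑ : ∀ (S : Subset n) c → expand S c ⊑ S
  expand-⊑ (false ∷ S) c       (suc v) p = expand-⊑ S c v p
  expand-⊑ (true ∷ S)  (b ∷ c) zero    p = refl
  expand-⊑ (true ∷ S)  (b ∷ c) (suc v) p = expand-⊑ S c v p

  expand-compress : ∀ (S T : Subset n) → T ⊑ S → expand S (compress S T) ≡ T
  expand-compress []          []          p = refl
  expand-compress (false ∷ S) (false ∷ T) p = cong (false ∷_) (expand-compress S T (λ v → p (suc v)))
  expand-compress (false ∷ S) (true ∷ T)  p = true≢false (p zero refl) refl
  expand-compress (true ∷ S)  (b ∷ T)     p = cong (b ∷_) (expand-compress S T (λ v → p (suc v)))

  compress-expand : ∀ (S : Subset n) c → compress S (expand S c) ≡ c
  compress-expand []          []      = refl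
  compress-expand (false ∷ S) c       = compress-expand S c
  compress-expand (true ∷ S)  (b ∷ c) = cong (b ∷_) (compress-expand S c)

  compress-mono : ∀ (S T U : Subset n) → T ⊑ U → compress S T ⊑ compress S U
  compress-mono (false ∷ S) (_ ∷ T) (_ ∷ U) p v       q = compress-mono S T U (λ v → p (suc v)) v q
  compress-mono (true ∷ S)  (_ ∷ T) (_ ∷ U) p zero    q = p zero q
  compress-mono (true ∷ S)  (_ ∷ T) (_ ∷ U) p (suc v) q = compress-mono S T U (λ v → p (suc v)) v q

  expand-mono : ∀ (S : Subset n) c d → c ⊑ d → expand S c ⊑ expand S d
  expand-mono (false ∷ S) c       d       p (suc v) q = expand-mono S c d p v q
  expand-mono (true ∷ S)  (_ ∷ c) (_ ∷ d) p zero    q = p zero q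
  expand-mono (true ∷ S)  (_ ∷ c) (_ ∷ d) p (suc v) q = expand-mono S c d (λ v → p (suc v)) v q

  lookup-members : ∀ (S : Subset n) i → lookup S (lookup (members S) i) ≡ true
  lookup-members (false ∷ S) i = trans
    (cong (lookup (false ∷ S)) (Vecₚ.lookup-map i suc (members S))) (lookup-members S i)
  lookup-members (true ∷ S)  zero    = refl
  lookup-members (true ∷ S)  (suc i) = trans
    (cong (lookup (true ∷ S)) (Vecₚ.lookup-map i suc (members S))) (lookup-members S i)

  member : ∀ (S : Subset n) v → lookup S v ≡ true → ∃[ i ] lookup (members S) i ≡ v
  member (false ∷ S) (suc v) p with member S v p
  ... | i , e = i , trans (Vecₚ.lookup-map i suc (members S)) (cong suc e)
  member (true ∷ S)  zero    p = zero , refl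
  member (true ∷ S)  (suc v) p with member S v p
  ... | i , e = suc i , trans (Vecₚ.lookup-map i suc (members S)) (cong suc e)

  -- Indices outside S contribute nothing on the right, because `expand S c` is `false` there.
  sum₂-members : ∀ (S : Subset n) c (g : Fin n → Bool) →
    sum₂ (λ i → lookup c i ∧ g (lookup (members S) i)) ≡ sum₂ (λ i → lookup (expand S c) i ∧ g i)
  sum₂-members []          []      g = refl
  sum₂-members (false ∷ S) c       g = trans
    (sum₂-cong λ i → cong (λ u → lookup c i ∧ g u) (Vecₚ.lookup-map i suc (members S)))
    (sum₂-members S c (g ∘ suc))
  sum₂-members (true ∷ S)  (b ∷ c) g = cong ((b ∧ g zero) xor_) (trans
    (sum₂-cong λ i → cong (λ u → lookup c i ∧ g u) (Vecₚ.lookup-map i suc (members S)))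
    (sum₂-members S c (g ∘ suc)))

  lookup-expand-members : ∀ (S : Subset n) c i → lookup (expand S c) (lookup (members S) i) ≡ lookup c i
  lookup-expand-members (false ∷ S) c i = trans
    (cong (lookup (false ∷ expand S c)) (Vecₚ.lookup-map i suc (members S))) (lookup-expand-members S c i)
  lookup-expand-members (true ∷ S)  (b ∷ c) zero    = refl
  lookup-expand-members (true ∷ S)  (b ∷ c) (suc i) = trans
    (cong (lookup (b ∷ expand S c)) (Vecₚ.lookup-map i suc (members S))) (lookup-expand-members S c i)

  -- Specifies the rank of the principal submatrix on S in ambient coordinates: a maximum that is
  -- attained and is an upper bound. The rank estimates below use only this, never the list maximum
  -- in `rank₂`.
  record IsRank (A : Matrix₂ n n) (S : Subset n) (k : ℕ) : Set where
    field
      rows        : Subset n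
      rows⊑       : rows ⊑ S
      independent : Independent A rows S
      ∣rows∣      : ∣ rows ∣ ≡ k
      maximal     : ∀ T → T ⊑ S → Independent A T S → ∣ T ∣ ≤ k

  rank₂-induced : ∀ (G : Graph n) S → IsRank (Graph.adjacency G) S (rank₂ (Graph.adjacency (induced G S)))
  rank₂-induced {n} G S = record
    { rows = expand S (proj₁ best) ; rows⊑ = expand-⊑ S (proj₁ best)
    ; independent = ind⇒ (proj₁ best) (proj₁ (proj₂ best))
    ; ∣rows∣ = trans (∣expand∣ S (proj₁ best)) (proj₂ (proj₂ best))
    ; maximal = λ T T⊑S ind → subst (_≤ rank₂ M)
        (trans (sym (∣expand∣ S (compress S T))) (cong ∣_∣ (expand-compress S T T⊑S)))
        (bound (compress S T) (⇒ind T T⊑S ind))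
    }
    where
    A = Graph.adjacency G
    M = Graph.adjacency (induced G S)

    comb≡ : ∀ c j → combination M c j ≡ combination A (expand S c) (lookup (members S) j)
    comb≡ c j = sum₂-members S c (λ i → A i (lookup (members S) j))

    ind⇒ : ∀ T → ¬ DependentRows M T → Independent A (expand S T) S
    ind⇒ T ¬dep c c⊑ van i = ≢true⇒false λ p → ⊥-elim (¬dep (compress S c , sub , ne p , van′))
      where
      c⊑S : c ⊑ S
      c⊑S v q = expand-⊑ S T v (c⊑ v q)
      c≡ = expand-compress S c c⊑S
      sub : compress S c ⊆ T
      sub = ⊑⇒⊆ (subst (compress S c ⊑_) (compress-expand S T) (compress-mono S c (expand S T) c⊑))
      ne : lookup c i ≡ true → Nonempty (compress S c)
      ne p with member S i (c⊑S i p)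
      ... | j , refl = j , Vecₚ.lookup⇒[]= j _ (trans
        (sym (lookup-expand-members S (compress S c) j)) (trans (cong (λ d → lookup d (lookup (members S) j)) c≡) p))
      van′ : ∀ j → combination M (compress S c) j ≡ false
      van′ j = trans (comb≡ (compress S c) j)
        (trans (cong (λ d → combination A d (lookup (members S) j)) c≡) (van _ (lookup-members S j)))

    ⇒ind : ∀ T → T ⊑ S → Independent A T S → ¬ DependentRows M (compress S T)
    ⇒ind T T⊑S ind (c , c⊆ , (i , c∋i) , van) = true≢false
      (trans (lookup-expand-members S c i) (Vecₚ.[]=⇒lookup c∋i))
      (ind (expand S c)
        (subst (expand S c ⊑_) (expand-compress S T T⊑S) (expand-mono S c (compress S T) (⊆⇒⊑ c⊆)))
        van′ (lookup (members S) i))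
      where
      van′ : Vanishing A (expand S c) S
      van′ j p with member S j p
      ... | j′ , refl = trans (sym (comb≡ c j′)) (van j′)

    candidates = List.filter (¬? ∘ dependentRows? M) (subsets ∣ S ∣)

    bound : ∀ T → ¬ DependentRows M T → ∣ T ∣ ≤ rank₂ M
    bound T ¬dep = v≤max⁺ 0 _ (inj₂
      (Any.map ℕₚ.≤-reflexive (∈-map⁺ ∣_∣ (∈-filter⁺ (¬? ∘ dependentRows? M) (∈subsets T) ¬dep))))

    best : Σ[ T ∈ Subset ∣ S ∣ ] ¬ DependentRows M T × ∣ T ∣ ≡ rank₂ M
    best with argmax-sel (λ k → k) 0 (List.map ∣_∣ candidates)
    -- If the maximum is the default value 0, the empty set of rows attains it.
    ... | inj₁ e = ∅ , (λ { (c , c⊆ , (i , p) , _) → true≢false (⊆⇒⊑ c⊆ i (Vecₚ.[]=⇒lookup p)) (lookup-∅ i) }) ,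
        trans (∣⊥∣≡0 ∣ S ∣) (sym e)
    ... | inj₂ p with ∈-map⁻ ∣_∣ p
    ...   | T , T∈ , e = T , proj₂ (∈-filter⁻ (¬? ∘ dependentRows? M) {xs = subsets ∣ S ∣} T∈) , sym e

  NonAdjacent : Graph n → Subset n → Subset n → Set
  NonAdjacent G S U = ∀ u v → lookup S u ≡ true → lookup U v ≡ true → Graph.adjacency G u v ≡ false

  NonAdjacent-sym : ∀ (G : Graph n) {S U} → NonAdjacent G S U → NonAdjacent G U S
  NonAdjacent-sym G na u v p q = trans (Graph.symmetric G u v) (na v u q p)

  module _ {n} (G : Graph n) where
    open IsRank
    private
      A = Graph.adjacency G

    rank≤∣∣ : ∀ {S k} → IsRank A S k → k ≤ ∣ S ∣
    rank≤∣∣ {S} r = subst (_≤ ∣ S ∣) (∣rows∣ r) (⊑⇒∣∣≤ (rows r) S (rows⊑ r))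

    rank-mono : ∀ {S U k l} → S ⊑ U → IsRank A S k → IsRank A U l → k ≤ l
    rank-mono {S} {U} S⊑U r s = subst (_≤ _) (∣rows∣ r) (maximal s (rows r)
      (λ v p → S⊑U v (rows⊑ r v p))
      λ c c⊑ van → independent r c c⊑ (λ j p → van j (S⊑U j p)))

    -- The row and the column of v cost one each: dropping row v from a basis loses at most one row,
    -- and forgetting column v loses at most one more by `independent-dropColumn`.
    rank-addVertex : ∀ {S v k l} → lookup S v ≡ false → IsRank A S k → IsRank A (S ⊕ ⁅ v ⁆) l → l ≤ 2 + k
    rank-addVertex {S} {v} {k} {l} v∉S r s = goal
      where
      T = rows s [ v ]≔ false

      T⊑S : T ⊑ S
      T⊑S u p with ∈⊕⁻ S ⁅ v ⁆ u (rows⊑ s u (remove-⊑ (rows s) v u p))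
      ... | inj₁ q = q
      ... | inj₂ q with lookup-⁅⁆⇒≡ u v q
      ...   | refl = true≢false p (lookup-remove (rows s) v)

      cover : ∀ j → lookup (S ⊕ ⁅ v ⁆) j ≡ true → lookup S j ≡ true ⊎ j ≡ v
      cover j p with ∈⊕⁻ S ⁅ v ⁆ j p
      ... | inj₁ q = inj₁ q
      ... | inj₂ q = inj₂ (lookup-⁅⁆⇒≡ j v q)

      T-independent : Independent A T (S ⊕ ⁅ v ⁆)
      T-independent c c⊑T = independent s c (λ u p → remove-⊑ (rows s) v u (c⊑T u p))

      goal : l ≤ 2 + k
      goal with independent-dropColumn A {T} {S} {S ⊕ ⁅ v ⁆} v cover T-independent
      ... | T′ , T′⊑T , ind , size = subst (_≤ 2 + k) (∣rows∣ s) (ℕₚ.≤-trans (∣∣≤1+remove (rows s) v)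
        (s≤s (ℕₚ.≤-trans size (s≤s (maximal r T′ (λ u p → T⊑S u (T′⊑T u p)) ind)))))

    combination-nonAdjacent : ∀ {S U c} → NonAdjacent G S U → c ⊑ S → Vanishing A c U
    combination-nonAdjacent {S} {U} {c} na c⊑S j p = trans (sum₂-cong term) (sum₂-zero n)
      where
      term : ∀ i → lookup c i ∧ A i j ≡ false
      term i with lookup c i in e
      ... | false = refl
      ... | true  = na i j (c⊑S i e) p

    module _ {S U : Subset n} (disj : Disjoint S U) (na : NonAdjacent G S U) where

      -- A combination of rows in S vanishes on U by itself, there being no edges between S and U,
      -- so vanishing on S already means vanishing on all columns.
      restrict : ∀ {T} → Independent A T (S ⊕ U) → Independent A (T ∩ S) S
      restrict {T} ind c c⊑ van = ind c (λ v p → ∩-⊑ˡ T S v (c⊑ v p)) van′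
        where
        van′ : Vanishing A c (S ⊕ U)
        van′ j p with ∈⊕⁻ S U j p
        ... | inj₁ q = van j q
        ... | inj₂ q = combination-nonAdjacent {S} {U} {c} na (λ v p → ∩-⊑ʳ T S v (c⊑ v p)) j q

      -- The matrix is block diagonal. A vanishing combination of rows from both bases splits into
      -- its two blocks; on the columns of one block the other block contributes nothing, so each
      -- part vanishes separately.
      rank-superadditive : ∀ {k l m} → IsRank A S k → IsRank A U l → IsRank A (S ⊕ U) m → k + l ≤ m
      rank-superadditive {k} {l} {m} r s t = subst (_≤ m)
        (trans (∣⊕∣ R₁ R₂ rdisj) (cong₂ _+_ (∣rows∣ r) (∣rows∣ s)))
        (maximal t (R₁ ⊕ R₂) sub ind)
        where
        R₁ = rows r
        R₂ = rows s
        rdisj : Disjoint R₁ R₂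
        rdisj = Disjoint-⊑ {S = S} {U} {R₁} {R₂} (rows⊑ r) (rows⊑ s) disj
        sub : R₁ ⊕ R₂ ⊑ S ⊕ U
        sub v p with ∈⊕⁻ R₁ R₂ v p
        ... | inj₁ q = ∈⊕⁺ˡ {S = S} {U} disj v (rows⊑ r v q)
        ... | inj₂ q = ∈⊕⁺ʳ {S = S} {U} disj v (rows⊑ s v q)
        ind : Independent A (R₁ ⊕ R₂) (S ⊕ U)
        ind c c⊑ van i = ≢true⇒false λ p → [ (λ q → true≢false (in∩ i p q) (c₁≡∅ i)) , (λ q → true≢false (in∩′ i p q) (c₂≡∅ i)) ]′ (∈⊕⁻ R₁ R₂ i (c⊑ i p))
          where
          in∩ : ∀ i → lookup c i ≡ true → lookup R₁ i ≡ true → lookup (c ∩ R₁) i ≡ true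
          in∩ i p q = trans (lookup-∩ c R₁ i) (cong₂ _∧_ p q)
          in∩′ : ∀ i → lookup c i ≡ true → lookup R₂ i ≡ true → lookup (c ∩ R₂) i ≡ true
          in∩′ i p q = trans (lookup-∩ c R₂ i) (cong₂ _∧_ p q)
          split : c ≡ (c ∩ R₁) ⊕ (c ∩ R₂)
          split = lookup-ext λ v → trans (pt v) (sym (trans (lookup-⊕ (c ∩ R₁) (c ∩ R₂) v)
            (cong₂ _xor_ (lookup-∩ c R₁ v) (lookup-∩ c R₂ v))))
            where
            pt : ∀ v → lookup c v ≡ ((lookup c v ∧ lookup R₁ v) xor (lookup c v ∧ lookup R₂ v))
            pt v with lookup c v in e
            ... | false = refl
            ... | true with ∈⊕⁻ R₁ R₂ v (c⊑ v e)
            ...   | inj₁ q rewrite q | rdisj v q = refl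
            ...   | inj₂ q rewrite q | Disjoint-sym {S = R₁} {R₂} rdisj v q = refl
          comb : ∀ j → combination A c j ≡ (combination A (c ∩ R₁) j xor combination A (c ∩ R₂) j)
          comb j = trans (cong (λ d → combination A d j) split) (combination-⊕ A (c ∩ R₁) (c ∩ R₂) j)
          sub₁ : c ∩ R₁ ⊑ S
          sub₁ v p = rows⊑ r v (∩-⊑ʳ c R₁ v p)
          sub₂ : c ∩ R₂ ⊑ U
          sub₂ v p = rows⊑ s v (∩-⊑ʳ c R₂ v p)
          c₁≡∅ : ∀ i → lookup (c ∩ R₁) i ≡ false
          c₁≡∅ = independent r (c ∩ R₁) (∩-⊑ʳ c R₁) λ j p → cancelʳ
            (combination-nonAdjacent {U} {S} {c ∩ R₂} (NonAdjacent-sym G {S} {U} na) sub₂ j p)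
            (trans (sym (comb j)) (van j (∈⊕⁺ˡ {S = S} {U} disj j p)))
            where
            cancelʳ : ∀ {a b} → b ≡ false → (a xor b) ≡ false → a ≡ false
            cancelʳ {false} _ _ = refl
            cancelʳ {true} refl ()
          c₂≡∅ : ∀ i → lookup (c ∩ R₂) i ≡ false
          c₂≡∅ = independent s (c ∩ R₂) (∩-⊑ʳ c R₂) λ j p → cancelˡ
            (combination-nonAdjacent {S} {U} {c ∩ R₁} na sub₁ j p)
            (trans (sym (comb j)) (van j (∈⊕⁺ʳ {S = S} {U} disj j p)))
            where
            cancelˡ : ∀ {a b} → a ≡ false → (a xor b) ≡ false → b ≡ false
            cancelˡ refl p = p

    -- A basis of the whole is cut into its rows in S and its rows in U, and `restrict` keeps both
    -- pieces independent.
    rank-subadditive : ∀ {S U k l m} → Disjoint S U → NonAdjacent G S U →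
      IsRank A S k → IsRank A U l → IsRank A (S ⊕ U) m → m ≤ k + l
    rank-subadditive {S} {U} {k} {l} {m} disj na r s t = subst (_≤ k + l)
      (trans (sym (∣⊕∣ (T ∩ S) (T ∩ U) tdisj)) (trans (cong ∣_∣ split) (∣rows∣ t)))
      (ℕₚ.+-mono-≤
        (maximal r (T ∩ S) (∩-⊑ʳ T S) (restrict {S} {U} disj na {T} (independent t)))
        (maximal s (T ∩ U) (∩-⊑ʳ T U) (restrict {U} {S} (Disjoint-sym {S = S} {U} disj) (NonAdjacent-sym G {S} {U} na) {T}
          (subst (Independent A T) (⊕-comm S U) (independent t)))))
      where
      T = rows t
      tdisj : Disjoint (T ∩ S) (T ∩ U)
      tdisj = Disjoint-⊑ {S = S} {U} {T ∩ S} {T ∩ U} (∩-⊑ʳ T S) (∩-⊑ʳ T U) disj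
      pt : ∀ v → ((lookup T v ∧ lookup S v) xor (lookup T v ∧ lookup U v)) ≡ lookup T v
      pt v with lookup T v in e
      ... | false = refl
      ... | true with ∈⊕⁻ S U v (rows⊑ t v e)
      ...   | inj₁ q rewrite q | disj v q = refl
      ...   | inj₂ q rewrite q | Disjoint-sym {S = S} {U} disj v q = refl
      split : (T ∩ S) ⊕ (T ∩ U) ≡ T
      split = lookup-ext λ v → trans (trans (lookup-⊕ (T ∩ S) (T ∩ U) v)
        (cong₂ _xor_ (lookup-∩ T S v) (lookup-∩ T U v))) (pt v)

    rank-additive : ∀ {S U k l m} → Disjoint S U → NonAdjacent G S U →
      IsRank A S k → IsRank A U l → IsRank A (S ⊕ U) m → m ≡ k + l
    rank-additive {S} {U} disj na r s t = ℕₚ.≤-antisym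
      (rank-subadditive disj na r s t) (rank-superadditive {S} {U} disj na r s t)

-- Treedepth from tree decompositions.

module TreeDecompositions where

  open Subsets
  open Rank using (NonAdjacent; member; lookup-members)
  open import Data.List.Base using ([]; _∷_; _++_; [_]; length)
  open import Data.List.Relation.Unary.All using ([]; _∷_)
  open import Data.List.Relation.Unary.AllPairs using ([]; _∷_)
  open import Data.List.Relation.Unary.Linked using (Linked; [-]; _∷_)
  open import Data.Nat.Base using (_+_; _*_; _^_; _≤_; _<_; z≤n; s≤s)
  open import Relation.Binary.Construct.Closure.ReflexiveTransitive using (Star; ε; _◅_)
  open ≡ using (sym; trans; cong; cong₂)

  private
    variable
      m n d : ℕ

  _∖_ : Subset n → Subset n → Subset n
  S ∖ U = S ∩ ∁ U

  ∈∖⁻ : ∀ (S U : Subset n) v → lookup (S ∖ U) v ≡ true → lookup S v ≡ true × lookup U v ≡ false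
  ∈∖⁻ S U v p = ∩-⊑ˡ S (∁ U) v p ,
    ≢true⇒false λ q → true≢false (∩-⊑ʳ S (∁ U) v p) (trans (Vecₚ.lookup-map v not U) (cong not q))

  ∈∖⁺ : ∀ (S U : Subset n) v → lookup S v ≡ true → lookup U v ≡ false → lookup (S ∖ U) v ≡ true
  ∈∖⁺ S U v p q = trans (lookup-∩ S (∁ U) v)
    (cong₂ _∧_ p (trans (Vecₚ.lookup-map v not U) (cong not q)))

  ⊑-antisym : ∀ {S U : Subset n} → S ⊑ U → U ⊑ S → S ≡ U
  ⊑-antisym {S = S} {U} p q = lookup-ext λ v → eq v
    where
    eq : ∀ v → lookup S v ≡ lookup U v
    eq v with bool-case (lookup S v) | bool-case (lookup U v)
    ... | inj₁ s | inj₁ u = trans s (sym u)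
    ... | inj₁ s | inj₂ u = true≢false (p v s) u
    ... | inj₂ s | inj₁ u = true≢false (q v u) s
    ... | inj₂ s | inj₂ u = trans s (sym u)

  ∣remove∣< : ∀ (S : Subset n) v → lookup S v ≡ true → suc ∣ S [ v ]≔ false ∣ ≤ ∣ S ∣
  ∣remove∣< (true Vec.∷ S)  zero    p = ℕₚ.≤-refl
  ∣remove∣< (true Vec.∷ S)  (suc v) p = s≤s (∣remove∣< S v p)
  ∣remove∣< (false Vec.∷ S) (suc v) p = ∣remove∣< S v p

  ∈remove : ∀ (S : Subset n) {v u} → u ≢ v → lookup S u ≡ true → lookup (S [ v ]≔ false) u ≡ true
  ∈remove S {v} {u} u≢v p = trans (Vecₚ.lookup∘updateAt′ u v u≢v S) p

  -- The induced subgraph on S has treedepth at most d.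
  data Treedepth (G : Graph n) : ℕ → Subset n → Set where
    empty  : Treedepth G d ∅
    union  : ∀ {S U} → Disjoint S U → NonAdjacent G S U →
             Treedepth G d S → Treedepth G d U → Treedepth G d (S ⊕ U)
    vertex : ∀ {S v} → lookup S v ≡ false → Treedepth G d S → Treedepth G (suc d) (S ⊕ ⁅ v ⁆)

  module _ {G : Graph n} where

    weaken₁ : ∀ {S} → Treedepth G d S → Treedepth G (suc d) S
    weaken₁ empty           = empty
    weaken₁ (union d na s t) = union d na (weaken₁ s) (weaken₁ t)
    weaken₁ (vertex v s)    = vertex v (weaken₁ s)

    weaken : ∀ k {S} → Treedepth G d S → Treedepth G (k + d) S
    weaken zero    s = s
    weaken (suc k) s = weaken₁ (weaken k s)

    -- The vertices of B are put back one at a time, each for one level; the constructor `vertex`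
    -- allows arbitrary edges at the new vertex.
    addVertices : ∀ k {U} (B : Subset n) → B ⊑ U → ∣ B ∣ ≤ k → Treedepth G d (U ∖ B) → Treedepth G (k + d) U
    addVertices {d = d} k {U} B B⊑U size s with any? (λ v → lookup B v ≟ᴮ true)
    ... | no ¬v = weaken k (subst (Treedepth G _) (⊑-antisym {S = U ∖ B} {U} (λ v p → proj₁ (∈∖⁻ U B v p))
        (λ v p → ∈∖⁺ U B v p (≢true⇒false λ q → ⊥-elim (¬v (v , q))))) s)
    ... | yes (v , B∋v) with k | ℕₚ.≤-trans (∣remove∣< B v B∋v) size
    ...   | suc k | s≤s size′ = subst (λ e → Treedepth G e U) (ℕₚ.+-suc k d)
      (addVertices k B′ (λ u p → B⊑U u (remove-⊑ B v u p)) size′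
        (subst (Treedepth G _) (⊑-antisym {S = (U ∖ B) ⊕ ⁅ v ⁆} {U ∖ B′} to from) (vertex v∉ s)))
      where
      B′ = B [ v ]≔ false
      v∉ : lookup (U ∖ B) v ≡ false
      v∉ = ≢true⇒false λ p → true≢false B∋v (proj₂ (∈∖⁻ U B v p))
      disj : Disjoint (U ∖ B) ⁅ v ⁆
      disj = Disjoint-⁅⁆ {S = U ∖ B} v∉
      to : (U ∖ B) ⊕ ⁅ v ⁆ ⊑ U ∖ B′
      to u p with ∈⊕⁻ (U ∖ B) ⁅ v ⁆ u p
      ... | inj₁ q = ∈∖⁺ U B′ u (proj₁ (∈∖⁻ U B u q))
        (≢true⇒false λ r → true≢false (remove-⊑ B v u r) (proj₂ (∈∖⁻ U B u q)))
      ... | inj₂ q rewrite lookup-⁅⁆⇒≡ u v q = ∈∖⁺ U B′ v (B⊑U v B∋v) (lookup-remove B v)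
      from : U ∖ B′ ⊑ (U ∖ B) ⊕ ⁅ v ⁆
      from u p with u ≟ᶠ v | ∈∖⁻ U B′ u p
      ... | yes refl | _ = ∈⊕⁺ʳ {S = U ∖ B} {⁅ v ⁆} disj v (lookup-⁅x⁆ v)
      ... | no u≢v | U∋u , u∉B′ = ∈⊕⁺ˡ {S = U ∖ B} {⁅ v ⁆} disj u
        (∈∖⁺ U B u U∋u (≢true⇒false λ q → true≢false (∈remove B u≢v q) u∉B′))

  module _ (T : Graph m) where

    Adj = Graph.Adjacent T

    -- Q is demanded of every node but the start, for which `ConnectedOn` supplies it separately.
    -- Matching on a walk thus exposes its second node together with the proof that this node
    -- satisfies Q.
    data Walk (Q : Fin m → Set) : Fin m → Fin m → Set where
      stop : ∀ {s} → Walk Q s s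
      step : ∀ {s u t} → Adj s u → Q u → Walk Q u t → Walk Q s t

    ConnectedOn : (Fin m → Set) → Set
    ConnectedOn Q = ∀ s t → Q s → Q t → Walk Q s t

    record Leaf (al : Subset m) : Set where
      field
        t p  : Fin m
        al-t : lookup al t ≡ true
        al-p : lookup al p ≡ true
        adj  : Adj t p
        only : ∀ s → lookup al s ≡ true → Adj t s → s ≡ p

      t≢p : t ≢ p
      t≢p e = true≢false adj (trans (cong (λ u → Graph.adjacency T t u) (sym e)) (Graph.loopless T t))

      -- A walk that enters the leaf leaves it to where it came from.
      avoid : ∀ {Q : Fin m → Set} → (∀ s → Q s → lookup al s ≡ true) → ∀ {s s′} → Q s → s ≢ t → s′ ≢ t →
        Walk Q s s′ → Walk (λ u → Q u × u ≢ t) s s′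
      avoid Q⊆al qs s≢t s′≢t stop = stop
      avoid {Q} Q⊆al {s} {s′} qs s≢t s′≢t (step {u = u} e q w) with u ≟ᶠ t
      ... | no u≢t = step e (q , u≢t) (avoid Q⊆al q u≢t s′≢t w)
      ... | yes refl with w
      ...   | stop = ⊥-elim (s′≢t refl)
      ...   | step {u = u′} e′ q′ w′ = subst (λ x → Walk _ x s′) u′≡s (avoid Q⊆al q′ (λ e → s≢t (trans (sym u′≡s) e)) s′≢t w′)
        where
        u′≡s : u′ ≡ s
        u′≡s = trans (only u′ (Q⊆al u′ q′) e′) (sym (only s (Q⊆al s qs) (trans (Graph.symmetric T t s) e)))

      connectedOn-remove : ∀ {Q : Fin m → Set} → (∀ s → Q s → lookup al s ≡ true) →
        ConnectedOn Q → ConnectedOn (λ u → Q u × u ≢ t)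
      connectedOn-remove Q⊆al conn s s′ (q , s≢t) (q′ , s′≢t) = avoid Q⊆al q s≢t s′≢t (conn s s′ q q′)

    walk-map : ∀ {Q R : Fin m → Set} → (∀ s → Q s → R s) → ∀ {s t} → Walk Q s t → Walk R s t
    walk-map f stop         = stop
    walk-map f (step e q w) = step e (f _ q) (walk-map f w)

    unique-lookup : ∀ {A : Set} {xs : List A} → Unique xs → ∀ {i j} → i Fin.< j →
      List.lookup xs i ≢ List.lookup xs j
    unique-lookup (x∉ ∷ u) {zero}  {suc j} (s≤s i<j) e = All.lookup x∉ (∈-lookup j) e
    unique-lookup (x∉ ∷ u) {suc i} {suc j} (s≤s i<j) e = unique-lookup u i<j e

    unique-length : ∀ {xs : List (Fin m)} → Unique xs → length xs ≤ m
    unique-length {xs} u with length xs ℕₚ.≤? m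
    ... | yes p = p
    ... | no ¬p with pigeonhole (ℕₚ.≰⇒> ¬p) (List.lookup xs)
    ...   | i , j , i<j , e = ⊥-elim (unique-lookup u i<j e)

    -- The path is cut at s, a later node adjacent to t; the piece up to s, followed by t, closes a
    -- cycle. The last two components say that the piece inherits distinctness from `rest`, as
    -- `Acyclic` demands.
    closeCycle : ∀ {s t p rest} → s ∈ᴸ rest → Linked Adj (p ∷ rest) → Adj s t →
      Σ[ w ∈ Fin m ] Σ[ r ∈ List (Fin m) ] Linked Adj (p ∷ w ∷ r ++ [ t ])
        × (∀ x → All (x ≢_) rest → All (x ≢_) (w ∷ r)) × (Unique rest → Unique (w ∷ r))
    closeCycle {s} (here refl) (e ∷ l) st = s , [] , (e ∷ st ∷ [-]) ,
      (λ { x (p ∷ _) → p ∷ [] }) , λ _ → [] ∷ []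
    closeCycle {rest = a ∷ rest} (there s∈) (e ∷ l) st with closeCycle s∈ l st
    ... | w , r , l′ , f , g = a , w ∷ r , (e ∷ l′) ,
      (λ { x (p ∷ ps) → p ∷ f x ps }) , λ { (p ∷ u) → f a p ∷ g u }

    module _ (acyclic : Acyclic T) (al : Subset m) where

      -- The end of a maximal path is a leaf.
      findLeaf : ∀ fuel t p rest → Unique (t ∷ p ∷ rest) → Linked Adj (t ∷ p ∷ rest) →
        lookup al t ≡ true → lookup al p ≡ true → length (t ∷ p ∷ rest) + fuel ≡ suc m → Leaf al
      -- With the fuel exhausted, the path would consist of m + 1 distinct nodes out of m.
      findLeaf zero t p rest u l at ap e = ⊥-elim (ℕₚ.<-irrefl refl
        (subst (_≤ m) (trans (sym (ℕₚ.+-identityʳ _)) e) (unique-length u)))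
      findLeaf (suc fuel) t p rest u l at ap e
        with any? (λ s → (lookup al s ≟ᴮ true) ×-dec (Graph.adjacency T t s ≟ᴮ true) ×-dec ¬? (s ≟ᶠ p))
      ... | no none = record { t = t ; p = p ; al-t = at ; al-p = ap ; adj = first l
        ; only = λ s as ts → decidable-stable (s ≟ᶠ p) λ s≢p → none (s , as , ts , s≢p) }
        where
        first : Linked Adj (t ∷ p ∷ rest) → Adj t p
        first (x ∷ _) = x
      findLeaf (suc fuel) t p rest u@((t≢p ∷ t∉) ∷ (p∉ ∷ u′)) l@(tp ∷ l′) at ap e
          | yes (s , as , ts , s≢p) = findLeaf fuel s t (p ∷ rest) ((s≢t ∷ s≢p ∷ s∉) ∷ u) (st ∷ l) as at
            (trans (sym (ℕₚ.+-suc _ fuel)) e)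
        where
        st : Adj s t
        st = trans (Graph.symmetric T s t) ts
        s≢t : s ≢ t
        s≢t refl = true≢false ts (Graph.loopless T t)
        notIn : ¬ s ∈ᴸ rest
        notIn s∈ with closeCycle s∈ l′ st
        ... | w , r , cyc , f , g = acyclic t p w r ((t≢p ∷ f t t∉) ∷ f p p∉ ∷ g u′) (tp ∷ cyc)
        s∉ : All (s ≢_) rest
        s∉ = All.tabulate λ x∈ e → notIn (subst (_∈ᴸ rest) (sym e) x∈)

      leaf : ∀ r s → lookup al r ≡ true → lookup al s ≡ true → s ≢ r → ConnectedOn (λ u → lookup al u ≡ true) → Leaf al
      leaf r s ar as s≢r conn with conn r s ar as
      ... | stop = ⊥-elim (s≢r refl)
      -- The search starts from a path of two nodes, so the fuel m - 1 makes the total m + 1.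
      ... | step {u = u} ru au w = findLeaf (m ℕ.∸ 1) u r [] ((u≢r ∷ []) ∷ [] ∷ [])
          (trans (Graph.symmetric T u r) ru ∷ [-]) au ar (cong suc (suc-pred r))
        where
        u≢r : u ≢ r
        u≢r refl = true≢false ru (Graph.loopless T u)
        suc-pred : ∀ {m} → Fin m → suc (m ℕ.∸ 1) ≡ m
        suc-pred {suc m} _ = refl

  -- One level of the recursion. Leaves are stripped until the set `Q` cut off at one of them has at
  -- least 2^ℓ vertices; then fewer than 2^ℓ remain beyond its bag. A smaller `Q` has treedepth d by
  -- `small` and is hung on the parent. Sets hung on the same node are not adjacent, so their union
  -- keeps treedepth d however large it grows; this is why `State` records the depth of H and not
  -- its size.
  module Separation (G : Graph n) (T : Graph m) (acyclic : Acyclic T)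
    (U : Subset n) (b : Fin m → Subset n) (b⊑U : ∀ s → b s ⊑ U)
    (k d ℓ : ℕ) (∣b∣≤k : ∀ s → ∣ b s ∣ ≤ k) (∣U∣< : ∣ U ∣ < 2 ^ suc ℓ)
    (small : ∀ S → ∣ S ∣ < 2 ^ ℓ → Treedepth G d S) where

    private
      Edge : Fin n → Fin n → Set
      Edge = Graph.Adjacent G

    -- The alive nodes carry the hanging sets H, which collect the vertices
    -- that occur only in bags of nodes removed already.
    record State (al : Subset m) (H : Fin m → Subset n) : Set where
      Alive : Fin m → Set
      Alive s = lookup al s ≡ true
      field
        connected : ConnectedOn T Alive
        bags      : ∀ v → ConnectedOn T (λ s → Alive s × lookup (b s) v ≡ true)
        depth     : ∀ s → Alive s → Treedepth G d (H s)
        H⊑U       : ∀ s → Alive s → H s ⊑ U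
        closed    : ∀ s → Alive s → ∀ u v → lookup (H s) u ≡ true → lookup U v ≡ true → Edge u v →
                    lookup (H s) v ≡ true ⊎ lookup (b s) v ≡ true
        disjoint  : ∀ s s′ → Alive s → Alive s′ → s ≢ s′ → Disjoint (H s) (H s′)
        offBags   : ∀ s s′ → Alive s → Alive s′ → Disjoint (H s) (b s′)
        cover     : ∀ v → lookup U v ≡ true → ∃[ s ] Alive s × (lookup (H s) v ≡ true ⊎ lookup (b s) v ≡ true)
        coverEdge : ∀ u v → lookup U u ≡ true → lookup U v ≡ true → Edge u v →
                    ∃[ s ] Alive s × (lookup (H s) u ≡ true ⊎ lookup (H s) v ≡ true
                                     ⊎ lookup (b s) u ≡ true × lookup (b s) v ≡ true)

    module _ {al H} (st : State al H) where
      open State st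

      -- Without the bag of t, the set U falls into `H t`, whose depth is known, and a remainder
      -- small enough for the induction; `closed` forbids edges between them.
      separate : ∀ t → Alive t → ∣ (U ∖ b t) ∖ H t ∣ < 2 ^ ℓ → Treedepth G (k + d) U
      separate t at size = addVertices k (b t) (b⊑U t) (∣b∣≤k t)
        (subst (Treedepth G d) (⊑-antisym {S = H t ⊕ R} {U ∖ b t} to from)
          (union disj na (depth t at) (small R size)))
        where
        R = (U ∖ b t) ∖ H t
        disj : Disjoint (H t) R
        disj v p = ≢true⇒false λ q → true≢false p (proj₂ (∈∖⁻ (U ∖ b t) (H t) v q))
        na : NonAdjacent G (H t) R
        na u v p q = ≢true⇒false λ e → let (q₁ , v∉H) = ∈∖⁻ (U ∖ b t) (H t) v q ; (U∋v , v∉b) = ∈∖⁻ U (b t) v q₁ in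
          case (closed t at u v p U∋v e) v∉H v∉b
          where
          case : ∀ {A : Set} {x y} → x ≡ true ⊎ y ≡ true → x ≡ false → y ≡ false → A
          case (inj₁ x) x′ y′ = true≢false x x′
          case (inj₂ y) x′ y′ = true≢false y y′
        to : H t ⊕ R ⊑ U ∖ b t
        to v p with ∈⊕⁻ (H t) R v p
        ... | inj₁ q = ∈∖⁺ U (b t) v (H⊑U t at v q) (offBags t t at at v q)
        ... | inj₂ q = proj₁ (∈∖⁻ (U ∖ b t) (H t) v q)
        from : U ∖ b t ⊑ H t ⊕ R
        from v p with bool-case (lookup (H t) v)
        ... | inj₁ q = ∈⊕⁺ˡ {S = H t} {R} disj v q
        ... | inj₂ q = ∈⊕⁺ʳ {S = H t} {R} disj v (∈∖⁺ (U ∖ b t) (H t) v p q)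

      -- With a single node left, `cover` puts all of U into its bag and its hanging set, so the
      -- remainder in `separate` is empty.
      finish : ∀ r → Alive r → (∀ s → Alive s → s ≡ r) → Treedepth G (k + d) U
      finish r ar only = separate r ar (subst (λ S → ∣ S ∣ < 2 ^ ℓ) (sym exhausted) (subst (_< 2 ^ ℓ) (sym (∣⊥∣≡0 n)) (ℕₚ.m^n>0 2 ℓ)))
        where
        exhausted : (U ∖ b r) ∖ H r ≡ ∅
        exhausted = lookup-ext λ v → trans (≢true⇒false λ p →
          let (q , v∉H) = ∈∖⁻ (U ∖ b r) (H r) v p ; (U∋v , v∉b) = ∈∖⁻ U (b r) v q in
          case (cover v U∋v) v∉H v∉b) (sym (lookup-∅ v))
          where
          case : ∀ {A : Set} {v} → ∃[ s ] Alive s × (lookup (H s) v ≡ true ⊎ lookup (b s) v ≡ true) →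
            lookup (H r) v ≡ false → lookup (b r) v ≡ false → A
          case (s , as , x) p q with only s as
          case (s , as , inj₁ x) p q | refl = true≢false x p
          case (s , as , inj₂ x) p q | refl = true≢false x q

      module Remove (leaf : Leaf T al) where
        open Leaf leaf

        -- N consists of the vertices private to the leaf: by `parentBag` they occur in no other
        -- alive bag. Q is what is handed to the parent p when t is removed.
        N Q : Subset n
        N = b t ∖ b p
        Q = H t ⊕ N

        N⇒ : ∀ v → lookup N v ≡ true → lookup (b t) v ≡ true × lookup (b p) v ≡ false
        N⇒ = ∈∖⁻ (b t) (b p)

        HtN : Disjoint (H t) N
        HtN v q = ≢true⇒false λ r → true≢false (proj₁ (N⇒ v r)) (offBags t t al-t al-t v q)

        Q⇒ : ∀ v → lookup Q v ≡ true → lookup (H t) v ≡ true ⊎ lookup N v ≡ true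
        Q⇒ = ∈⊕⁻ (H t) N

        H⇒Q : H t ⊑ Q
        H⇒Q = ∈⊕⁺ˡ {S = H t} {N} HtN

        N⇒Q : N ⊑ Q
        N⇒Q = ∈⊕⁺ʳ {S = H t} {N} HtN

        bag⇒Q : ∀ v → lookup (b t) v ≡ true → lookup Q v ≡ true ⊎ lookup (b p) v ≡ true
        bag⇒Q v q with bool-case (lookup (b p) v)
        ... | inj₁ r = inj₂ r
        ... | inj₂ r = inj₁ (N⇒Q v (∈∖⁺ (b t) (b p) v q r))

        Q⊑U : Q ⊑ U
        Q⊑U v q with Q⇒ v q
        ... | inj₁ r = H⊑U t al-t v r
        ... | inj₂ r = b⊑U t v (proj₁ (N⇒ v r))

        -- Bags containing v form a connected set, which contains p as soon as
        -- it contains t and another alive node.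
        parentBag : ∀ s v → Alive s → s ≢ t → lookup (b t) v ≡ true → lookup (b s) v ≡ true → lookup (b p) v ≡ true
        parentBag s v as s≢t bt bs with bags v t s (al-t , bt) (as , bs)
        ... | stop = ⊥-elim (s≢t refl)
        ... | step {u = u} e (au , bu) w = subst (λ x → lookup (b x) v ≡ true) (only u au e) bu

        N-offBags : ∀ s → Alive s → s ≢ t → Disjoint N (b s)
        N-offBags s as s≢t v q = ≢true⇒false λ r →
          true≢false (parentBag s v as s≢t (proj₁ (N⇒ v q)) r) (proj₂ (N⇒ v q))

        Q-offBags : ∀ s → Alive s → s ≢ t → Disjoint Q (b s)
        Q-offBags s as s≢t v q with Q⇒ v q
        ... | inj₁ r = offBags t s al-t as v r
        ... | inj₂ r = N-offBags s as s≢t v r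

        Q-disjoint : ∀ s → Alive s → s ≢ t → Disjoint (H s) Q
        Q-disjoint s as s≢t v q = ≢true⇒false λ r → true≢false q (case v (Q⇒ v r))
          where
          case : ∀ v → lookup (H t) v ≡ true ⊎ lookup N v ≡ true → lookup (H s) v ≡ false
          case v (inj₁ x) = disjoint t s al-t as (λ e → s≢t (sym e)) v x
          case v (inj₂ x) = ≢true⇒false λ y → true≢false (proj₁ (N⇒ v x)) (offBags s t as al-t v y)

        -- For u in N only the alternatives of `coverEdge` at the node t survive: any other
        -- contradicts that u lies in the bag of t and in no other alive bag.
        Q-closed : ∀ u v → lookup Q u ≡ true → lookup U v ≡ true → Edge u v →
          lookup Q v ≡ true ⊎ lookup (b p) v ≡ true
        Q-closed u v q U∋v e with Q⇒ u q
        ... | inj₁ r with closed t al-t u v r U∋v e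
        ...   | inj₁ x = inj₁ (H⇒Q v x)
        ...   | inj₂ x = bag⇒Q v x
        Q-closed u v q U∋v e | inj₂ r with coverEdge u v (b⊑U t u (proj₁ (N⇒ u r))) U∋v e
        ... | s , as , inj₁ x = true≢false (proj₁ (N⇒ u r)) (offBags s t as al-t u x)
        ... | s , as , inj₂ (inj₁ x) with s ≟ᶠ t
        ...   | yes refl = inj₁ (H⇒Q v x)
        ...   | no s≢t with closed s as v u x (b⊑U t u (proj₁ (N⇒ u r))) (trans (Graph.symmetric G v u) e)
        ...     | inj₁ y = true≢false (proj₁ (N⇒ u r)) (offBags s t as al-t u y)
        ...     | inj₂ y = true≢false y (N-offBags s as s≢t u r)
        Q-closed u v q U∋v e | inj₂ r | s , as , inj₂ (inj₂ (x , y)) with s ≟ᶠ t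
        ...   | yes refl = bag⇒Q v y
        ...   | no s≢t = true≢false x (N-offBags s as s≢t u r)

        al′ : Subset m
        al′ = al [ t ]≔ false

        H′ : Fin m → Subset n
        H′ s with s ≟ᶠ p
        ... | yes _ = H s ⊕ Q
        ... | no  _ = H s

        p≢t : p ≢ t
        p≢t e = t≢p (sym e)

        H′⁻ : ∀ s v → lookup (H′ s) v ≡ true → lookup (H s) v ≡ true ⊎ s ≡ p × lookup Q v ≡ true
        H′⁻ s v q with s ≟ᶠ p
        ... | no _ = inj₁ q
        ... | yes s≡p with ∈⊕⁻ (H s) Q v q
        ...   | inj₁ r = inj₁ r
        ...   | inj₂ r = inj₂ (s≡p , r)

        H′⁺ : ∀ s → H s ⊑ H′ s
        H′⁺ s v q with s ≟ᶠ p
        ... | no _ = q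
        ... | yes refl = ∈⊕⁺ˡ {S = H p} {Q} (Q-disjoint p al-p p≢t) v q

        Q⊑H′ : Q ⊑ H′ p
        Q⊑H′ v q with p ≟ᶠ p
        ... | no p≢p = ⊥-elim (p≢p refl)
        ... | yes _ = ∈⊕⁺ʳ {S = H p} {Q} (Q-disjoint p al-p p≢t) v q

        alive : ∀ s → lookup al′ s ≡ true → Alive s
        alive = remove-⊑ al t

        ≢t : ∀ s → lookup al′ s ≡ true → s ≢ t
        ≢t s p refl = true≢false p (lookup-remove al t)

        alive′ : ∀ s → Alive s → s ≢ t → lookup al′ s ≡ true
        alive′ s as s≢t = ∈remove al s≢t as

        nonAdjacent : NonAdjacent G (H p) Q
        nonAdjacent u v x y = ≢true⇒false λ e → case u v x y (closed p al-p u v x (Q⊑U v y) e)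
          where
          case : ∀ u v → lookup (H p) u ≡ true → lookup Q v ≡ true →
            lookup (H p) v ≡ true ⊎ lookup (b p) v ≡ true → Graph.adjacency G u v ≡ false
          case u v x y (inj₁ z) = true≢false y (Q-disjoint p al-p p≢t v z)
          case u v x y (inj₂ z) = true≢false z (Q-offBags p al-p p≢t v y)

        module _ (Q-depth : Treedepth G d Q) where

          depth′ : ∀ s → Alive s → Treedepth G d (H′ s)
          depth′ s as with s ≟ᶠ p
          ... | no _ = depth s as
          ... | yes refl = union (Q-disjoint p al-p p≢t) nonAdjacent (depth p al-p) Q-depth

          closed′ : ∀ s → Alive s → ∀ u v → lookup (H′ s) u ≡ true → lookup U v ≡ true → Edge u v →
                    lookup (H′ s) v ≡ true ⊎ lookup (b s) v ≡ true
          closed′ s as u v x U∋v e with H′⁻ s u x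
          ... | inj₁ y with closed s as u v y U∋v e
          ...   | inj₁ z = inj₁ (H′⁺ s v z)
          ...   | inj₂ z = inj₂ z
          closed′ s as u v x U∋v e | inj₂ (refl , y) with Q-closed u v y U∋v e
          ...   | inj₁ z = inj₁ (Q⊑H′ v z)
          ...   | inj₂ z = inj₂ z

          disjoint′ : ∀ s s′ → lookup al′ s ≡ true → lookup al′ s′ ≡ true → s ≢ s′ → Disjoint (H′ s) (H′ s′)
          disjoint′ s s′ as as′ s≢s′ v x = ≢true⇒false λ y → case (H′⁻ s v x) (H′⁻ s′ v y)
            where
            case : lookup (H s) v ≡ true ⊎ s ≡ p × lookup Q v ≡ true →
                   lookup (H s′) v ≡ true ⊎ s′ ≡ p × lookup Q v ≡ true → ∀ {A : Set} → A
            case (inj₁ x) (inj₁ y) = true≢false y (disjoint s s′ (alive s as) (alive s′ as′) s≢s′ v x)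
            case (inj₁ x) (inj₂ (_ , y)) = true≢false y (Q-disjoint s (alive s as) (≢t s as) v x)
            case (inj₂ (_ , x)) (inj₁ y) = true≢false x (Q-disjoint s′ (alive s′ as′) (≢t s′ as′) v y)
            case (inj₂ (e , _)) (inj₂ (e′ , _)) = ⊥-elim (s≢s′ (trans e (sym e′)))

          offBags′ : ∀ s s′ → lookup al′ s ≡ true → lookup al′ s′ ≡ true → Disjoint (H′ s) (b s′)
          offBags′ s s′ as as′ v x with H′⁻ s v x
          ... | inj₁ y = offBags s s′ (alive s as) (alive s′ as′) v y
          ... | inj₂ (_ , y) = Q-offBags s′ (alive s′ as′) (≢t s′ as′) v y

          cover′ : ∀ v → lookup U v ≡ true → ∃[ s ] lookup al′ s ≡ true × (lookup (H′ s) v ≡ true ⊎ lookup (b s) v ≡ true)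
          cover′ v U∋v with cover v U∋v
          ... | s , as , x with s ≟ᶠ t
          ...   | no s≢t = s , alive′ s as s≢t , keep x
            where
            keep : lookup (H s) v ≡ true ⊎ lookup (b s) v ≡ true → lookup (H′ s) v ≡ true ⊎ lookup (b s) v ≡ true
            keep (inj₁ y) = inj₁ (H′⁺ s v y)
            keep (inj₂ y) = inj₂ y
          cover′ v U∋v | s , as , inj₁ x | yes refl = p , alive′ p al-p p≢t , inj₁ (Q⊑H′ v (H⇒Q v x))
          cover′ v U∋v | s , as , inj₂ x | yes refl with bag⇒Q v x
          ... | inj₁ y = p , alive′ p al-p p≢t , inj₁ (Q⊑H′ v y)
          ... | inj₂ y = p , alive′ p al-p p≢t , inj₂ y

          coverEdge′ : ∀ u v → lookup U u ≡ true → lookup U v ≡ true → Edge u v →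
                    ∃[ s ] lookup al′ s ≡ true × (lookup (H′ s) u ≡ true ⊎ lookup (H′ s) v ≡ true
                                     ⊎ lookup (b s) u ≡ true × lookup (b s) v ≡ true)
          coverEdge′ u v U∋u U∋v e with coverEdge u v U∋u U∋v e
          ... | s , as , x with s ≟ᶠ t
          coverEdge′ u v U∋u U∋v e | s , as , inj₁ x | no s≢t = s , alive′ s as s≢t , inj₁ (H′⁺ s u x)
          coverEdge′ u v U∋u U∋v e | s , as , inj₂ (inj₁ x) | no s≢t = s , alive′ s as s≢t , inj₂ (inj₁ (H′⁺ s v x))
          coverEdge′ u v U∋u U∋v e | s , as , inj₂ (inj₂ x) | no s≢t = s , alive′ s as s≢t , inj₂ (inj₂ x)
          coverEdge′ u v U∋u U∋v e | s , as , inj₁ x | yes refl = p , alive′ p al-p p≢t , inj₁ (Q⊑H′ u (H⇒Q u x))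
          coverEdge′ u v U∋u U∋v e | s , as , inj₂ (inj₁ x) | yes refl = p , alive′ p al-p p≢t , inj₂ (inj₁ (Q⊑H′ v (H⇒Q v x)))
          coverEdge′ u v U∋u U∋v e | s , as , inj₂ (inj₂ (x , y)) | yes refl with bag⇒Q u x | bag⇒Q v y
          ... | inj₁ x′ | _ = p , alive′ p al-p p≢t , inj₁ (Q⊑H′ u x′)
          ... | inj₂ x′ | inj₁ y′ = p , alive′ p al-p p≢t , inj₂ (inj₁ (Q⊑H′ v y′))
          ... | inj₂ x′ | inj₂ y′ = p , alive′ p al-p p≢t , inj₂ (inj₂ (x′ , y′))

          H′⊑U : ∀ s → Alive s → H′ s ⊑ U
          H′⊑U s as v x with H′⁻ s v x
          ... | inj₁ y = H⊑U s as v y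
          ... | inj₂ (_ , y) = Q⊑U v y

          state′ : State al′ H′
          state′ = record
            { connected = λ s s′ as as′ → walk-map T (λ { u (a , u≢t) → alive′ u a u≢t })
                (connectedOn-remove (λ _ a → a) connected s s′ (alive s as , ≢t s as) (alive s′ as′ , ≢t s′ as′))
            ; bags = λ { v s s′ (as , bs) (as′ , bs′) → walk-map T (λ { u ((a , bu) , u≢t) → alive′ u a u≢t , bu })
                (connectedOn-remove (λ _ → proj₁) (bags v) s s′ ((alive s as , bs) , ≢t s as) ((alive s′ as′ , bs′) , ≢t s′ as′)) }
            ; depth = λ s as → depth′ s (alive s as)
            ; H⊑U = λ s as → H′⊑U s (alive s as)
            ; closed = λ s as → closed′ s (alive s as)
            ; disjoint = disjoint′
            ; offBags = offBags′
            ; cover = cover′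
            ; coverEdge = coverEdge′
            }

        -- The remainder and Q are disjoint subsets of U, which has fewer than 2 · 2^ℓ vertices.
        rest-small : 2 ^ ℓ ≤ ∣ Q ∣ → ∣ (U ∖ b t) ∖ H t ∣ < 2 ^ ℓ
        rest-small big = ℕₚ.+-cancelʳ-< (2 ^ ℓ) _ _ (ℕₚ.≤-<-trans (ℕₚ.+-monoʳ-≤ ∣ R ∣ big)
          (ℕₚ.≤-<-trans (ℕₚ.≤-trans (ℕₚ.≤-reflexive (sym (∣⊕∣ R Q disj))) (⊑⇒∣∣≤ (R ⊕ Q) U sub))
            (subst (∣ U ∣ <_) (cong (2 ^ ℓ +_) (ℕₚ.+-identityʳ (2 ^ ℓ))) ∣U∣<)))
          where
          R = (U ∖ b t) ∖ H t
          disj : Disjoint R Q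
          disj v x = ≢true⇒false λ y → let (z , v∉H) = ∈∖⁻ (U ∖ b t) (H t) v x in
            case (Q⇒ v y) v∉H (proj₂ (∈∖⁻ U (b t) v z))
            where
            case : ∀ {v} {A : Set} → lookup (H t) v ≡ true ⊎ lookup N v ≡ true → lookup (H t) v ≡ false → lookup (b t) v ≡ false → A
            case (inj₁ x) p q = true≢false x p
            case (inj₂ x) p q = true≢false (proj₁ (N⇒ _ x)) q
          sub : R ⊕ Q ⊑ U
          sub v x with ∈⊕⁻ R Q v x
          ... | inj₁ y = proj₁ (∈∖⁻ U (b t) v (proj₁ (∈∖⁻ (U ∖ b t) (H t) v y)))
          ... | inj₂ y = Q⊑U v y

    run : ∀ fuel {al H} → ∣ al ∣ ≤ fuel → ∀ r → lookup al r ≡ true → State al H → Treedepth G (k + d) U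
    run fuel {al} size r ar st with any? (λ s → (lookup al s ≟ᴮ true) ×-dec ¬? (s ≟ᶠ r))
    ... | no none = finish st r ar λ s as → decidable-stable (s ≟ᶠ r) λ s≢r → none (s , as , s≢r)
    ... | yes (s , as , s≢r) with leaf T acyclic al r s ar as s≢r (State.connected st)
    ...   | lf with ∣ Remove.Q st lf ∣ ℕₚ.<? 2 ^ ℓ | fuel | ℕₚ.≤-trans (∣remove∣< al (Leaf.t lf) (Leaf.al-t lf)) size
    ...     | no big   | _ | _ = separate st (Leaf.t lf) (Leaf.al-t lf) (Remove.rest-small st lf (ℕₚ.≮⇒≥ big))
    ...     | yes Q<   | suc fuel′ | s≤s size′ = run fuel′ size′ (Leaf.p lf)
        (∈remove al (λ e → Leaf.t≢p lf (sym e)) (Leaf.al-p lf)) (Remove.state′ st lf (small _ Q<))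

  module _ {G : Graph n} (D : TreeDecomposition G) where
    open TreeDecomposition D

    bag≤ : ∀ t → ∣ bag t ∣ ≤ suc width
    bag≤ t = ℕₚ.≤-trans (≤foldr (λ t → ∣ bag t ∣) t) (ℕₚ.m≤n+m∸n _ 1)
      where
      ≤foldr : ∀ {m} (f : Fin m → ℕ) i → f i ≤ Vector.foldr ℕ._⊔_ 0 f
      ≤foldr f zero    = ℕₚ.m≤m⊔n _ _
      ≤foldr f (suc i) = ℕₚ.≤-trans (≤foldr (λ i → f (suc i)) i) (ℕₚ.m≤n⊔m (f zero) _)

    -- Each halving of the size costs one bag, that is, `suc width` levels; size below 2^0 means
    -- that U is empty. The search starts with all nodes alive, nothing hanging, and the bags cut
    -- down to U.
    treedepth : ∀ ℓ U → ∣ U ∣ < 2 ^ ℓ → Treedepth G (ℓ * suc width) U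
    treedepth zero U size = subst (Treedepth G 0) (sym (lookup-ext λ v → trans (≢true⇒false (λ p → ⊥-elim
      (ℕₚ.<⇒≱ size (ℕₚ.≤-trans (s≤s z≤n) (∣remove∣< U v p))))) (sym (lookup-∅ v)))) empty
    treedepth (suc ℓ) U size = run _ {⊤ˢ} {λ _ → ∅} ℕₚ.≤-refl root (∈⊤ˢ root) (record
      { connected = λ s s′ _ _ → toWalk (proj₁ (proj₂ isTree) s s′)
      ; bags = bags
      ; depth = λ _ _ → empty
      ; H⊑U = λ s _ v p → true≢false p (lookup-∅ v)
      ; closed = λ s _ u v p → true≢false p (lookup-∅ u)
      ; disjoint = λ s s′ _ _ _ v _ → lookup-∅ v
      ; offBags = λ s s′ _ _ v p → true≢false p (lookup-∅ v)
      ; cover = λ v p → let (t , q) = coversVertex v in t , ∈⊤ˢ t , inj₂ (∈∩ t (Vecₚ.[]=⇒lookup q) p)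
      ; coverEdge = λ u v p q e → let (t , x , y) = coversEdge u v e in t , ∈⊤ˢ t ,
          inj₂ (inj₂ (∈∩ t (Vecₚ.[]=⇒lookup x) p , ∈∩ t (Vecₚ.[]=⇒lookup y) q))
      })
      where
      b : Fin nodes → Subset n
      b t = bag t ∩ U

      open Separation G tree (proj₂ (proj₂ isTree)) U b (λ s → ∩-⊑ʳ (bag s) U) (suc width) (ℓ * suc width) ℓ
        (λ s → ℕₚ.≤-trans (⊑⇒∣∣≤ (b s) (bag s) (∩-⊑ˡ (bag s) U)) (bag≤ s)) size (treedepth ℓ)

      ∈⊤ˢ : ∀ t → lookup (⊤ˢ {nodes}) t ≡ true
      ∈⊤ˢ t = Vecₚ.lookup-replicate t true

      ∈∩ : ∀ t {v} → lookup (bag t) v ≡ true → lookup U v ≡ true → lookup (b t) v ≡ true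
      ∈∩ t {v} p q = trans (lookup-∩ (bag t) U v) (cong₂ _∧_ p q)

      root : Fin nodes
      root with nodes | proj₁ isTree
      ... | suc _ | _ = zero

      toWalk : ∀ {s t} → Star (Graph.Adjacent tree) s t → Walk tree (λ s → lookup (⊤ˢ {nodes}) s ≡ true) s t
      toWalk ε       = stop
      toWalk (e ◅ w) = step e (∈⊤ˢ _) (toWalk w)

      bags : ∀ v → ConnectedOn tree (λ s → lookup (⊤ˢ {nodes}) s ≡ true × lookup (b s) v ≡ true)
      bags v s s′ (_ , p) (_ , q) with member X s (X∋ s p) | member X s′ (X∋ s′ q)
        where
        X = tabulate λ t → lookup (bag t) v
        X∋ : ∀ s → lookup (b s) v ≡ true → lookup X s ≡ true
        X∋ s p = trans (Vecₚ.lookup∘tabulate _ s) (∩-⊑ˡ (bag s) U v p)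
      ... | i , refl | j , refl = go (bagsConnected v i j)
        where
        X = tabulate λ t → lookup (bag t) v
        go : ∀ {i j} → Star (Graph.Adjacent (induced tree X)) i j →
          Walk tree (λ s → lookup (⊤ˢ {nodes}) s ≡ true × lookup (b s) v ≡ true) (lookup (members X) i) (lookup (members X) j)
        go ε = stop
        go {i} (_◅_ {j = j} e w) = step e (∈⊤ˢ _ , ∈∩ _ (trans (sym (Vecₚ.lookup∘tabulate _ (lookup (members X) j))) (lookup-members X j)) (∩-⊑ʳ (bag s) U v p)) (go w)

-- Ordered-field arithmetic and weighted finite sums.

module Reals (ℝ : CompleteOrderedField) where

  open import Data.Integer.Base using (+_)

  open RealOperations ℝ public

  open PosetReasoning poset public
  open CommutativeRing commutativeRing public using (-‿cong) renaming (sym to ≈-sym; refl to ≈-refl; trans to ≈-trans; reflexive to ≈-reflexive)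
  open RingProperties ring using (-‿distribˡ-*; -‿distribʳ-*; -‿involutive; -0#≈0#)
  open AbelianGroupProperties (CommutativeRing.+-abelianGroup commutativeRing) using () renaming (⁻¹-∙-comm to -‿+-comm)
  open MultProperties semiring public using (×-homo-+; ×1-homo-*)

  -- Integer coefficients let the ring solver compute with numerals over the abstract field. The
  -- solver's numeral one is thereby `fromℕ 1`, that is `1# + 0#`, and not `1#`.
  fromℤ : ℤ → Carrier
  fromℤ (+ n)      = fromℕ n
  fromℤ (-[1+ n ]) = - fromℕ (suc n)

  fromℤ-⊖ : ∀ m n → fromℤ (m ℤ.⊖ n) ≈ fromℕ m + - fromℕ n
  fromℤ-⊖ m zero = begin-equality
    fromℕ m         ≈⟨ +-identityʳ _ ⟨
    fromℕ m + 0#    ≈⟨ +-congˡ -0#≈0# ⟨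
    fromℕ m + - 0#  ∎
  fromℤ-⊖ zero (suc n) = ≈-sym (+-identityˡ _)
  fromℤ-⊖ (suc m) (suc n) = begin-equality
    fromℤ (suc m ℤ.⊖ suc n)                    ≡⟨ ≡.cong fromℤ (ℤₚ.[1+m]⊖[1+n]≡m⊖n m n) ⟩
    fromℤ (m ℤ.⊖ n)                            ≈⟨ fromℤ-⊖ m n ⟩
    fromℕ m + - fromℕ n                        ≈⟨ +-congʳ (x+z-z≈x (fromℕ m) 1#) ⟨
    fromℕ m + 1# + - 1# + - fromℕ n            ≈⟨ +-assoc _ _ _ ⟩
    fromℕ m + 1# + (- 1# + - fromℕ n)          ≈⟨ +-cong (+-comm _ _) (-‿+-comm 1# (fromℕ n)) ⟩
    fromℕ (suc m) + - fromℕ (suc n)            ∎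

  fromℤ-+ : ∀ i j → fromℤ (i ℤ.+ j) ≈ fromℤ i + fromℤ j
  fromℤ-+ (+ m)      (+ n)      = ×-homo-+ 1# m n
  fromℤ-+ (+ m)      (-[1+ n ]) = fromℤ-⊖ m (suc n)
  fromℤ-+ (-[1+ m ]) (+ n)      = ≈-trans (fromℤ-⊖ n (suc m)) (+-comm _ _)
  fromℤ-+ (-[1+ m ]) (-[1+ n ]) = begin-equality
    - fromℕ (suc (suc (m ℕ.+ n)))       ≡⟨ ≡.cong (λ k → - fromℕ k) (≡.sym (ℕₚ.+-suc (suc m) n)) ⟩
    - fromℕ (suc m ℕ.+ suc n)           ≈⟨ -‿cong (×-homo-+ 1# (suc m) (suc n)) ⟩
    - (fromℕ (suc m) + fromℕ (suc n))   ≈⟨ -‿+-comm _ _ ⟨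
    - fromℕ (suc m) + - fromℕ (suc n)   ∎

  fromℤ-◃ : ∀ n → fromℤ (Sign.- ℤ.◃ n) ≈ - fromℕ n
  fromℤ-◃ zero    = ≈-sym -0#≈0#
  fromℤ-◃ (suc n) = ≈-refl

  fromℤ-* : ∀ i j → fromℤ (i ℤ.* j) ≈ fromℤ i * fromℤ j
  fromℤ-* (+ m) (+ n) = ≈-trans (≈-reflexive (≡.cong fromℤ (ℤₚ.+◃n≡+n (m ℕ.* n)))) (×1-homo-* m n)
  fromℤ-* (+ m) (-[1+ n ]) = begin-equality
    fromℤ (Sign.- ℤ.◃ (m ℕ.* suc n)) ≈⟨ fromℤ-◃ (m ℕ.* suc n) ⟩
    - fromℕ (m ℕ.* suc n)            ≈⟨ -‿cong (×1-homo-* m (suc n)) ⟩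
    - (fromℕ m * fromℕ (suc n))      ≈⟨ -‿distribʳ-* _ _ ⟩
    fromℕ m * - fromℕ (suc n)        ∎
  fromℤ-* (-[1+ m ]) (+ n) = begin-equality
    fromℤ (Sign.- ℤ.◃ (suc m ℕ.* n)) ≈⟨ fromℤ-◃ (suc m ℕ.* n) ⟩
    - fromℕ (suc m ℕ.* n)            ≈⟨ -‿cong (×1-homo-* (suc m) n) ⟩
    - (fromℕ (suc m) * fromℕ n)      ≈⟨ -‿distribˡ-* _ _ ⟩
    - fromℕ (suc m) * fromℕ n        ∎
  fromℤ-* (-[1+ m ]) (-[1+ n ]) = begin-equality
    fromℕ (suc m ℕ.* suc n)               ≈⟨ ×1-homo-* (suc m) (suc n) ⟩
    fromℕ (suc m) * fromℕ (suc n)         ≈⟨ -‿involutive _ ⟨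
    - (- (fromℕ (suc m) * fromℕ (suc n))) ≈⟨ -‿cong (-‿distribˡ-* _ _) ⟩
    - (- fromℕ (suc m) * fromℕ (suc n))   ≈⟨ -‿distribʳ-* _ _ ⟩
    - fromℕ (suc m) * - fromℕ (suc n)     ∎

  fromℤ-neg : ∀ i → fromℤ (ℤ.- i) ≈ - fromℤ i
  fromℤ-neg (+ zero)   = ≈-sym -0#≈0#
  fromℤ-neg (+ suc n)  = ≈-refl
  fromℤ-neg (-[1+ n ]) = ≈-sym (-‿involutive _)

  fromℤ-morphism : ℤ.+-*-rawRing -Raw-AlmostCommutative⟶ fromCommutativeRing commutativeRing
  fromℤ-morphism = record
    { ⟦_⟧ = fromℤ ; +-homo = fromℤ-+ ; *-homo = fromℤ-* ; -‿homo = fromℤ-neg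
    ; 0-homo = ≈-refl ; 1-homo = +-identityʳ 1# }

  coefficient≟ : ∀ i j → Maybe (fromℤ i ≈ fromℤ j)
  coefficient≟ i j with i ℤₚ.≟ j
  ... | yes e = just (≈-reflexive (≡.cong fromℤ e))
  ... | no  _ = nothing

  module Solver = RingSolver ℤ.+-*-rawRing (fromCommutativeRing commutativeRing) fromℤ-morphism coefficient≟
  open Solver public using (solve; con; _:=_; _:+_; _:*_; _:-_; :-_)

  sq : Carrier → Carrier
  sq x = x * x

  sq-cong : ∀ {x y} → x ≈ y → sq x ≈ sq y
  sq-cong e = *-cong e e

  sq-neg : ∀ x → sq (- x) ≈ sq x
  sq-neg = solve 1 (λ x → (:- x) :* (:- x) := x :* x) ≈-refl

  0≤-x : ∀ {x} → x ≤ 0# → 0# ≤ - x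
  0≤-x {x} p = ≤-trans (x≤y⇒0≤y-x p) (≤-reflexive (+-identityˡ (- x)))

  sq-nonNeg : ∀ x → 0# ≤ sq x
  sq-nonNeg x with total 0# x
  ... | inj₁ p = *-nonNeg p p
  ... | inj₂ p = ≤-trans (*-nonNeg (0≤-x p) (0≤-x p)) (≤-reflexive (sq-neg x))

  *-monoʳ-≤ : ∀ {z x y} → 0# ≤ z → x ≤ y → z * x ≤ z * y
  *-monoʳ-≤ {z} {x} {y} 0≤z p = begin
    z * x ≈⟨ *-comm z x ⟩
    x * z ≤⟨ *-monoˡ-≤ 0≤z p ⟩
    y * z ≈⟨ *-comm y z ⟩
    z * y ∎

  +-monoʳ-≤ : ∀ z {x y} → x ≤ y → z + x ≤ z + y
  +-monoʳ-≤ z p = +-mono-≤ ≤-refl p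

  +-nonNeg : ∀ {x y} → 0# ≤ x → 0# ≤ y → 0# ≤ x + y
  +-nonNeg {x} {y} p q = ≤-trans (≤-reflexive (≈-sym (+-identityˡ 0#))) (+-mono-≤ p q)

  x≤x+y : ∀ {x y} → 0# ≤ y → x ≤ x + y
  x≤x+y {x} {y} p = ≤-trans (≤-reflexive (≈-sym (+-identityʳ x))) (+-monoʳ-≤ x p)

  y≤x+y : ∀ {x y} → 0# ≤ x → y ≤ x + y
  y≤x+y {x} {y} p = ≤-trans (x≤x+y p) (≤-reflexive (+-comm y x))

  0≤y-x⇒x≤y : ∀ {x y} → 0# ≤ y - x → x ≤ y
  0≤y-x⇒x≤y {x} {y} p = begin
    x           ≈⟨ +-identityˡ x ⟨
    0# + x      ≤⟨ +-monoˡ-≤ x p ⟩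
    y - x + x   ≈⟨ x-z+z≈x y x ⟩
    y           ∎

  ⁻¹-inverseˡ : ∀ {x} → 0# < x → x ⁻¹ * x ≈ 1#
  ⁻¹-inverseˡ {x} p = ≈-trans (*-comm _ _) (⁻¹-inverseʳ (>⇒≉0 p))

  0≤½ : 0# ≤ ½
  0≤½ = proj₁ (⁻¹-pos 0<2)

  module Min = NaturalMin totalOrder
  module Max = NaturalMax totalOrder

  ⊓-distribʳ-* : ∀ {z} x y → 0# ≤ z → (x ⊓ y) * z ≈ (x * z) ⊓ (y * z)
  ⊓-distribʳ-* {z} x y 0≤z = cases (total x y)
    where
    cases : x ≤ y ⊎ y ≤ x → (x ⊓ y) * z ≈ (x * z) ⊓ (y * z)
    cases (inj₁ p) = ≈-trans (*-congʳ (Min.x≤y⇒x⊓y≈x p)) (≈-sym (Min.x≤y⇒x⊓y≈x (*-monoˡ-≤ 0≤z p)))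
    cases (inj₂ p) = ≈-trans (*-congʳ (Min.x≤y⇒y⊓x≈x p)) (≈-sym (Min.x≤y⇒y⊓x≈x (*-monoˡ-≤ 0≤z p)))

  -- A sum over a finite index set; In singles out the indices that occur.
  record Summation (A : Set) : Set₁ where
    field
      In    : A → Set
      ∫     : (A → Carrier) → Carrier
      mono  : ∀ {f g} → (∀ a → In a → f a ≤ g a) → ∫ f ≤ ∫ g
      add   : ∀ f g → ∫ (λ a → f a + g a) ≈ ∫ f + ∫ g
      scale : ∀ c f → ∫ (λ a → c * f a) ≈ c * ∫ f

    cong : ∀ {f g} → (∀ a → In a → f a ≈ g a) → ∫ f ≈ ∫ g
    cong p = antisym (mono λ a i → ≤-reflexive (p a i)) (mono λ a i → ≤-reflexive (≈-sym (p a i)))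

    scaleʳ : ∀ c f → ∫ (λ a → f a * c) ≈ ∫ f * c
    scaleʳ c f = begin-equality
      ∫ (λ a → f a * c) ≈⟨ cong (λ a _ → *-comm (f a) c) ⟩
      ∫ (λ a → c * f a) ≈⟨ scale c f ⟩
      c * ∫ f           ≈⟨ *-comm c (∫ f) ⟩
      ∫ f * c           ∎

    ∫0 : ∫ (λ _ → 0#) ≈ 0#
    ∫0 = begin-equality
      ∫ (λ _ → 0#)      ≈⟨ cong (λ _ _ → ≈-sym (zeroˡ 0#)) ⟩
      ∫ (λ _ → 0# * 0#) ≈⟨ scale 0# (λ _ → 0#) ⟩
      0# * ∫ (λ _ → 0#) ≈⟨ zeroˡ _ ⟩
      0#                ∎

    nonNeg : ∀ {f} → (∀ a → In a → 0# ≤ f a) → 0# ≤ ∫ f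
    nonNeg p = ≤-trans (≤-reflexive (≈-sym ∫0)) (mono p)

    neg : ∀ f → ∫ (λ a → - f a) ≈ - ∫ f
    neg f = begin-equality
      ∫ (λ a → - f a)      ≈⟨ cong (λ a _ → solve 1 (λ x → :- x := (:- con (+ 1)) :* x) ≈-refl (f a)) ⟩
      ∫ (λ a → - fromℕ 1 * f a) ≈⟨ scale (- fromℕ 1) f ⟩
      - fromℕ 1 * ∫ f          ≈⟨ solve 1 (λ x → (:- con (+ 1)) :* x := :- x) ≈-refl (∫ f) ⟩
      - ∫ f                ∎

    sub : ∀ f g → ∫ (λ a → f a - g a) ≈ ∫ f - ∫ g
    sub f g = ≈-trans (add f (λ a → - g a)) (+-congˡ (neg g))

    module Weighted (w : A → Carrier) (w≥0 : ∀ a → In a → 0# ≤ w a) (W>0 : 0# < ∫ w) where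

      W : Carrier
      W = ∫ w

      mean : (A → Carrier) → Carrier
      mean f = W ⁻¹ * ∫ (λ a → w a * f a)

      W*mean : ∀ f → W * mean f ≈ ∫ (λ a → w a * f a)
      W*mean f = begin-equality
        W * (W ⁻¹ * ∫ (λ a → w a * f a)) ≈⟨ *-assoc _ _ _ ⟨
        W * W ⁻¹ * ∫ (λ a → w a * f a)   ≈⟨ *-congʳ (⁻¹-inverseʳ (>⇒≉0 W>0)) ⟩
        1# * ∫ (λ a → w a * f a)         ≈⟨ *-identityˡ _ ⟩
        ∫ (λ a → w a * f a)              ∎

      deviation : (A → Carrier) → Carrier → Carrier
      deviation f c = ∫ (λ a → w a * sq (f a - c))

      deviation-nonNeg : ∀ f c → 0# ≤ deviation f c
      deviation-nonNeg f c = nonNeg λ a i → *-nonNeg (w≥0 a i) (sq-nonNeg _)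

      -- Expanding around the mean, the cross term is a multiple of the weighted sum of f minus its
      -- mean, which vanishes. Both minimality of the mean (`deviation-mean`) and `jensen`, where c
      -- is zero, are read off from this.
      deviation-split : ∀ f c → deviation f c ≈ deviation f (mean f) + W * sq (mean f - c)
      deviation-split f c = begin-equality
        deviation f c
          ≈⟨ cong (λ a _ → solve 4 (λ w f c m → w :* ((f :- c) :* (f :- c))
               := w :* ((f :- m) :* (f :- m)) :+ (con (+ 2) :* (m :- c) :* (w :* f)
                  :+ ((m :- c) :* (m :- c) :- con (+ 2) :* (m :- c) :* m) :* w)) ≈-refl (w a) (f a) c m) ⟩
        ∫ (λ a → w a * sq (f a - m) + (2# * (m - c) * (w a * f a) + (sq (m - c) - 2# * (m - c) * m) * w a))
          ≈⟨ ≈-trans (add _ _) (+-congˡ (≈-trans (add _ _) (+-cong (scale _ _) (scale _ _)))) ⟩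
        deviation f m + (2# * (m - c) * ∫ (λ a → w a * f a) + (sq (m - c) - 2# * (m - c) * m) * W)
          ≈⟨ +-congˡ (+-congʳ (*-congˡ (≈-sym (W*mean f)))) ⟩
        deviation f m + (2# * (m - c) * (W * m) + (sq (m - c) - 2# * (m - c) * m) * W)
          ≈⟨ solve 4 (λ d m c W → d :+ (con (+ 2) :* (m :- c) :* (W :* m)
                :+ ((m :- c) :* (m :- c) :- con (+ 2) :* (m :- c) :* m) :* W)
               := d :+ W :* ((m :- c) :* (m :- c))) ≈-refl (deviation f m) m c W ⟩
        deviation f m + W * sq (m - c) ∎
        where m = mean f

      deviation-mean : ∀ f c → deviation f (mean f) ≤ deviation f c
      deviation-mean f c = ≤-trans (x≤x+y (*-nonNeg (proj₁ W>0) (sq-nonNeg _))) (≤-reflexive (≈-sym (deviation-split f c)))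

      jensen : ∀ f → W * sq (mean f) ≤ ∫ (λ a → w a * sq (f a))
      jensen f = begin
        W * sq (mean f)                             ≈⟨ *-congˡ (sq-cong (x-0≈x (mean f))) ⟨
        W * sq (mean f - 0#)                        ≤⟨ y≤x+y (deviation-nonNeg f (mean f)) ⟩
        deviation f (mean f) + W * sq (mean f - 0#) ≈⟨ deviation-split f 0# ⟨
        deviation f 0#                              ≈⟨ cong (λ a _ → *-congˡ (sq-cong (x-0≈x (f a)))) ⟩
        ∫ (λ a → w a * sq (f a)) ∎
        where
        x-0≈x : ∀ x → x - 0# ≈ x
        x-0≈x = solve 1 (λ x → x :- con (+ 0) := x) ≈-refl

      mean-sub : ∀ f g → mean (λ a → f a - g a) ≈ mean f - mean g
      mean-sub f g = begin-equality
        W ⁻¹ * ∫ (λ a → w a * (f a - g a))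
          ≈⟨ *-congˡ (cong λ a _ → solve 3 (λ w f g → w :* (f :- g) := w :* f :- w :* g) ≈-refl (w a) (f a) (g a)) ⟩
        W ⁻¹ * ∫ (λ a → w a * f a - w a * g a)
          ≈⟨ *-congˡ (sub _ _) ⟩
        W ⁻¹ * (∫ (λ a → w a * f a) - ∫ (λ a → w a * g a))
          ≈⟨ solve 3 (λ w f g → w :* (f :- g) := w :* f :- w :* g) ≈-refl _ _ _ ⟩
        mean f - mean g ∎

      cauchySchwarz : ∀ f → sq (∫ (λ a → w a * f a)) ≤ W * ∫ (λ a → w a * sq (f a))
      cauchySchwarz f = begin
        sq (∫ (λ a → w a * f a)) ≈⟨ sq-cong (W*mean f) ⟨
        sq (W * mean f)          ≈⟨ solve 2 (λ W m → (W :* m) :* (W :* m) := W :* (W :* (m :* m))) ≈-refl W (mean f) ⟩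
        W * (W * sq (mean f))    ≤⟨ *-monoʳ-≤ (proj₁ W>0) (jensen f) ⟩
        W * ∫ (λ a → w a * sq (f a)) ∎

-- Poincaré inequalities on the cube of subsets.

module Cube (ℝ : CompleteOrderedField) where

  open import Data.Integer.Base using (+_)
  open Reals ℝ
  open Subsets
  open import Data.Vec.Base using ([]; _∷_)

  private
    variable
      n : ℕ

  -- Recursion on U, with summands that still take subsets of the whole vertex set, turns the
  -- splitting over disjoint unions and the reindexing by a flip into structural inductions.
  ∑⊆ : Subset n → (Subset n → Carrier) → Carrier
  ∑⊆ []          f = f []
  ∑⊆ (false ∷ U) f = ∑⊆ U (f ∘ (false ∷_))
  ∑⊆ (true ∷ U)  f = ∑⊆ U (f ∘ (false ∷_)) + ∑⊆ U (f ∘ (true ∷_))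

  extend-⊑ : ∀ {S U : Subset n} b → S ⊑ U → b ∷ S ⊑ true ∷ U
  extend-⊑ b p zero    q = refl
  extend-⊑ b p (suc v) q = p v q

  extend-⊑′ : ∀ {S U : Subset n} → S ⊑ U → false ∷ S ⊑ false ∷ U
  extend-⊑′ p (suc v) q = p v q

  +-interchange : ∀ a b c d → (a + b) + (c + d) ≈ (a + c) + (b + d)
  +-interchange = solve 4 (λ a b c d → (a :+ b) :+ (c :+ d) := (a :+ c) :+ (b :+ d)) ≈-refl

  ∑⊆-mono : ∀ (U : Subset n) {f g} → (∀ S → S ⊑ U → f S ≤ g S) → ∑⊆ U f ≤ ∑⊆ U g
  ∑⊆-mono []          p = p [] (λ ())
  ∑⊆-mono (false ∷ U) p = ∑⊆-mono U λ S q → p _ (extend-⊑′ {S = S} {U} q)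
  ∑⊆-mono (true ∷ U)  p = +-mono-≤ (∑⊆-mono U λ S q → p _ (extend-⊑ {S = S} {U} false q))
                                   (∑⊆-mono U λ S q → p _ (extend-⊑ {S = S} {U} true q))

  ∑⊆-add : ∀ (U : Subset n) f g → ∑⊆ U (λ S → f S + g S) ≈ ∑⊆ U f + ∑⊆ U g
  ∑⊆-add []          f g = ≈-refl
  ∑⊆-add (false ∷ U) f g = ∑⊆-add U _ _
  ∑⊆-add (true ∷ U)  f g = ≈-trans (+-cong (∑⊆-add U _ _) (∑⊆-add U _ _)) (+-interchange _ _ _ _)

  ∑⊆-scale : ∀ (U : Subset n) c f → ∑⊆ U (λ S → c * f S) ≈ c * ∑⊆ U f
  ∑⊆-scale []          c f = ≈-refl
  ∑⊆-scale (false ∷ U) c f = ∑⊆-scale U c _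
  ∑⊆-scale (true ∷ U)  c f = ≈-trans (+-cong (∑⊆-scale U c _) (∑⊆-scale U c _)) (≈-sym (distribˡ c _ _))

  subsetSum : Subset n → Summation (Subset n)
  subsetSum U = record { In = _⊑ U ; ∫ = ∑⊆ U ; mono = ∑⊆-mono U ; add = ∑⊆-add U ; scale = ∑⊆-scale U }

  module Sub {n} (U : Subset n) = Summation (subsetSum U)

  finSum : ∀ n → Summation (Fin n)
  finSum n = record
    { In    = λ _ → ⊤
    ; ∫     = sum
    ; mono  = λ p → sum-mono λ i → p i tt
    ; add   = CMSum.∑-distrib-+ (CommutativeRing.+-commutativeMonoid commutativeRing)
    ; scale = λ c f → ≈-sym (SemiringSum.*-distribˡ-sum semiring c f)
    }
    where
    sum-mono : ∀ {n} {f g : Fin n → Carrier} → (∀ i → f i ≤ g i) → sum f ≤ sum g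
    sum-mono {zero}  p = ≤-refl
    sum-mono {suc n} p = +-mono-≤ (p zero) (sum-mono λ i → p (suc i))

  module Fins (n : ℕ) = Summation (finSum n)

  ≤sum : ∀ {n} (f : Fin n → Carrier) → (∀ i → 0# ≤ f i) → ∀ i → f i ≤ sum f
  ≤sum f p zero    = x≤x+y (Fins.nonNeg _ λ i _ → p (suc i))
  ≤sum f p (suc i) = ≤-trans (≤sum (f ∘ suc) (λ i → p (suc i)) i) (y≤x+y (p zero))

  ∑⊆-exchange : ∀ {A : Set} (B : Summation A) (U : Subset n) (f : Subset n → A → Carrier) →
    ∑⊆ U (λ S → Summation.∫ B (f S)) ≈ Summation.∫ B (λ a → ∑⊆ U (λ S → f S a))
  ∑⊆-exchange B []          f = ≈-refl
  ∑⊆-exchange B (false ∷ U) f = ∑⊆-exchange B U _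
  ∑⊆-exchange B (true ∷ U)  f =
    ≈-trans (+-cong (∑⊆-exchange B U _) (∑⊆-exchange B U _)) (≈-sym (Summation.add B _ _))

  ∑⊆-pos : ∀ (U : Subset n) {f} → (∀ S → 0# < f S) → 0# < ∑⊆ U f
  ∑⊆-pos []          p = p []
  ∑⊆-pos (false ∷ U) p = ∑⊆-pos U (λ S → p _)
  ∑⊆-pos (true ∷ U)  p = <-≤-trans (∑⊆-pos U (λ S → p _)) (x≤x+y (proj₁ (∑⊆-pos U (λ S → p _))))

  ∑⊆-⊕ : ∀ (U V : Subset n) → Disjoint U V → ∀ f → ∑⊆ (U ⊕ V) f ≈ ∑⊆ V (λ T → ∑⊆ U (λ S → f (S ⊕ T)))
  ∑⊆-⊕ []          []          d f = ≈-refl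
  ∑⊆-⊕ (false ∷ U) (false ∷ V) d f = ∑⊆-⊕ U V (d ∘ suc) _
  ∑⊆-⊕ (false ∷ U) (true ∷ V)  d f = +-cong (∑⊆-⊕ U V (d ∘ suc) _) (∑⊆-⊕ U V (d ∘ suc) _)
  ∑⊆-⊕ (true ∷ U)  (false ∷ V) d f =
    ≈-trans (+-cong (∑⊆-⊕ U V (d ∘ suc) _) (∑⊆-⊕ U V (d ∘ suc) _)) (≈-sym (∑⊆-add V _ _))
  ∑⊆-⊕ (true ∷ U)  (true ∷ V)  d f = true≢false refl (d zero refl)

  ∑⊆-flip : ∀ (U : Subset n) v → lookup U v ≡ true → ∀ f → ∑⊆ U (λ S → f (S ⊕ ⁅ v ⁆)) ≈ ∑⊆ U f
  ∑⊆-flip (true ∷ U) zero p f = ≈-trans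
    (+-cong (Sub.cong U λ S _ → ≈-reflexive (≡.cong (λ T → f (true ∷ T)) (⊕-identityʳ S)))
            (Sub.cong U λ S _ → ≈-reflexive (≡.cong (λ T → f (false ∷ T)) (⊕-identityʳ S))))
    (+-comm _ _)
  ∑⊆-flip (false ∷ U) (suc v) p f = ∑⊆-flip U v p _
  ∑⊆-flip (true ∷ U)  (suc v) p f = +-cong (∑⊆-flip U v p _) (∑⊆-flip U v p _)

  ∑⊆-∅ : ∀ (f : Subset n → Carrier) → ∑⊆ ∅ f ≈ f ∅
  ∑⊆-∅ {zero}  f = ≈-refl
  ∑⊆-∅ {suc n} f = ∑⊆-∅ (f ∘ (false ∷_))

  ∑⊆-⁅⁆ : ∀ (v : Fin n) f → ∑⊆ ⁅ v ⁆ f ≈ f ∅ + f ⁅ v ⁆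
  ∑⊆-⁅⁆ zero    f = +-cong (∑⊆-∅ (f ∘ (false ∷_))) (∑⊆-∅ (f ∘ (true ∷_)))
  ∑⊆-⁅⁆ (suc v) f = ∑⊆-⁅⁆ v _

  flip-⊑ : ∀ (S U : Subset n) v → lookup U v ≡ true → S ⊑ U → S ⊕ ⁅ v ⁆ ⊑ U
  flip-⊑ S U v v∈U S⊑U u p with ∈⊕⁻ S ⁅ v ⁆ u p
  ... | inj₁ q = S⊑U u q
  ... | inj₂ q = subst (λ x → lookup U x ≡ true) (≡.sym (lookup-⁅⁆⇒≡ u v q)) v∈U

  -- The minimum is w S times the Metropolis acceptance probability min(1, w (S ⊕ v) / w S), written
  -- without division; it is symmetric under the flip. Each pair of sets differing in v is counted
  -- twice.
  edge : Subset n → (Subset n → Carrier) → (Subset n → Carrier) → Fin n → Carrier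
  edge U w f v = ∑⊆ U (λ S → (w S ⊓ w (S ⊕ ⁅ v ⁆)) * sq (f S - f (S ⊕ ⁅ v ⁆)))

  -- Makes every energy a sum over all vertices, so that energies on U, on V and on U ⊕ V can be
  -- compared summand by summand.
  edgeWithin : Subset n → (Subset n → Carrier) → (Subset n → Carrier) → Fin n → Carrier
  edgeWithin U w f v = if lookup U v then edge U w f v else 0#

  -- The Dirichlet form of the chain on the subsets of U (up to a factor).
  energy : Subset n → (Subset n → Carrier) → (Subset n → Carrier) → Carrier
  energy U w f = sum (edgeWithin U w f)

  -- A spectral gap for an unnormalised weight. The centre c is existential rather than the mean, so
  -- a comparison of weights can reuse it; `deviation-mean` leads back to the variance.
  Poincaré : Subset n → (Subset n → Carrier) → Carrier → Set
  Poincaré U w C = ∀ f → ∃[ c ] ∑⊆ U (λ S → w S * sq (f S - c)) ≤ C * energy U w f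

  edgeWithin-∈ : ∀ (U : Subset n) w f {v} → lookup U v ≡ true → edgeWithin U w f v ≡ edge U w f v
  edgeWithin-∈ U w f p rewrite p = refl

  ⊓-nonNeg : ∀ {x y} → 0# ≤ x → 0# ≤ y → 0# ≤ x ⊓ y
  ⊓-nonNeg p q = Min.⊓-glb p q

  edge-nonNeg : ∀ (U : Subset n) {w} f → (∀ S → 0# < w S) → ∀ v → 0# ≤ edge U w f v
  edge-nonNeg U f w>0 v = Sub.nonNeg U λ S _ → *-nonNeg (⊓-nonNeg (proj₁ (w>0 _)) (proj₁ (w>0 _))) (sq-nonNeg _)

  edgeWithin-nonNeg : ∀ (U : Subset n) {w} f → (∀ S → 0# < w S) → ∀ v → 0# ≤ edgeWithin U w f v
  edgeWithin-nonNeg U f w>0 v with lookup U v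
  ... | true  = edge-nonNeg U f w>0 v
  ... | false = ≤-refl

  energy-nonNeg : ∀ (U : Subset n) {w} f → (∀ S → 0# < w S) → 0# ≤ energy U w f
  energy-nonNeg {n = n} U f w>0 = Fins.nonNeg n λ v _ → edgeWithin-nonNeg U f w>0 v

  poincaré-∅ : ∀ {w : Subset n → Carrier} {C} → 0# ≤ C → (∀ S → 0# < w S) → Poincaré ∅ w C
  poincaré-∅ {w = w} {C} C≥0 w>0 f = f ∅ , (begin
    ∑⊆ ∅ (λ S → w S * sq (f S - f ∅)) ≈⟨ ∑⊆-∅ (λ S → w S * sq (f S - f ∅)) ⟩
    w ∅ * sq (f ∅ - f ∅)              ≈⟨ solve 2 (λ w f → w :* ((f :- f) :* (f :- f)) := con (+ 0)) ≈-refl (w ∅) (f ∅) ⟩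
    0#                                ≤⟨ *-nonNeg C≥0 (energy-nonNeg ∅ f w>0) ⟩
    C * energy ∅ w f                  ∎)

  -- On two points the constant is chosen to be the value at the heavier one.
  poincaré-⁅⁆ : ∀ {w : Subset n → Carrier} (v : Fin n) → (∀ S → 0# < w S) → Poincaré ⁅ v ⁆ w 1#
  poincaré-⁅⁆ {w = w} v w>0 f = cases (total (w ∅) (w ⁅ v ⁆))
    where
    x = f ∅
    y = f ⁅ v ⁆
    a = w ∅
    b = w ⁅ v ⁆

    enough : (a ⊓ b) * sq (x - y) ≤ 1# * energy ⁅ v ⁆ w f
    enough = begin
      (a ⊓ b) * sq (x - y)
        ≡⟨ ≡.cong (λ S → (a ⊓ w S) * sq (x - f S)) (≡.trans (≡.sym (⊕-identityʳ _)) (⊕-comm _ _)) ⟩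
      (a ⊓ w (∅ ⊕ ⁅ v ⁆)) * sq (x - f (∅ ⊕ ⁅ v ⁆))
        -- The summand at the empty set is enough; the other orientation of the same edge is
        -- dropped.
        ≤⟨ x≤x+y (*-nonNeg (⊓-nonNeg (proj₁ (w>0 _)) (proj₁ (w>0 _))) (sq-nonNeg _)) ⟩
      _ ≈⟨ ∑⊆-⁅⁆ v _ ⟨
      edge ⁅ v ⁆ w f v        ≡⟨ edgeWithin-∈ ⁅ v ⁆ w f (lookup-⁅x⁆ v) ⟨
      edgeWithin ⁅ v ⁆ w f v  ≤⟨ ≤sum _ (edgeWithin-nonNeg ⁅ v ⁆ f w>0) v ⟩
      energy ⁅ v ⁆ w f        ≈⟨ *-identityˡ _ ⟨
      1# * energy ⁅ v ⁆ w f   ∎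

    cases : a ≤ b ⊎ b ≤ a → ∃[ c ] ∑⊆ ⁅ v ⁆ (λ S → w S * sq (f S - c)) ≤ 1# * energy ⁅ v ⁆ w f
    cases (inj₁ a≤b) = y , (begin
      ∑⊆ ⁅ v ⁆ (λ S → w S * sq (f S - y))  ≈⟨ ∑⊆-⁅⁆ v _ ⟩
      a * sq (x - y) + b * sq (y - y)      ≈⟨ solve 4 (λ a b x y → a :* ((x :- y) :* (x :- y)) :+ b :* ((y :- y) :* (y :- y)) := a :* ((x :- y) :* (x :- y))) ≈-refl a b x y ⟩
      a * sq (x - y)                       ≈⟨ *-congʳ (Min.x≤y⇒x⊓y≈x a≤b) ⟨
      (a ⊓ b) * sq (x - y)                 ≤⟨ enough ⟩
      1# * energy ⁅ v ⁆ w f                ∎)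
    cases (inj₂ b≤a) = x , (begin
      ∑⊆ ⁅ v ⁆ (λ S → w S * sq (f S - x))  ≈⟨ ∑⊆-⁅⁆ v _ ⟩
      a * sq (x - x) + b * sq (y - x)      ≈⟨ solve 4 (λ a b x y → a :* ((x :- x) :* (x :- x)) :+ b :* ((y :- x) :* (y :- x)) := b :* ((x :- y) :* (x :- y))) ≈-refl a b x y ⟩
      b * sq (x - y)                       ≈⟨ *-congʳ (Min.x≤y⇒y⊓x≈x b≤a) ⟨
      (a ⊓ b) * sq (x - y)                 ≤⟨ enough ⟩
      1# * energy ⁅ v ⁆ w f                ∎)

  poincaré-mono : ∀ {U : Subset n} {w C D} → (∀ S → 0# < w S) → C ≤ D → Poincaré U w C → Poincaré U w D
  poincaré-mono {U = U} w>0 C≤D P f with P f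
  ... | c , p = c , ≤-trans p (*-monoˡ-≤ (energy-nonNeg U f w>0) C≤D)

  -- Perturbation in the manner of Holley and Stroock: with the same centre, passing from w to w′
  -- costs b in the deviation, and returning costs a in the energy.
  poincaré-compare : ∀ {U : Subset n} {w w′ C a b} → (∀ S → 0# < w S) → (∀ S → 0# < w′ S) → 0# ≤ a → 0# ≤ b → 0# ≤ C →
    (∀ S → S ⊑ U → w S ≤ b * w′ S) → (∀ S → S ⊑ U → w′ S ≤ a * w S) →
    Poincaré U w′ C → Poincaré U w (b * C * a)
  poincaré-compare {n = n} {U = U} {w} {w′} {C} {a} {b} w>0 w′>0 a≥0 b≥0 C≥0 w≤ w′≤ P f with P f
  ... | c , p = c , (begin
    ∑⊆ U (λ S → w S * sq (f S - c))        ≤⟨ ∑⊆-mono U (λ S q → *-monoˡ-≤ (sq-nonNeg _) (w≤ S q)) ⟩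
    ∑⊆ U (λ S → b * w′ S * sq (f S - c))   ≈⟨ Sub.cong U (λ S _ → *-assoc b (w′ S) _) ⟩
    ∑⊆ U (λ S → b * (w′ S * sq (f S - c))) ≈⟨ ∑⊆-scale U b _ ⟩
    b * ∑⊆ U (λ S → w′ S * sq (f S - c))   ≤⟨ *-monoʳ-≤ b≥0 p ⟩
    b * (C * energy U w′ f)                ≈⟨ *-assoc b C _ ⟨
    b * C * energy U w′ f                  ≤⟨ *-monoʳ-≤ (*-nonNeg b≥0 C≥0) energy≤ ⟩
    b * C * (a * energy U w f)             ≈⟨ *-assoc (b * C) a _ ⟨
    b * C * a * energy U w f               ∎)
    where
    min≤ : ∀ {x y x′ y′} → x′ ≤ a * x → y′ ≤ a * y → x′ ⊓ y′ ≤ a * (x ⊓ y)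
    min≤ {x} {y} {x′} {y′} p q = begin
      x′ ⊓ y′             ≤⟨ Min.⊓-mono-≤ p q ⟩
      (a * x) ⊓ (a * y)   ≈⟨ Min.⊓-cong (*-comm a x) (*-comm a y) ⟩
      (x * a) ⊓ (y * a)   ≈⟨ ⊓-distribʳ-* x y a≥0 ⟨
      (x ⊓ y) * a         ≈⟨ *-comm _ a ⟩
      a * (x ⊓ y)         ∎

    edgeWithin≤ : ∀ v → edgeWithin U w′ f v ≤ a * edgeWithin U w f v
    edgeWithin≤ v with lookup U v in e
    ... | false = ≤-reflexive (≈-sym (zeroʳ a))
    ... | true  = begin
      edge U w′ f v
        ≤⟨ ∑⊆-mono U (λ S q → *-monoˡ-≤ (sq-nonNeg _) (min≤ (w′≤ S q) (w′≤ (S ⊕ ⁅ v ⁆) (flip-⊑ S U v e q)))) ⟩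
      ∑⊆ U (λ S → a * (w S ⊓ w (S ⊕ ⁅ v ⁆)) * sq (f S - f (S ⊕ ⁅ v ⁆)))
        ≈⟨ Sub.cong U (λ S _ → *-assoc a _ _) ⟩
      _ ≈⟨ ∑⊆-scale U a _ ⟩
      a * edge U w f v ∎

    energy≤ : energy U w′ f ≤ a * energy U w f
    energy≤ = ≤-trans (Fins.mono n λ v _ → edgeWithin≤ v) (≤-reflexive (Fins.scale n a _))

  module Product {U V : Subset n} (disj : Disjoint U V) (w w₁ w₂ : Subset n → Carrier)
    (w₁>0 : ∀ S → 0# < w₁ S) (w₂>0 : ∀ S → 0# < w₂ S)
    (w≈ : ∀ S T → S ⊑ U → T ⊑ V → w (S ⊕ T) ≈ w₁ S * w₂ T) where

    -- A flip inside U leaves the factor `w₂ T` common to both weights, so it comes out of the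
    -- minimum.
    edge-factor : ∀ f {v} → lookup U v ≡ true →
      edge (U ⊕ V) w f v ≈ ∑⊆ V (λ T → w₂ T * edge U w₁ (λ S → f (S ⊕ T)) v)
    edge-factor f {v} v∈U = ≈-trans (∑⊆-⊕ U V disj _)
      (Sub.cong V λ T T⊑V → ≈-trans (Sub.cong U λ S S⊑U → term S T S⊑U T⊑V) (∑⊆-scale U (w₂ T) _))
      where
      term : ∀ S T → S ⊑ U → T ⊑ V →
        (w (S ⊕ T) ⊓ w (S ⊕ T ⊕ ⁅ v ⁆)) * sq (f (S ⊕ T) - f (S ⊕ T ⊕ ⁅ v ⁆))
        ≈ w₂ T * ((w₁ S ⊓ w₁ (S ⊕ ⁅ v ⁆)) * sq (f (S ⊕ T) - f (S ⊕ ⁅ v ⁆ ⊕ T)))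
      term S T S⊑U T⊑V rewrite ⊕-swapʳ S T ⁅ v ⁆ = begin-equality
        (w (S ⊕ T) ⊓ w (S ⊕ ⁅ v ⁆ ⊕ T)) * q
          ≈⟨ *-congʳ (Min.⊓-cong (w≈ S T S⊑U T⊑V) (w≈ _ T (flip-⊑ S U v v∈U S⊑U) T⊑V)) ⟩
        ((w₁ S * w₂ T) ⊓ (w₁ (S ⊕ ⁅ v ⁆) * w₂ T)) * q
          ≈⟨ *-congʳ (⊓-distribʳ-* _ _ (proj₁ (w₂>0 T))) ⟨
        (w₁ S ⊓ w₁ (S ⊕ ⁅ v ⁆)) * w₂ T * q
          ≈⟨ solve 3 (λ m w q → m :* w :* q := w :* (m :* q)) ≈-refl _ _ _ ⟩
        w₂ T * ((w₁ S ⊓ w₁ (S ⊕ ⁅ v ⁆)) * q) ∎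
        where q = sq (f (S ⊕ T) - f (S ⊕ ⁅ v ⁆ ⊕ T))

  module _ {U V : Subset n} (disj : Disjoint U V) (w w₁ w₂ : Subset n → Carrier)
    (w₁>0 : ∀ S → 0# < w₁ S) (w₂>0 : ∀ S → 0# < w₂ S)
    (w≈ : ∀ S T → S ⊑ U → T ⊑ V → w (S ⊕ T) ≈ w₁ S * w₂ T) where

    open Summation.Weighted (subsetSum U) w₁ (λ S _ → proj₁ (w₁>0 S)) (∑⊆-pos U w₁>0) using (W; mean; jensen; mean-sub; deviation-split; deviation-mean)

    private
      module P  = Product {U = U} {V} disj w w₁ w₂ w₁>0 w₂>0 w≈
      module P′ = Product {U = V} {U} (Disjoint-sym {S = U} {V} disj) w w₂ w₁ w₂>0 w₁>0
        (λ T S T⊑V S⊑U → ≈-trans (≈-reflexive (≡.cong w (⊕-comm T S))) (≈-trans (w≈ S T S⊑U T⊑V) (*-comm _ _)))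

    edge-factorʳ : ∀ f {v} → lookup V v ≡ true →
      edge (U ⊕ V) w f v ≈ ∑⊆ U (λ S → w₁ S * edge V w₂ (λ T → f (S ⊕ T)) v)
    edge-factorʳ f {v} v∈V = begin-equality
      edge (U ⊕ V) w f v                                        ≡⟨ ≡.cong (λ X → edge X w f v) (⊕-comm U V) ⟩
      edge (V ⊕ U) w f v                                        ≈⟨ P′.edge-factor f v∈V ⟩
      ∑⊆ U (λ S → w₁ S * edge V w₂ (λ T → f (T ⊕ S)) v)         ≈⟨ Sub.cong U (λ S _ → *-congˡ (Sub.cong V λ T _ →
        ≈-reflexive (≡.cong₂ (λ A B → (w₂ T ⊓ w₂ (T ⊕ ⁅ v ⁆)) * sq (f A - f B)) (⊕-comm T S) (⊕-comm _ S)))) ⟩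
      ∑⊆ U (λ S → w₁ S * edge V w₂ (λ T → f (S ⊕ T)) v)         ∎

    average : (Subset n → Carrier) → Subset n → Carrier
    average f T = mean (λ S → f (S ⊕ T))

    -- Convexity: for each T, `jensen` over S is applied to the difference of f across the flip of
    -- v.
    edge-average : ∀ f v → W * edge V w₂ (average f) v ≤ ∑⊆ U (λ S → w₁ S * edge V w₂ (λ T → f (S ⊕ T)) v)
    edge-average f v = begin
      W * edge V w₂ (average f) v
        ≈⟨ ∑⊆-scale V W _ ⟨
      ∑⊆ V (λ T → W * (e T * sq (average f T - average f (T ⊕ ⁅ v ⁆))))
        ≤⟨ ∑⊆-mono V (λ T _ → term T) ⟩
      ∑⊆ V (λ T → ∑⊆ U (λ S → w₁ S * (e T * sq (f (S ⊕ T) - f (S ⊕ (T ⊕ ⁅ v ⁆))))))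
        ≈⟨ ∑⊆-exchange (subsetSum U) V _ ⟩
      ∑⊆ U (λ S → ∑⊆ V (λ T → w₁ S * (e T * sq (f (S ⊕ T) - f (S ⊕ (T ⊕ ⁅ v ⁆))))))
        ≈⟨ Sub.cong U (λ S _ → ∑⊆-scale V (w₁ S) _) ⟩
      ∑⊆ U (λ S → w₁ S * edge V w₂ (λ T → f (S ⊕ T)) v) ∎
      where
      e : Subset n → Carrier
      e T = w₂ T ⊓ w₂ (T ⊕ ⁅ v ⁆)
      term : ∀ T → W * (e T * sq (average f T - average f (T ⊕ ⁅ v ⁆)))
        ≤ ∑⊆ U (λ S → w₁ S * (e T * sq (f (S ⊕ T) - f (S ⊕ (T ⊕ ⁅ v ⁆)))))
      term T = begin
        W * (e T * sq (average f T - average f T′))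
          ≈⟨ *-congˡ (*-congˡ (sq-cong (≈-sym (mean-sub _ _)))) ⟩
        W * (e T * sq (mean (λ S → f (S ⊕ T) - f (S ⊕ T′))))
          ≈⟨ solve 3 (λ W e m → W :* (e :* m) := e :* (W :* m)) ≈-refl W (e T) _ ⟩
        e T * (W * sq (mean (λ S → f (S ⊕ T) - f (S ⊕ T′))))
          ≤⟨ *-monoʳ-≤ (⊓-nonNeg (proj₁ (w₂>0 _)) (proj₁ (w₂>0 _))) (jensen _) ⟩
        e T * ∑⊆ U (λ S → w₁ S * sq (f (S ⊕ T) - f (S ⊕ T′)))
          ≈⟨ ∑⊆-scale U (e T) _ ⟨
        ∑⊆ U (λ S → e T * (w₁ S * sq (f (S ⊕ T) - f (S ⊕ T′))))
          ≈⟨ Sub.cong U (λ S _ → solve 3 (λ e w q → e :* (w :* q) := w :* (e :* q)) ≈-refl (e T) (w₁ S) _) ⟩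
        ∑⊆ U (λ S → w₁ S * (e T * sq (f (S ⊕ T) - f (S ⊕ T′)))) ∎
        where T′ = T ⊕ ⁅ v ⁆

    -- No vertex lies in both U and V, so at most one of the two summands on the left is nonzero:
    -- for v in U the bound is an equality, for v in V it is `edge-average`.
    edgeWithin-split : ∀ f v →
      ∑⊆ V (λ T → w₂ T * edgeWithin U w₁ (λ S → f (S ⊕ T)) v) + W * edgeWithin V w₂ (average f) v
      ≤ edgeWithin (U ⊕ V) w f v
    edgeWithin-split f v with lookup U v in u | lookup V v in p | lookup (U ⊕ V) v | lookup-⊕ U V v
    ... | true  | true  | _ | _ = true≢false p (disj v u)
    ... | true  | false | _ | e rewrite e = begin
      ∑⊆ V (λ T → w₂ T * edge U w₁ (λ S → f (S ⊕ T)) v) + W * 0# ≈⟨ +-cong (≈-sym (P.edge-factor f u)) (zeroʳ W) ⟩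
      edge (U ⊕ V) w f v + 0#                                    ≈⟨ +-identityʳ _ ⟩
      edge (U ⊕ V) w f v                                         ∎
    ... | false | true  | _ | e rewrite e = begin
      ∑⊆ V (λ T → w₂ T * 0#) + W * edge V w₂ (average f) v  ≈⟨ +-congʳ (≈-trans (Sub.cong V λ T _ → zeroʳ _) (Sub.∫0 V)) ⟩
      0# + W * edge V w₂ (average f) v                      ≈⟨ +-identityˡ _ ⟩
      W * edge V w₂ (average f) v                           ≤⟨ edge-average f v ⟩
      _                                                     ≈⟨ edge-factorʳ f p ⟨
      edge (U ⊕ V) w f v                                    ∎
    ... | false | false | _ | e rewrite e = begin
      ∑⊆ V (λ T → w₂ T * 0#) + W * 0#  ≈⟨ +-cong (≈-trans (Sub.cong V λ T _ → zeroʳ _) (Sub.∫0 V)) (zeroʳ W) ⟩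
      0# + 0#                          ≈⟨ +-identityˡ _ ⟩
      0#                               ∎

    energy-split : ∀ f →
      ∑⊆ V (λ T → w₂ T * energy U w₁ (λ S → f (S ⊕ T))) + W * energy V w₂ (average f) ≤ energy (U ⊕ V) w f
    energy-split f = begin
      ∑⊆ V (λ T → w₂ T * energy U w₁ (λ S → f (S ⊕ T))) + W * energy V w₂ (average f)
        ≈⟨ +-cong (Sub.cong V λ T _ → ≈-sym (Fins.scale n (w₂ T) _)) (≈-sym (Fins.scale n W _)) ⟩
      ∑⊆ V (λ T → sum (λ v → w₂ T * edgeWithin U w₁ (λ S → f (S ⊕ T)) v)) + sum (λ v → W * edgeWithin V w₂ (average f) v)
        ≈⟨ +-congʳ (∑⊆-exchange (finSum n) V _) ⟩
      sum (λ v → ∑⊆ V (λ T → w₂ T * edgeWithin U w₁ (λ S → f (S ⊕ T)) v)) + sum (λ v → W * edgeWithin V w₂ (average f) v)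
        ≈⟨ Fins.add n _ _ ⟨
      _ ≤⟨ Fins.mono n (λ v _ → edgeWithin-split f v) ⟩
      energy (U ⊕ V) w f ∎

    -- Law of total variance: the deviation on each fibre T is centred at the fibre mean, and the
    -- fluctuation of these means is handled by the inequality on V. The two resulting energies fit
    -- together into one by `energy-split`, which is why C does not grow.
    poincaré-product : ∀ {C} → 0# ≤ C → Poincaré U w₁ C → Poincaré V w₂ C → Poincaré (U ⊕ V) w C
    poincaré-product {C} C≥0 P₁ P₂ f with P₂ (average f)
    ... | c , p₂ = c , (begin
      ∑⊆ (U ⊕ V) (λ S → w S * sq (f S - c))
        ≈⟨ ∑⊆-⊕ U V disj _ ⟩
      ∑⊆ V (λ T → ∑⊆ U (λ S → w (S ⊕ T) * sq (f (S ⊕ T) - c)))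
        ≈⟨ Sub.cong V (λ T T⊑V → ≈-trans (Sub.cong U λ S S⊑U → ≈-trans (*-congʳ (≈-trans (w≈ S T S⊑U T⊑V) (*-comm _ _))) (*-assoc _ _ _)) (∑⊆-scale U (w₂ T) _)) ⟩
      ∑⊆ V (λ T → w₂ T * ∑⊆ U (λ S → w₁ S * sq (f (S ⊕ T) - c)))
        ≈⟨ Sub.cong V (λ T _ → *-congˡ (deviation-split _ c)) ⟩
      ∑⊆ V (λ T → w₂ T * (∑⊆ U (λ S → w₁ S * sq (f (S ⊕ T) - average f T)) + W * sq (average f T - c)))
        ≤⟨ ∑⊆-mono V (λ T _ → *-monoʳ-≤ (proj₁ (w₂>0 T)) (+-monoˡ-≤ _ (bound T))) ⟩
      ∑⊆ V (λ T → w₂ T * (C * energy U w₁ (λ S → f (S ⊕ T)) + W * sq (average f T - c)))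
        ≈⟨ Sub.cong V (λ T _ → solve 5 (λ w C e W q → w :* (C :* e :+ W :* q) := C :* (w :* e) :+ W :* (w :* q)) ≈-refl (w₂ T) C _ W _) ⟩
      ∑⊆ V (λ T → C * (w₂ T * energy U w₁ (λ S → f (S ⊕ T))) + W * (w₂ T * sq (average f T - c)))
        ≈⟨ ≈-trans (∑⊆-add V _ _) (+-cong (∑⊆-scale V C _) (∑⊆-scale V W _)) ⟩
      C * E₁ + W * ∑⊆ V (λ T → w₂ T * sq (average f T - c))
        ≤⟨ +-monoʳ-≤ _ (*-monoʳ-≤ (proj₁ (∑⊆-pos U w₁>0)) p₂) ⟩
      C * E₁ + W * (C * energy V w₂ (average f))
        ≈⟨ solve 4 (λ C e W q → C :* e :+ W :* (C :* q) := C :* (e :+ W :* q)) ≈-refl C E₁ W _ ⟩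
      C * (E₁ + W * energy V w₂ (average f))
        ≤⟨ *-monoʳ-≤ C≥0 (energy-split f) ⟩
      C * energy (U ⊕ V) w f ∎)
      where
      E₁ = ∑⊆ V (λ T → w₂ T * energy U w₁ (λ S → f (S ⊕ T)))
      bound : ∀ T → ∑⊆ U (λ S → w₁ S * sq (f (S ⊕ T) - average f T)) ≤ C * energy U w₁ (λ S → f (S ⊕ T))
      bound T with P₁ (λ S → f (S ⊕ T))
      -- The centre given by `P₁` depends on T in an uncontrolled way; replacing it by the mean only
      -- lowers the deviation and makes it `average f T`.
      ... | c₁ , p₁ = ≤-trans (deviation-mean _ c₁) p₁

-- Poincaré constant of the interlace weights.

module Weights (ℝ : CompleteOrderedField) where

  open Reals ℝ
  open Cube ℝ
  open Subsets
  open Rank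
  open TreeDecompositions
  open Chains ℝ using (interlaceWeight; ratio-pos)

  open CommutativeExp commutativeSemiring public using (^-distrib-*)
  open Exp semiring public using (^-homo-*; ^-assocʳ; ^-congˡ; ^-congʳ)

  -- Decoupling a vertex turns μ into μ′; `up` bounds μ/μ′ and `lo` bounds μ′/μ. They are separate
  -- parameters because all powers r^δ lie on the same side of 1: one of the two can be 1, and a
  -- vertex costs max(r, 1/r)^2 instead of max(r, 1/r)^4.
  module Factorising {n} (G : Graph n) (μ : Subset n → Carrier) (μ>0 : ∀ S → 0# < μ S)
    (μ-multiplicative : ∀ {U V} → Disjoint U V → NonAdjacent G U V → ∀ S T → S ⊑ U → T ⊑ V → μ (S ⊕ T) ≈ μ S * μ T)
    {b r up lo : Carrier} (0<b : 0# < b)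
    (μ-addVertex : ∀ S v → lookup S v ≡ false → ∃[ δ ] δ ℕ.≤ 2 × μ (S ⊕ ⁅ v ⁆) ≈ μ S * b * r ^ δ)
    (r^≤up : ∀ δ → δ ℕ.≤ 2 → r ^ δ ≤ up) (1≤lo*r^ : ∀ δ → δ ℕ.≤ 2 → 1# ≤ lo * r ^ δ) where

    1≤up : 1# ≤ up
    1≤up = r^≤up 0 ℕ.z≤n

    1≤lo : 1# ≤ lo
    1≤lo = ≤-trans (1≤lo*r^ 0 ℕ.z≤n) (≤-reflexive (*-identityʳ lo))

    1≤up*lo : 1# ≤ up * lo
    1≤up*lo = ≤-trans (≤-reflexive (≈-sym (*-identityˡ 1#))) (*-mono-≤ 0≤1 0≤1 1≤up 1≤lo)

    0≤up : 0# ≤ up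
    0≤up = ≤-trans 0≤1 1≤up

    0≤lo : 0# ≤ lo
    0≤lo = ≤-trans 0≤1 1≤lo

    module Decoupled (v : Fin n) where

      -- In μ′ the vertex v is independent of the rest. Its factor b is the one it would contribute
      -- if adding it never raised the rank.
      νᵥ μ′ : Subset n → Carrier
      νᵥ T = if lookup T v then b else 1#
      μ′ S = μ (S [ v ]≔ false) * νᵥ S

      νᵥ>0 : ∀ T → 0# < νᵥ T
      νᵥ>0 T with lookup T v
      ... | true  = 0<b
      ... | false = 0<1

      μ′>0 : ∀ S → 0# < μ′ S
      μ′>0 S = *-pos (μ>0 _) (νᵥ>0 S)

      remove-⊕ : ∀ S T → lookup S v ≡ false → T ⊑ ⁅ v ⁆ → (S ⊕ T) [ v ]≔ false ≡ S
      remove-⊕ S T v∉S T⊑v = lookup-ext pointwise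
        where
        pointwise : ∀ u → lookup ((S ⊕ T) [ v ]≔ false) u ≡ lookup S u
        pointwise u with u ≟ᶠ v
        ... | yes refl = ≡.trans (lookup-remove (S ⊕ T) v) (≡.sym v∉S)
        ... | no u≢v = ≡.trans (Vecₚ.lookup∘updateAt′ u v u≢v (S ⊕ T)) (≡.trans (lookup-⊕ S T u)
          (≡.trans (≡.cong (lookup S u xor_) (≢true⇒false λ p → ⊥-elim (u≢v (lookup-⁅⁆⇒≡ u v (T⊑v u p))))) (xor-identityʳ (lookup S u))))

      μ′-factor : ∀ {U} → lookup U v ≡ false → ∀ S T → S ⊑ U → T ⊑ ⁅ v ⁆ → μ′ (S ⊕ T) ≈ μ S * νᵥ T
      μ′-factor {U} v∉U S T S⊑U T⊑v = ≈-reflexive (≡.cong₂ _*_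
        (≡.cong μ (remove-⊕ S T v∉S T⊑v))
        (≡.cong (λ c → if c then b else 1#) (≡.trans (lookup-⊕ S T v) (≡.cong (_xor lookup T v) v∉S))))
        where
        v∉S : lookup S v ≡ false
        v∉S = ≢true⇒false λ p → true≢false (S⊑U v p) v∉U

      restore : ∀ S → lookup S v ≡ true → (S [ v ]≔ false) ⊕ ⁅ v ⁆ ≡ S
      restore S p = lookup-ext pointwise
        where
        R = S [ v ]≔ false
        pointwise : ∀ u → lookup (R ⊕ ⁅ v ⁆) u ≡ lookup S u
        pointwise u with u ≟ᶠ v
        ... | yes refl = ≡.trans (lookup-⊕ R ⁅ v ⁆ v) (≡.trans (≡.cong₂ _xor_ (lookup-remove S v) (lookup-⁅x⁆ v)) (≡.sym p))
        ... | no u≢v = ≡.trans (lookup-⊕ R ⁅ v ⁆ u) (≡.trans (≡.cong₂ _xor_ (Vecₚ.lookup∘updateAt′ u v u≢v S)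
          (≢true⇒false λ q → ⊥-elim (u≢v (lookup-⁅⁆⇒≡ u v q)))) (xor-identityʳ (lookup S u)))

      decouple : ∀ S → ∃[ δ ] δ ℕ.≤ 2 × μ S ≈ μ′ S * r ^ δ
      decouple S = cases (bool-case (lookup S v))
        where
        S′ = S [ v ]≔ false
        νᵥ≡ : ∀ {c} → lookup S v ≡ c → μ′ S ≡ μ S′ * (if c then b else 1#)
        νᵥ≡ e = ≡.cong (λ c → μ S′ * (if c then b else 1#)) e
        cases : lookup S v ≡ true ⊎ lookup S v ≡ false → ∃[ δ ] δ ℕ.≤ 2 × μ S ≈ μ′ S * r ^ δ
        cases (inj₁ e) = let (δ , δ≤2 , eq) = μ-addVertex S′ v (lookup-remove S v) in δ , δ≤2 , (begin-equality
          μ S                ≡⟨ ≡.cong μ (restore S e) ⟨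
          μ (S′ ⊕ ⁅ v ⁆)     ≈⟨ eq ⟩
          μ S′ * b * r ^ δ   ≡⟨ ≡.cong (_* r ^ δ) (νᵥ≡ e) ⟨
          μ′ S * r ^ δ       ∎)
        cases (inj₂ e) = 0 , ℕ.z≤n , (begin-equality
          μ S             ≡⟨ ≡.cong μ (Vecₚ.updateAt-id-local v S (≡.sym e)) ⟨
          μ S′            ≈⟨ ≈-trans (*-identityʳ _) (*-identityʳ _) ⟨
          μ S′ * 1# * 1#  ≡⟨ ≡.cong (_* 1#) (νᵥ≡ e) ⟨
          μ′ S * 1#       ∎)

      μ≤ : ∀ S → μ S ≤ up * μ′ S
      μ≤ S = let (δ , δ≤2 , eq) = decouple S in begin
        μ S           ≈⟨ eq ⟩
        μ′ S * r ^ δ  ≤⟨ *-monoʳ-≤ (proj₁ (μ′>0 S)) (r^≤up δ δ≤2) ⟩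
        μ′ S * up     ≈⟨ *-comm _ _ ⟩
        up * μ′ S     ∎

      μ′≤ : ∀ S → μ′ S ≤ lo * μ S
      μ′≤ S = let (δ , δ≤2 , eq) = decouple S in begin
        μ′ S                  ≈⟨ *-identityʳ _ ⟨
        μ′ S * 1#             ≤⟨ *-monoʳ-≤ (proj₁ (μ′>0 S)) (1≤lo*r^ δ δ≤2) ⟩
        μ′ S * (lo * r ^ δ)   ≈⟨ solve 3 (λ m l q → m :* (l :* q) := l :* (m :* q)) ≈-refl _ _ _ ⟩
        lo * (μ′ S * r ^ δ)   ≈⟨ *-congˡ eq ⟨
        lo * μ S              ∎

    poincaré : ∀ {d U} → Treedepth G d U → Poincaré U μ ((up * lo) ^ d)
    poincaré {d} empty = poincaré-∅ (^-nonNeg d (≤-trans 0≤1 1≤up*lo)) μ>0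
    poincaré {d} (union {S = S} {U} disj na s u) = poincaré-product {U = S} {U} disj μ μ μ μ>0 μ>0
      (μ-multiplicative {S} {U} disj na) (^-nonNeg d (≤-trans 0≤1 1≤up*lo)) (poincaré s) (poincaré u)
    -- μ is compared with μ′, the product of μ on S and a two-point weight at v; the two-point
    -- constant 1 is at most C.
    poincaré {suc d} (vertex {S = S} {v} v∉S s) = poincaré-mono {U = S ⊕ ⁅ v ⁆} μ>0
      (≤-reflexive (solve 3 (λ u c l → u :* c :* l := u :* l :* c) ≈-refl up C lo))
      (poincaré-compare {U = S ⊕ ⁅ v ⁆} μ>0 μ′>0 0≤lo 0≤up 0≤C (λ S _ → μ≤ S) (λ S _ → μ′≤ S)
        (poincaré-product {U = S} {⁅ v ⁆} (Disjoint-⁅⁆ {S = S} v∉S) μ′ μ νᵥ μ>0 νᵥ>0 (μ′-factor {S} v∉S) 0≤C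
          (poincaré s) (poincaré-mono {U = ⁅ v ⁆} νᵥ>0 (1≤^ d 1≤up*lo) (poincaré-⁅⁆ v νᵥ>0))))
      where
      open Decoupled v
      C = (up * lo) ^ d
      0≤C : 0# ≤ C
      0≤C = ^-nonNeg d (≤-trans 0≤1 1≤up*lo)

  module Interlace {x y : Carrier} (1<x : 1# < x) (1<y : 1# < y) where

    a b r : Carrier
    a = x - 1#
    b = y - 1#
    r = a / b

    0<a : 0# < a
    0<a = x<y⇒0<y-x 1<x

    0<b : 0# < b
    0<b = x<y⇒0<y-x 1<y

    0<r : 0# < r
    0<r = ratio-pos 1<x 1<y

    a≈rb : a ≈ r * b
    a≈rb = begin-equality
      a              ≈⟨ *-identityʳ a ⟨
      a * 1#         ≈⟨ *-congˡ (⁻¹-inverseˡ 0<b) ⟨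
      a * (b ⁻¹ * b) ≈⟨ *-assoc _ _ _ ⟨
      r * b          ∎

    module OnGraph {n} (G : Graph n) where

      ρ : Subset n → ℕ
      ρ S = rank₂ (Graph.adjacency (induced G S))

      isRank : ∀ S → IsRank (Graph.adjacency G) S (ρ S)
      isRank = rank₂-induced G

      μ : Subset n → Carrier
      μ S = interlaceWeight x y (induced G S)

      μ>0 : ∀ S → 0# < μ S
      μ>0 S = *-pos (^-pos (ρ S) 0<a) (^-pos (∣ S ∣ ∸ ρ S) 0<b)

      -- The truncated difference disappears, and every question about the weights becomes one about
      -- cardinality, which is exactly additive, and rank.
      μ≈ : ∀ S → μ S ≈ b ^ ∣ S ∣ * r ^ ρ S
      μ≈ S = begin-equality
        a ^ k * b ^ (∣ S ∣ ∸ k)             ≈⟨ *-congʳ (^-congˡ k a≈rb) ⟩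
        (r * b) ^ k * b ^ (∣ S ∣ ∸ k)       ≈⟨ *-congʳ (^-distrib-* r b k) ⟩
        r ^ k * b ^ k * b ^ (∣ S ∣ ∸ k)     ≈⟨ *-assoc _ _ _ ⟩
        r ^ k * (b ^ k * b ^ (∣ S ∣ ∸ k))   ≈⟨ *-congˡ (^-homo-* b k (∣ S ∣ ∸ k)) ⟨
        r ^ k * b ^ (k ℕ.+ (∣ S ∣ ∸ k))     ≡⟨ ≡.cong (λ m → r ^ k * b ^ m) (ℕₚ.m+[n∸m]≡n (rank≤∣∣ G (isRank S))) ⟩
        r ^ k * b ^ ∣ S ∣                   ≈⟨ *-comm _ _ ⟩
        b ^ ∣ S ∣ * r ^ k                   ∎
        where k = ρ S

      μ-multiplicative : ∀ {U V} → Disjoint U V → NonAdjacent G U V →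
        ∀ S T → S ⊑ U → T ⊑ V → μ (S ⊕ T) ≈ μ S * μ T
      μ-multiplicative {U} {V} disj na S T S⊑U T⊑V = begin-equality
        μ (S ⊕ T)                                              ≈⟨ μ≈ (S ⊕ T) ⟩
        b ^ ∣ S ⊕ T ∣ * r ^ ρ (S ⊕ T)                          ≡⟨ ≡.cong₂ (λ i j → b ^ i * r ^ j) (∣⊕∣ S T disj′)
          (rank-additive G disj′ (λ u v p q → na u v (S⊑U u p) (T⊑V v q)) (isRank S) (isRank T) (isRank (S ⊕ T))) ⟩
        b ^ (∣ S ∣ ℕ.+ ∣ T ∣) * r ^ (ρ S ℕ.+ ρ T)              ≈⟨ *-cong (^-homo-* b ∣ S ∣ ∣ T ∣) (^-homo-* r (ρ S) (ρ T)) ⟩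
        (b ^ ∣ S ∣ * b ^ ∣ T ∣) * (r ^ ρ S * r ^ ρ T)          ≈⟨ solve 4 (λ a b c d → (a :* b) :* (c :* d) := (a :* c) :* (b :* d)) ≈-refl _ _ _ _ ⟩
        (b ^ ∣ S ∣ * r ^ ρ S) * (b ^ ∣ T ∣ * r ^ ρ T)          ≈⟨ *-cong (μ≈ S) (μ≈ T) ⟨
        μ S * μ T                                              ∎
        where
        disj′ : Disjoint S T
        disj′ = Disjoint-⊑ {S = U} {V} {S} {T} S⊑U T⊑V disj

      μ-addVertex : ∀ S v → lookup S v ≡ false → ∃[ δ ] δ ℕ.≤ 2 × μ (S ⊕ ⁅ v ⁆) ≈ μ S * b * r ^ δ
      μ-addVertex S v v∉S = δ , ℕₚ.m≤n+o⇒m∸n≤o _ (ρ S) (subst (ρ (S ⊕ ⁅ v ⁆) ℕ.≤_) (ℕₚ.+-comm 2 (ρ S)) (rank-addVertex G v∉S (isRank S) (isRank (S ⊕ ⁅ v ⁆)))) ,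
        (begin-equality
          μ (S ⊕ ⁅ v ⁆)                          ≈⟨ μ≈ (S ⊕ ⁅ v ⁆) ⟩
          b ^ ∣ S ⊕ ⁅ v ⁆ ∣ * r ^ ρ (S ⊕ ⁅ v ⁆)  ≡⟨ ≡.cong₂ (λ i j → b ^ i * r ^ j) size (≡.sym (ℕₚ.m+[n∸m]≡n ρ≤)) ⟩
          b * b ^ ∣ S ∣ * r ^ (ρ S ℕ.+ δ)        ≈⟨ *-congˡ (^-homo-* r (ρ S) δ) ⟩
          b * b ^ ∣ S ∣ * (r ^ ρ S * r ^ δ)      ≈⟨ solve 4 (λ a b c d → (a :* b) :* (c :* d) := b :* c :* a :* d) ≈-refl _ _ _ _ ⟩
          b ^ ∣ S ∣ * r ^ ρ S * b * r ^ δ        ≈⟨ *-congʳ (*-congʳ (μ≈ S)) ⟨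
          μ S * b * r ^ δ                        ∎)
        where
        disj : Disjoint S ⁅ v ⁆
        disj = Disjoint-⁅⁆ {S = S} v∉S
        δ = ρ (S ⊕ ⁅ v ⁆) ∸ ρ S
        ρ≤ : ρ S ℕ.≤ ρ (S ⊕ ⁅ v ⁆)
        ρ≤ = rank-mono G (∈⊕⁺ˡ {S = S} {⁅ v ⁆} disj) (isRank S) (isRank (S ⊕ ⁅ v ⁆))
        size : ∣ S ⊕ ⁅ v ⁆ ∣ ≡ suc ∣ S ∣
        size = ≡.trans (∣⊕∣ S ⁅ v ⁆ disj) (≡.trans (≡.cong (∣ S ∣ ℕ.+_) (∣⁅x⁆∣≡1 v)) (ℕₚ.+-comm ∣ S ∣ 1))

-- From the Poincaré inequality to the mixing time.

module Mixing (ℝ : CompleteOrderedField) where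

  open import Data.Integer.Base using (+_)
  open Reals ℝ
  open Cube ℝ
  open Subsets
  open Chains ℝ
  open import Data.List.Base using ([]; _∷_; _++_; foldr)

  private
    variable
      n : ℕ

  sumList : {A : Set} → (A → Carrier) → List A → Carrier
  sumList f = foldr (λ a acc → f a + acc) 0#

  sumList-++ : ∀ {A : Set} (f : A → Carrier) xs ys → sumList f (xs ++ ys) ≈ sumList f xs + sumList f ys
  sumList-++ f []       ys = ≈-sym (+-identityˡ _)
  sumList-++ f (x ∷ xs) ys = ≈-trans (+-congˡ (sumList-++ f xs ys)) (≈-sym (+-assoc _ _ _))

  sumList-map : ∀ {A B : Set} (f : B → Carrier) (g : A → B) xs → sumList f (List.map g xs) ≈ sumList (f ∘ g) xs
  sumList-map f g []       = ≈-refl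
  sumList-map f g (x ∷ xs) = +-congˡ (sumList-map f g xs)

  ∑≈∑⊆ : ∀ (f : Subset n → Carrier) → ∑ f ≈ ∑⊆ ⊤ˢ f
  ∑≈∑⊆ {zero}  f = +-identityʳ _
  ∑≈∑⊆ {suc n} f = ≈-trans (sumList-++ f (List.map (false Vec.∷_) (subsets n)) _)
    (+-cong (≈-trans (sumList-map f (false Vec.∷_) (subsets n)) (∑≈∑⊆ (f ∘ (false Vec.∷_))))
            (≈-trans (sumList-map f (true Vec.∷_) (subsets n)) (∑≈∑⊆ (f ∘ (true Vec.∷_)))))

  lookup-⊤ : ∀ (v : Fin n) → lookup ⊤ˢ v ≡ true
  lookup-⊤ v = Vecₚ.lookup-replicate v true

  ∑⊆-single : ∀ (Y : Subset n) (f : Subset n → Carrier) → (∀ Z → Z ≢ Y → f Z ≈ 0#) → ∑⊆ ⊤ˢ f ≈ f Y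
  ∑⊆-single Vec.[]          f p = ≈-refl
  ∑⊆-single {suc n} (false Vec.∷ Y) f p = ≈-trans (+-cong (∑⊆-single Y _ λ Z ne → p _ λ e → ne (Vecₚ.∷-injectiveʳ e))
    (≈-trans (Sub.cong (⊤ˢ {n}) λ Z _ → p (true Vec.∷ Z) λ ()) (Sub.∫0 (⊤ˢ {n})))) (+-identityʳ _)
  ∑⊆-single {suc n} (true Vec.∷ Y) f p = ≈-trans (+-cong (≈-trans (Sub.cong (⊤ˢ {n}) λ Z _ → p (false Vec.∷ Z) λ ()) (Sub.∫0 (⊤ˢ {n})))
    (∑⊆-single Y _ λ Z ne → p _ λ e → ne (Vecₚ.∷-injectiveʳ e))) (+-identityˡ _)

  ≤∑⊆ : ∀ (S : Subset n) f → (∀ S → 0# ≤ f S) → f S ≤ ∑⊆ ⊤ˢ f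
  ≤∑⊆ Vec.[]          f p = ≤-refl
  ≤∑⊆ {suc n} (false Vec.∷ S) f p = ≤-trans (≤∑⊆ S _ (λ S → p _)) (x≤x+y (Sub.nonNeg (⊤ˢ {n}) λ S _ → p (true Vec.∷ S)))
  ≤∑⊆ {suc n} (true Vec.∷ S)  f p = ≤-trans (≤∑⊆ S _ (λ S → p _)) (y≤x+y (Sub.nonNeg (⊤ˢ {n}) λ S _ → p (false Vec.∷ S)))

  point-refl : ∀ (X : Subset n) → point X X ≡ 1#
  point-refl X with Vecₚ.≡-dec _≟ᴮ_ X X
  ... | yes _ = refl
  ... | no ne = ⊥-elim (ne refl)

  point-≢ : ∀ {X Y : Subset n} → X ≢ Y → point X Y ≡ 0#
  point-≢ {X = X} {Y} ne with Vecₚ.≡-dec _≟ᴮ_ X Y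
  ... | yes e = ⊥-elim (ne e)
  ... | no _  = refl

  ∑⊆-point : ∀ (h : Subset n → Carrier) Y → ∑⊆ ⊤ˢ (λ Z → h Z * point Z Y) ≈ h Y
  ∑⊆-point h Y = begin-equality
    ∑⊆ ⊤ˢ (λ Z → h Z * point Z Y) ≈⟨ ∑⊆-single Y _ (λ Z ne → ≈-trans (*-congˡ (≈-reflexive (point-≢ ne))) (zeroʳ _)) ⟩
    h Y * point Y Y              ≈⟨ *-congˡ (≈-reflexive (point-refl Y)) ⟩
    h Y * 1#                     ≈⟨ *-identityʳ _ ⟩
    h Y                          ∎

  ∑⊆-point-flip : ∀ (h : Subset n → Carrier) v Y → ∑⊆ ⊤ˢ (λ Z → h Z * point (Z ⊕ ⁅ v ⁆) Y) ≈ h (Y ⊕ ⁅ v ⁆)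
  ∑⊆-point-flip h v Y = begin-equality
    ∑⊆ ⊤ˢ (λ Z → h Z * point (Z ⊕ ⁅ v ⁆) Y)
      ≈⟨ Sub.cong ⊤ˢ (λ Z _ → ≈-reflexive (≡.cong (λ W → h W * point (Z ⊕ ⁅ v ⁆) Y) (≡.sym (⊕-involutive Z ⁅ v ⁆)))) ⟩
    ∑⊆ ⊤ˢ (λ Z → h (Z ⊕ ⁅ v ⁆ ⊕ ⁅ v ⁆) * point (Z ⊕ ⁅ v ⁆) Y)
      ≈⟨ ∑⊆-flip ⊤ˢ v (lookup-⊤ v) (λ Z → h (Z ⊕ ⁅ v ⁆) * point Z Y) ⟩
    ∑⊆ ⊤ˢ (λ Z → h (Z ⊕ ⁅ v ⁆) * point Z Y)
      ≈⟨ ∑⊆-point (λ Z → h (Z ⊕ ⁅ v ⁆)) Y ⟩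
    h (Y ⊕ ⁅ v ⁆) ∎

  ½+½≈1 : ½ + ½ ≈ 1#
  ½+½≈1 = ≈-trans (≈-sym (2*x≈x+x ½)) (⁻¹-inverseʳ (>⇒≉0 0<2))

  half : ∀ x → x ≈ ½ * (x + x)
  half x = begin-equality
    x              ≈⟨ *-identityˡ x ⟨
    1# * x         ≈⟨ *-congʳ ½+½≈1 ⟨
    (½ + ½) * x    ≈⟨ solve 2 (λ h x → (h :+ h) :* x := h :* (x :+ x)) ≈-refl ½ x ⟩
    ½ * (x + x)    ∎

  ½≤1 : ½ ≤ 1#
  ½≤1 = ≤-trans (x≤x+y 0≤½) (≤-reflexive ½+½≈1)

  -- Summing a t ≤ N (a t - a (t + 1)) over N steps telescopes to N a N ≤ N (a 0 - a N).
  halving : ∀ (a : ℕ → Carrier) N .{{_ : NonZero N}} → (∀ t → a (suc t) ≤ a t) →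
    (∀ t → a t ≤ fromℕ N * (a t - a (suc t))) → 2# * a N ≤ a 0
  halving a N@(suc k) anti contr = begin
    2# * a N          ≈⟨ 2*x≈x+x (a N) ⟩
    a N + a N         ≤⟨ +-monoˡ-≤ (a N) (*-cancelʳ-≤ (0<fromℕ-suc k) (≤-trans (≤-reflexive (*-comm _ _)) (≤-trans (go N) (≤-reflexive (*-comm _ _))))) ⟩
    a 0 - a N + a N   ≈⟨ x-z+z≈x (a 0) (a N) ⟩
    a 0               ∎
    where
    go : ∀ k → fromℕ k * a k ≤ fromℕ N * (a 0 - a k)
    go zero = ≤-reflexive (solve 2 (λ x N → con (+ 0) :* x := N :* (x :- x)) ≈-refl (a 0) (fromℕ N))
    go (suc k) = begin
      fromℕ (suc k) * a (suc k)                                  ≤⟨ *-monoʳ-≤ (fromℕ-nonNeg (suc k)) (anti k) ⟩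
      fromℕ (suc k) * a k                                        ≈⟨ *-congʳ (fromℕ-suc k) ⟨
      (fromℕ k + 1#) * a k                                       ≈⟨ ≈-trans (distribʳ _ _ _) (+-congˡ (*-identityˡ _)) ⟩
      fromℕ k * a k + a k                                        ≤⟨ +-mono-≤ (go k) (contr k) ⟩
      fromℕ N * (a 0 - a k) + fromℕ N * (a k - a (suc k))        ≈⟨ solve 4 (λ N x y z → N :* (x :- y) :+ N :* (y :- z) := N :* (x :- z)) ≈-refl (fromℕ N) (a 0) (a k) (a (suc k)) ⟩
      fromℕ N * (a 0 - a (suc k))                                ∎

  halving-iterated : ∀ (a : ℕ → Carrier) N .{{_ : NonZero N}} → (∀ t → a (suc t) ≤ a t) →
    (∀ t → a t ≤ fromℕ N * (a t - a (suc t))) → ∀ m → 2# ^ m * a (m ℕ.* N) ≤ a 0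
  halving-iterated a N anti contr zero    = ≤-reflexive (*-identityˡ _)
  halving-iterated a N anti contr (suc m) = begin
    2# * 2# ^ m * a (suc m ℕ.* N)    ≈⟨ solve 3 (λ u v w → u :* v :* w := u :* (v :* w)) ≈-refl 2# (2# ^ m) _ ⟩
    2# * (2# ^ m * a (N ℕ.+ m ℕ.* N)) ≡⟨ ≡.cong (λ k → 2# * (2# ^ m * a k)) (ℕₚ.+-comm N (m ℕ.* N)) ⟩
    2# * (2# ^ m * a (m ℕ.* N ℕ.+ N)) ≤⟨ *-monoʳ-≤ (proj₁ 0<2) (halving-iterated (λ t → a (t ℕ.+ N)) N (λ t → anti (t ℕ.+ N)) (λ t → contr (t ℕ.+ N)) m) ⟩
    2# * a N                          ≤⟨ halving a N anti contr ⟩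
    a 0                               ∎

  sq-cancel-≤ : ∀ {x y} → 0# < y → sq x ≤ sq y → x ≤ y
  sq-cancel-≤ {x} {y} 0<y p = ^-cancelˡ-≤ 1 0<y (≤-trans (≤-reflexive (*-congˡ (*-identityʳ x)))
    (≤-trans p (≤-reflexive (*-congˡ (≈-sym (*-identityʳ y))))))

  sq≤0⇒≈0 : ∀ {x} → sq x ≤ 0# → x ≈ 0#
  sq≤0⇒≈0 {x} p with x ≟ 0#
  ... | yes e = e
  ... | no ne = *-cancelʳ-≈ ne (antisym (≤-trans p (≤-reflexive (≈-sym (zeroˡ x)))) (≤-trans (≤-reflexive (zeroˡ x)) (sq-nonNeg x)))

  sq-abs : ∀ x → sq (abs x) ≈ sq x
  sq-abs x = cases (total x (- x))
    where
    cases : x ≤ - x ⊎ - x ≤ x → sq (abs x) ≈ sq x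
    cases (inj₁ p) = ≈-trans (sq-cong (Max.x≤y⇒x⊔y≈y p)) (sq-neg x)
    cases (inj₂ p) = sq-cong (Max.x≤y⇒y⊔x≈y p)

  abs-cong : ∀ {x y} → x ≈ y → abs x ≈ abs y
  abs-cong e = Max.⊔-cong e (-‿cong e)

  abs-* : ∀ {z} x → 0# ≤ z → abs (z * x) ≈ z * abs x
  abs-* {z} x 0≤z = cases (total x (- x))
    where
    -z*x : - (z * x) ≈ z * - x
    -z*x = solve 2 (λ z x → :- (z :* x) := z :* (:- x)) ≈-refl z x
    cases : x ≤ - x ⊎ - x ≤ x → abs (z * x) ≈ z * abs x
    cases (inj₁ p) = ≈-trans (≈-trans (Max.x≤y⇒x⊔y≈y (≤-trans (*-monoʳ-≤ 0≤z p) (≤-reflexive (≈-sym -z*x)))) -z*x)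
      (*-congˡ (≈-sym (Max.x≤y⇒x⊔y≈y p)))
    cases (inj₂ p) = ≈-trans (Max.x≤y⇒y⊔x≈y (≤-trans (≤-reflexive -z*x) (*-monoʳ-≤ 0≤z p)))
      (*-congˡ (≈-sym (Max.x≤y⇒y⊔x≈y p)))

  least : ∀ (Q : ℕ → Set) → (∀ t → Dec (Q t)) → ∀ T → Q T → Σ[ t ∈ ℕ ] IsLeast Q t × t ℕ.≤ T
  least Q Q? T q with Q? 0
  ... | yes q₀ = 0 , (q₀ , λ _ _ → ℕ.z≤n) , ℕ.z≤n
  least Q Q? zero    q | no ¬q₀ = ⊥-elim (¬q₀ q)
  least Q Q? (suc T) q | no ¬q₀ with least (Q ∘ suc) (Q? ∘ suc) T q
  ... | t , (qt , min) , t≤T = suc t , (qt , λ { zero q₀ → ⊥-elim (¬q₀ q₀) ; (suc s) qs → ℕ.s≤s (min s qs) }) , ℕ.s≤s t≤T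

  module Chain {n} .{{_ : NonZero n}} (w : ∀ {m} → Graph m → Carrier) (G : Graph n)
    (w>0 : ∀ S → 0# < w (induced G S)) where

    Ω : Subset n
    Ω = ⊤ˢ

    P : Kernel n
    P = flipChain w G

    μ : Subset n → Carrier
    μ S = w (induced G S)

    open Summation.Weighted (subsetSum Ω) μ (λ S _ → proj₁ (w>0 S)) (∑⊆-pos Ω w>0)
      using (mean; deviation; deviation-mean; cauchySchwarz) renaming (W to Z)

    Z>0 : 0# < Z
    Z>0 = ∑⊆-pos Ω w>0

    n⁻¹ : Carrier
    n⁻¹ = fromℕ n ⁻¹

    0<n : 0# < fromℕ n
    0<n = <-≤-trans 0<1 (1≤fromℕ n)

    0<n⁻¹ : 0# < n⁻¹
    0<n⁻¹ = ⁻¹-pos 0<n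

    sum-n⁻¹ : sum {n} (λ _ → n⁻¹) ≈ 1#
    sum-n⁻¹ = begin-equality
      sum {n} (λ _ → n⁻¹)    ≈⟨ MonoidSum.sum-replicate (CommutativeRing.+-monoid commutativeRing) n ⟩
      n · n⁻¹                ≈⟨ MultProperties.×-congʳ semiring n (*-identityˡ n⁻¹) ⟨
      n · (1# * n⁻¹)         ≈⟨ MultProperties.×-assoc-* semiring n 1# n⁻¹ ⟨
      fromℕ n * n⁻¹          ≈⟨ ⁻¹-inverseʳ (>⇒≉0 0<n) ⟩
      1#                     ∎

    infixl 8 _↕_
    _↕_ : Subset n → Fin n → Subset n
    X ↕ v = X ⊕ ⁅ v ⁆

    p : Fin n → Subset n → Carrier
    p v X = ½ * (1# ⊓ (μ (X ↕ v) / μ X))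

    e : Fin n → Subset n → Carrier
    e v X = μ X ⊓ μ (X ↕ v)

    e-sym : ∀ v X → e v (X ↕ v) ≈ e v X
    e-sym v X = ≈-trans (Min.⊓-cong ≈-refl (≈-reflexive (≡.cong μ (⊕-involutive X ⁅ v ⁆)))) (Min.⊓-comm _ _)

    -- Detailed balance: the right-hand side is invariant under the flip of v by `e-sym`.
    p*μ : ∀ v X → p v X * μ X ≈ ½ * e v X
    p*μ v X = begin-equality
      ½ * (1# ⊓ (μ (X ↕ v) / μ X)) * μ X       ≈⟨ *-assoc _ _ _ ⟩
      ½ * ((1# ⊓ (μ (X ↕ v) / μ X)) * μ X)     ≈⟨ *-congˡ (⊓-distribʳ-* _ _ (proj₁ (w>0 X))) ⟩
      ½ * ((1# * μ X) ⊓ (μ (X ↕ v) / μ X * μ X)) ≈⟨ *-congˡ (Min.⊓-cong (*-identityˡ _)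
        (≈-trans (*-assoc _ _ _) (≈-trans (*-congˡ (⁻¹-inverseˡ (w>0 X))) (*-identityʳ _)))) ⟩
      ½ * e v X ∎

    p≤½ : ∀ v X → p v X ≤ ½
    p≤½ v X = ≤-trans (*-monoʳ-≤ 0≤½ (Min.x⊓y≤x _ _)) (≤-reflexive (*-identityʳ ½))

    e≥0 : ∀ v X → 0# ≤ e v X
    e≥0 v X = ⊓-nonNeg (proj₁ (w>0 X)) (proj₁ (w>0 (X ↕ v)))

    -- The expectation of f after one step from X.
    L : (Subset n → Carrier) → Subset n → Carrier
    L f X = n⁻¹ * sum (λ v → p v X * f (X ↕ v) + (1# - p v X) * f X)

    push : ∀ (F : Subset n → Carrier) Y → ∑ (λ X → F X * P X Y) ≈ n⁻¹ * sum (λ v → p v (Y ↕ v) * F (Y ↕ v) + (1# - p v Y) * F Y)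
    push F Y = begin-equality
      ∑ (λ X → F X * P X Y)
        ≈⟨ ∑≈∑⊆ (λ X → F X * P X Y) ⟩
      ∑⊆ Ω (λ X → F X * (n⁻¹ * sum (move X)))
        ≈⟨ Sub.cong Ω (λ X _ → ≈-trans (solve 3 (λ f n s → f :* (n :* s) := n :* (f :* s)) ≈-refl (F X) n⁻¹ _) (*-congˡ (≈-sym (Fins.scale n (F X) (move X))))) ⟩
      ∑⊆ Ω (λ X → n⁻¹ * sum (λ v → F X * move X v))
        ≈⟨ ≈-trans (∑⊆-scale Ω n⁻¹ _) (*-congˡ (∑⊆-exchange (finSum n) Ω _)) ⟩
      n⁻¹ * sum (λ v → ∑⊆ Ω (λ X → F X * move X v))
        ≈⟨ *-congˡ (Fins.cong n λ v _ → term v) ⟩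
      n⁻¹ * sum (λ v → p v (Y ↕ v) * F (Y ↕ v) + (1# - p v Y) * F Y) ∎
      where
      move : Subset n → Fin n → Carrier
      move X v = p v X * point (X ↕ v) Y + (1# - p v X) * point X Y
      term : ∀ v → ∑⊆ Ω (λ X → F X * move X v) ≈ p v (Y ↕ v) * F (Y ↕ v) + (1# - p v Y) * F Y
      term v = begin-equality
        ∑⊆ Ω (λ X → F X * move X v)
          ≈⟨ Sub.cong Ω (λ X _ → solve 5 (λ f p q a b → f :* (p :* a :+ q :* b) := p :* f :* a :+ q :* f :* b) ≈-refl (F X) (p v X) (1# - p v X) _ _) ⟩
        ∑⊆ Ω (λ X → p v X * F X * point (X ↕ v) Y + (1# - p v X) * F X * point X Y)
          ≈⟨ ∑⊆-add Ω _ _ ⟩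
        ∑⊆ Ω (λ X → p v X * F X * point (X ↕ v) Y) + ∑⊆ Ω (λ X → (1# - p v X) * F X * point X Y)
          ≈⟨ +-cong (∑⊆-point-flip (λ X → p v X * F X) v Y) (∑⊆-point (λ X → (1# - p v X) * F X) Y) ⟩
        p v (Y ↕ v) * F (Y ↕ v) + (1# - p v Y) * F Y ∎

    -- By reversibility the chain acts on densities with respect to μ by L.
    push-density : ∀ {F g : Subset n → Carrier} → (∀ X → F X ≈ μ X * g X) → ∀ Y → ∑ (λ X → F X * P X Y) ≈ μ Y * L g Y
    push-density {F} {g} F≈ Y = begin-equality
      ∑ (λ X → F X * P X Y)
        ≈⟨ push F Y ⟩
      n⁻¹ * sum (λ v → p v (Y ↕ v) * F (Y ↕ v) + (1# - p v Y) * F Y)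
        ≈⟨ *-congˡ (Fins.cong n λ v _ → term v) ⟩
      n⁻¹ * sum (λ v → μ Y * (p v Y * g (Y ↕ v) + (1# - p v Y) * g Y))
        ≈⟨ *-congˡ (Fins.scale n (μ Y) _) ⟩
      n⁻¹ * (μ Y * sum (λ v → p v Y * g (Y ↕ v) + (1# - p v Y) * g Y))
        ≈⟨ solve 3 (λ n m s → n :* (m :* s) := m :* (n :* s)) ≈-refl n⁻¹ (μ Y) _ ⟩
      μ Y * L g Y ∎
      where
      term : ∀ v → p v (Y ↕ v) * F (Y ↕ v) + (1# - p v Y) * F Y ≈ μ Y * (p v Y * g (Y ↕ v) + (1# - p v Y) * g Y)
      term v = begin-equality
        p v (Y ↕ v) * F (Y ↕ v) + (1# - p v Y) * F Y
          ≈⟨ +-cong (≈-trans (*-congˡ (F≈ _)) (≈-sym (*-assoc _ _ _))) (*-congˡ (F≈ Y)) ⟩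
        p v (Y ↕ v) * μ (Y ↕ v) * g (Y ↕ v) + (1# - p v Y) * (μ Y * g Y)
          ≈⟨ +-congʳ (*-congʳ (≈-trans (p*μ v (Y ↕ v)) (≈-trans (*-congˡ (e-sym v Y)) (≈-sym (p*μ v Y))))) ⟩
        p v Y * μ Y * g (Y ↕ v) + (1# - p v Y) * (μ Y * g Y)
          ≈⟨ solve 5 (λ p m a q b → p :* m :* a :+ q :* (m :* b) := m :* (p :* a :+ q :* b)) ≈-refl (p v Y) (μ Y) _ (1# - p v Y) _ ⟩
        μ Y * (p v Y * g (Y ↕ v) + (1# - p v Y) * g Y) ∎

    ∑⊆-e-flip : ∀ v (h : Subset n → Carrier) → ∑⊆ Ω (λ X → e v X * h (X ↕ v)) ≈ ∑⊆ Ω (λ X → e v X * h X)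
    ∑⊆-e-flip v h = ≈-trans (Sub.cong Ω λ X _ → *-congʳ (≈-sym (e-sym v X)))
      (∑⊆-flip Ω v (lookup-⊤ v) (λ X → e v X * h X))

    -- This is stationarity of μ. At each site the inflow and the outflow agree after reindexing by
    -- the flip.
    mass : ∀ f → ∑⊆ Ω (λ X → μ X * L f X) ≈ ∑⊆ Ω (λ X → μ X * f X)
    mass f = begin-equality
      ∑⊆ Ω (λ X → μ X * L f X)
        ≈⟨ Sub.cong Ω (λ X _ → ≈-trans (solve 3 (λ m n s → m :* (n :* s) := n :* (m :* s)) ≈-refl (μ X) n⁻¹ _) (*-congˡ (≈-sym (Fins.scale n (μ X) _)))) ⟩
      ∑⊆ Ω (λ X → n⁻¹ * sum (λ v → μ X * (p v X * f (X ↕ v) + (1# - p v X) * f X)))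
        ≈⟨ ≈-trans (∑⊆-scale Ω n⁻¹ _) (*-congˡ (∑⊆-exchange (finSum n) Ω _)) ⟩
      n⁻¹ * sum (λ v → ∑⊆ Ω (λ X → μ X * (p v X * f (X ↕ v) + (1# - p v X) * f X)))
        ≈⟨ *-congˡ (Fins.cong n λ v _ → term v) ⟩
      n⁻¹ * sum {n} (λ v → M)
        ≈⟨ Fins.scale n n⁻¹ _ ⟨
      sum {n} (λ v → n⁻¹ * M)
        ≈⟨ Fins.scaleʳ n M _ ⟩
      sum {n} (λ _ → n⁻¹) * M
        ≈⟨ ≈-trans (*-congʳ sum-n⁻¹) (*-identityˡ M) ⟩
      M ∎
      where
      M = ∑⊆ Ω (λ X → μ X * f X)
      term : ∀ v → ∑⊆ Ω (λ X → μ X * (p v X * f (X ↕ v) + (1# - p v X) * f X)) ≈ M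
      term v = begin-equality
        ∑⊆ Ω (λ X → μ X * (p v X * f (X ↕ v) + (1# - p v X) * f X))
          -- The factor `1# - p v X` is expanded by hand, since `1#` is not the solver's numeral
          -- one.
          ≈⟨ Sub.cong Ω (λ X _ → ≈-trans (*-congˡ (+-congˡ (≈-trans (distribʳ _ _ _) (+-congʳ (*-identityˡ _)))))
               (≈-trans (solve 4 (λ m p a b → m :* (p :* a :+ (b :+ (:- p) :* b)) := (p :* m) :* a :+ (m :* b :- (p :* m) :* b)) ≈-refl (μ X) (p v X) (f (X ↕ v)) (f X))
               (+-cong (≈-trans (*-congʳ (p*μ v X)) (*-assoc _ _ _)) (+-congˡ (-‿cong (≈-trans (*-congʳ (p*μ v X)) (*-assoc _ _ _))))))) ⟩
        ∑⊆ Ω (λ X → ½ * (e v X * f (X ↕ v)) + (μ X * f X - ½ * (e v X * f X)))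
          ≈⟨ ≈-trans (∑⊆-add Ω _ _) (+-cong (∑⊆-scale Ω ½ _) (≈-trans (Sub.sub Ω _ _) (+-congˡ (-‿cong (∑⊆-scale Ω ½ _))))) ⟩
        ½ * ∑⊆ Ω (λ X → e v X * f (X ↕ v)) + (M - ½ * ∑⊆ Ω (λ X → e v X * f X))
          ≈⟨ +-congʳ (*-congˡ (∑⊆-e-flip v f)) ⟩
        ½ * ∑⊆ Ω (λ X → e v X * f X) + (M - ½ * ∑⊆ Ω (λ X → e v X * f X))
          ≈⟨ solve 2 (λ a m → a :+ (m :- a) := m) ≈-refl _ M ⟩
        M ∎

    mean-L : ∀ f → mean (L f) ≈ mean f
    mean-L f = *-congˡ (mass f)

    deviation-cong : ∀ {f g c d} → (∀ X → f X ≈ g X) → c ≈ d → deviation f c ≈ deviation g d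
    deviation-cong f≈g c≈d = Sub.cong Ω λ X _ → *-congˡ (sq-cong (+-cong (f≈g X) (-‿cong c≈d)))

    D : (Subset n → Carrier) → Carrier
    D = energy Ω μ

    -- The factor 1/n is the chance of selecting the site. The 1/4 is what `siteDecay` leaves: the
    -- first-order term gains 1/2 of the edge energy, the second-order term takes back 1/4.
    γ : Carrier
    γ = n⁻¹ * (½ * ½)

    Δ : Fin n → (Subset n → Carrier) → Subset n → Carrier
    Δ v f X = f X - f (X ↕ v)

    -- The site v is updated with probability at most ½; this laziness absorbs
    -- the second-order term of sq (h - p Δ).
    siteDecay : ∀ f c v → ∑⊆ Ω (λ X → μ X * sq (f X - c - p v X * Δ v f X)) ≤ deviation f c - ½ * ½ * edge Ω μ f v
    siteDecay f c v = begin
      ∑⊆ Ω (λ X → μ X * sq (h X - p v X * Δ v f X))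
        ≤⟨ ∑⊆-mono Ω (λ X _ → pointwise X) ⟩
      ∑⊆ Ω (λ X → μ X * sq (h X) - e v X * (h X * Δ v f X) + ½ * ½ * (e v X * sq (Δ v f X)))
        ≈⟨ ≈-trans (∑⊆-add Ω _ _) (+-cong (Sub.sub Ω _ _) (∑⊆-scale Ω (½ * ½) _)) ⟩
      deviation f c - A + ½ * ½ * B
        ≈⟨ +-congʳ (+-congˡ (-‿cong (≈-trans A≈ (*-congˡ (half B))))) ⟩
      deviation f c - ½ * (½ * (B + B)) + ½ * ½ * B
        ≈⟨ solve 3 (λ d h b → d :- h :* (h :* (b :+ b)) :+ h :* h :* b := d :- h :* h :* b) ≈-refl _ ½ B ⟩
      deviation f c - ½ * ½ * B ∎
      where
      h : Subset n → Carrier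
      h X = f X - c
      A = ∑⊆ Ω (λ X → e v X * (h X * Δ v f X))
      B = ∑⊆ Ω (λ X → e v X * sq (Δ v f X))

      -- Pairing X with its flip makes the centre c cancel and turns the first-order term into half
      -- of the squared difference.
      A≈ : A ≈ ½ * B
      A≈ = begin-equality
        A
          ≈⟨ half A ⟩
        ½ * (A + A)
          ≈⟨ *-congˡ (+-congˡ (≈-sym (∑⊆-e-flip v (λ X → h X * Δ v f X)))) ⟩
        ½ * (A + ∑⊆ Ω (λ X → e v X * (h (X ↕ v) * Δ v f (X ↕ v))))
          ≈⟨ *-congˡ (≈-sym (∑⊆-add Ω _ _)) ⟩
        ½ * ∑⊆ Ω (λ X → e v X * (h X * Δ v f X) + e v X * (h (X ↕ v) * Δ v f (X ↕ v)))
          ≈⟨ *-congˡ (Sub.cong Ω λ X _ → ≈-trans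
               (≈-reflexive (≡.cong (λ Y → e v X * (h X * Δ v f X) + e v X * (h (X ↕ v) * (f (X ↕ v) - f Y))) (⊕-involutive X ⁅ v ⁆)))
               (solve 4 (λ e a b c → e :* ((a :- c) :* (a :- b)) :+ e :* ((b :- c) :* (b :- a)) := e :* ((a :- b) :* (a :- b))) ≈-refl (e v X) (f X) (f (X ↕ v)) c)) ⟩
        ½ * B ∎

      pointwise : ∀ X → μ X * sq (h X - p v X * Δ v f X)
        ≤ μ X * sq (h X) - e v X * (h X * Δ v f X) + ½ * ½ * (e v X * sq (Δ v f X))
      pointwise X = begin
        μ X * sq (h X - p v X * d)
          ≈⟨ solve 4 (λ m h p d → m :* ((h :- p :* d) :* (h :- p :* d)) := m :* (h :* h) :- (p :* m :+ p :* m) :* (h :* d) :+ p :* (p :* m) :* (d :* d)) ≈-refl (μ X) (h X) (p v X) d ⟩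
        μ X * sq (h X) - (p v X * μ X + p v X * μ X) * (h X * d) + p v X * (p v X * μ X) * sq d
          ≈⟨ +-cong (+-congˡ (-‿cong (*-congʳ (≈-trans (+-cong (p*μ v X) (p*μ v X)) (≈-trans (≈-sym (distribˡ _ _ _)) (≈-sym (half (e v X)))))))) (*-congʳ (*-congˡ (p*μ v X))) ⟩
        μ X * sq (h X) - e v X * (h X * d) + p v X * (½ * e v X) * sq d
          ≤⟨ +-monoʳ-≤ _ (*-monoˡ-≤ (sq-nonNeg d) (*-monoˡ-≤ (*-nonNeg 0≤½ (e≥0 v X)) (p≤½ v X))) ⟩
        μ X * sq (h X) - e v X * (h X * d) + ½ * (½ * e v X) * sq d
          ≈⟨ +-congˡ (solve 3 (λ h e q → h :* (h :* e) :* q := h :* h :* (e :* q)) ≈-refl ½ (e v X) (sq d)) ⟩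
        μ X * sq (h X) - e v X * (h X * d) + ½ * ½ * (e v X * sq d) ∎
        where d = Δ v f X

    D≈ : ∀ f → D f ≈ sum (edge Ω μ f)
    D≈ f = Fins.cong n λ v _ → ≈-reflexive (edgeWithin-∈ Ω μ f (lookup-⊤ v))

    -- `L f X - c` is the uniform average over v of the single-site updates, so by convexity of the
    -- square the decay at each site averages to the decay of the chain.
    decay : ∀ f c → deviation (L f) c ≤ deviation f c - γ * D f
    decay f c = begin
      ∑⊆ Ω (λ X → μ X * sq (L f X - c))
        ≤⟨ ∑⊆-mono Ω (λ X _ → *-monoʳ-≤ (proj₁ (w>0 X)) (convex X)) ⟩
      ∑⊆ Ω (λ X → μ X * sum (λ v → n⁻¹ * sq (k X v)))
        ≈⟨ Sub.cong Ω (λ X _ → ≈-trans (≈-sym (Fins.scale n (μ X) _)) (Fins.cong n λ v _ → solve 3 (λ m n q → m :* (n :* q) := n :* (m :* q)) ≈-refl (μ X) n⁻¹ _)) ⟩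
      ∑⊆ Ω (λ X → sum (λ v → n⁻¹ * (μ X * sq (k X v))))
        ≈⟨ ≈-trans (∑⊆-exchange (finSum n) Ω _) (Fins.cong n λ v _ → ∑⊆-scale Ω n⁻¹ _) ⟩
      sum (λ v → n⁻¹ * ∑⊆ Ω (λ X → μ X * sq (k X v)))
        ≤⟨ Fins.mono n (λ v _ → *-monoʳ-≤ (proj₁ 0<n⁻¹) (siteDecay f c v)) ⟩
      sum (λ v → n⁻¹ * (deviation f c - ½ * ½ * edge Ω μ f v))
        ≈⟨ Fins.cong n (λ v _ → solve 4 (λ n d h b → n :* (d :- h :* b) := n :* d :- (n :* h) :* b) ≈-refl n⁻¹ (deviation f c) (½ * ½) _) ⟩
      sum (λ v → n⁻¹ * deviation f c - γ * edge Ω μ f v)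
        ≈⟨ ≈-trans (Fins.sub n _ _) (+-cong (Fins.scaleʳ n (deviation f c) _) (-‿cong (Fins.scale n γ _))) ⟩
      sum {n} (λ _ → n⁻¹) * deviation f c - γ * sum (edge Ω μ f)
        ≈⟨ +-cong (≈-trans (*-congʳ sum-n⁻¹) (*-identityˡ _)) (-‿cong (*-congˡ (≈-sym (D≈ f)))) ⟩
      deviation f c - γ * D f ∎
      where
      k : Subset n → Fin n → Carrier
      k X v = f X - c - p v X * Δ v f X

      module Uniform = Summation.Weighted (finSum n) (λ _ → n⁻¹) (λ _ _ → proj₁ 0<n⁻¹) (<-≤-trans 0<1 (≤-reflexive (≈-sym sum-n⁻¹)))

      moved : Subset n → Fin n → Carrier
      moved X v = p v X * f (X ↕ v) + (1# - p v X) * f X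

      L-c : ∀ X → L f X - c ≈ sum (λ v → n⁻¹ * k X v)
      L-c X = begin-equality
        n⁻¹ * sum (moved X) - c
          ≈⟨ +-cong (≈-sym (Fins.scale n n⁻¹ (moved X))) (-‿cong (≈-trans (≈-sym (*-identityˡ c)) (≈-trans (*-congʳ (≈-sym sum-n⁻¹)) (≈-sym (Fins.scaleʳ n c (λ _ → n⁻¹)))))) ⟩
        sum (λ v → n⁻¹ * moved X v) - sum {n} (λ v → n⁻¹ * c)
          ≈⟨ Fins.sub n (λ v → n⁻¹ * moved X v) (λ v → n⁻¹ * c) ⟨
        sum (λ v → n⁻¹ * moved X v - n⁻¹ * c)
          ≈⟨ Fins.cong n (λ v _ → ≈-trans (+-congʳ (*-congˡ (+-congˡ (≈-trans (distribʳ _ _ _) (+-congʳ (*-identityˡ _))))))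
               (solve 5 (λ n p a b c → n :* (p :* a :+ (b :+ (:- p) :* b)) :- n :* c := n :* (b :- c :- p :* (b :- a))) ≈-refl n⁻¹ (p v X) (f (X ↕ v)) (f X) c)) ⟩
        sum (λ v → n⁻¹ * k X v) ∎

      convex : ∀ X → sq (L f X - c) ≤ sum (λ v → n⁻¹ * sq (k X v))
      convex X = begin
        sq (L f X - c)                                      ≈⟨ sq-cong (L-c X) ⟩
        sq (sum (λ v → n⁻¹ * k X v))                        ≤⟨ Uniform.cauchySchwarz (k X) ⟩
        sum {n} (λ _ → n⁻¹) * sum (λ v → n⁻¹ * sq (k X v))  ≈⟨ ≈-trans (*-congʳ sum-n⁻¹) (*-identityˡ _) ⟩
        sum (λ v → n⁻¹ * sq (k X v))                        ∎

    V : (Subset n → Carrier) → Carrier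
    V f = deviation f (mean f)

    V-decay : ∀ f → V (L f) ≤ V f - γ * D f
    V-decay f = ≤-trans (deviation-mean (L f) (mean f)) (decay f (mean f))

    D≥0 : ∀ f → 0# ≤ D f
    D≥0 f = energy-nonNeg Ω f w>0

    0≤γ : 0# ≤ γ
    0≤γ = *-nonNeg (proj₁ 0<n⁻¹) (*-nonNeg 0≤½ 0≤½)

    V-antitone : ∀ f → V (L f) ≤ V f
    V-antitone f = ≤-trans (V-decay f) (begin
      V f - γ * D f           ≤⟨ x≤x+y (*-nonNeg 0≤γ (D≥0 f)) ⟩
      V f - γ * D f + γ * D f ≈⟨ x-z+z≈x _ _ ⟩
      V f                     ∎)

    module Gap {C : Carrier} (poincaré : Poincaré Ω μ C) (N : ℕ) .{{_ : NonZero N}} (C≤Nγ : C ≤ fromℕ N * γ) where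

      -- The relaxation time enters as a natural number N and without division, in the form that
      -- `halving` telescopes.
      contraction : ∀ f → V f ≤ fromℕ N * (V f - V (L f))
      contraction f = let (c , bound) = poincaré f in begin
        V f                        ≤⟨ ≤-trans (deviation-mean f c) bound ⟩
        C * D f                    ≤⟨ *-monoˡ-≤ (D≥0 f) C≤Nγ ⟩
        fromℕ N * γ * D f          ≈⟨ *-assoc _ _ _ ⟩
        fromℕ N * (γ * D f)        ≈⟨ *-congˡ (solve 2 (λ v d → d := v :- (v :- d)) ≈-refl (V f) (γ * D f)) ⟩
        fromℕ N * (V f - (V f - γ * D f)) ≤⟨ *-monoʳ-≤ (fromℕ-nonNeg N) (+-monoʳ-≤ (V f) (neg-mono (V-decay f))) ⟩
        fromℕ N * (V f - V (L f))  ∎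
        where
        neg-mono : ∀ {x y} → x ≤ y → - y ≤ - x
        neg-mono {x} {y} q = 0≤y-x⇒x≤y (≤-trans (x≤y⇒0≤y-x q) (≤-reflexive (solve 2 (λ x y → y :- x := :- x :- (:- y)) ≈-refl x y)))

      module _ {π : Distribution n} (stationary : IsStationary P π) where

        private
          g : Subset n → Carrier
          g X = μ X ⁻¹ * π X

          π≈ : ∀ X → π X ≈ μ X * g X
          π≈ X = ≈-sym (≈-trans (≈-sym (*-assoc _ _ _)) (≈-trans (*-congʳ (⁻¹-inverseʳ (>⇒≉0 (w>0 X)))) (*-identityˡ _)))

          Lg≈g : ∀ X → L g X ≈ g X
          Lg≈g X = *-cancelʳ-≈ (>⇒≉0 (w>0 X)) (begin-equality
            L g X * μ X          ≈⟨ *-comm _ _ ⟩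
            μ X * L g X          ≈⟨ push-density π≈ X ⟨
            ∑ (λ Y → π Y * P Y X) ≈⟨ proj₂ stationary X ⟩
            π X                  ≈⟨ ≈-trans (π≈ X) (*-comm _ _) ⟩
            g X * μ X            ∎)

          V≤0 : V g ≤ 0#
          V≤0 = begin
            V g                        ≤⟨ contraction g ⟩
            fromℕ N * (V g - V (L g))  ≈⟨ *-congˡ (+-congˡ (-‿cong (deviation-cong Lg≈g (mean-L g)))) ⟩
            fromℕ N * (V g - V g)      ≈⟨ solve 2 (λ n v → n :* (v :- v) := con (+ 0)) ≈-refl (fromℕ N) (V g) ⟩
            0#                         ∎

          mean-g : mean g ≈ Z ⁻¹
          mean-g = begin-equality
            Z ⁻¹ * ∑⊆ Ω (λ X → μ X * g X) ≈⟨ *-congˡ (Sub.cong Ω λ X _ → ≈-sym (π≈ X)) ⟩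
            Z ⁻¹ * ∑⊆ Ω π                 ≈⟨ *-congˡ (≈-trans (≈-sym (∑≈∑⊆ π)) (proj₂ (proj₁ stationary))) ⟩
            Z ⁻¹ * 1#                     ≈⟨ *-identityʳ _ ⟩
            Z ⁻¹                          ∎

          g≈ : ∀ X → g X ≈ Z ⁻¹
          g≈ X = ≈-trans (diff (sq≤0⇒≈0 (*-cancelʳ-≤ (w>0 X) (begin
            sq (g X - mean g) * μ X ≈⟨ *-comm _ _ ⟩
            μ X * sq (g X - mean g) ≤⟨ ≤∑⊆ X (λ X → μ X * sq (g X - mean g)) (λ X → *-nonNeg (proj₁ (w>0 X)) (sq-nonNeg _)) ⟩
            V g                     ≤⟨ V≤0 ⟩
            0#                      ≈⟨ zeroˡ _ ⟨
            0# * μ X                ∎)))) mean-g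
            where
            diff : ∀ {x y} → x - y ≈ 0# → x ≈ y
            diff {x} {y} q = ≈-trans (≈-sym (x-z+z≈x x y)) (≈-trans (+-congʳ q) (+-identityˡ y))

        -- The density g of π is fixed by L, so `contraction` bounds its variance by zero; all
        -- weights being positive, g is constant.
        stationary-unique : ∀ X → π X ≈ μ X * Z ⁻¹
        stationary-unique X = ≈-trans (π≈ X) (*-congˡ (g≈ X))

      density : Subset n → ℕ → Subset n → Carrier
      density H zero    X = μ X ⁻¹ * point H X
      density H (suc t) = L (density H t)

      iterate≈ : ∀ H t X → iterate P t H X ≈ μ X * density H t X
      iterate≈ H zero    X = ≈-sym (≈-trans (≈-sym (*-assoc _ _ _)) (≈-trans (*-congʳ (⁻¹-inverseʳ (>⇒≉0 (w>0 X)))) (*-identityˡ _)))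
      iterate≈ H (suc t) X = push-density (iterate≈ H t) X

      ∑-initial : ∀ H (h : Subset n → Carrier) → ∑⊆ Ω (λ X → point H X * h X) ≈ h H
      ∑-initial H h = ≈-trans (∑⊆-single H _ λ X ne → ≈-trans (*-congʳ (≈-reflexive (point-≢ (λ q → ne (≡.sym q))))) (zeroˡ _))
        (≈-trans (*-congʳ (≈-reflexive (point-refl H))) (*-identityˡ _))

      mean-density : ∀ H t → mean (density H t) ≈ Z ⁻¹
      mean-density H (suc t) = ≈-trans (mean-L (density H t)) (mean-density H t)
      mean-density H zero = begin-equality
        Z ⁻¹ * ∑⊆ Ω (λ X → μ X * density H 0 X) ≈⟨ *-congˡ (Sub.cong Ω λ X _ → ≈-trans (≈-sym (iterate≈ H 0 X)) (≈-sym (*-identityʳ _))) ⟩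
        Z ⁻¹ * ∑⊆ Ω (λ X → point H X * 1#)      ≈⟨ *-congˡ (∑-initial H (λ _ → 1#)) ⟩
        Z ⁻¹ * 1#                               ≈⟨ *-identityʳ _ ⟩
        Z ⁻¹                                    ∎

      -- The initial density lives at H with value `μ H ⁻¹`; centring at zero instead of the mean
      -- only overestimates.
      V₀ : ∀ H → V (density H 0) ≤ μ H ⁻¹
      V₀ H = begin
        V (density H 0)
          ≤⟨ deviation-mean (density H 0) 0# ⟩
        deviation (density H 0) 0#
          ≈⟨ Sub.cong Ω (λ X _ → ≈-trans (solve 3 (λ m i q → m :* ((i :* q :- con (+ 0)) :* (i :* q :- con (+ 0))) := q :* ((m :* i) :* i :* q)) ≈-refl (μ X) (μ X ⁻¹) (point H X))
               (*-congˡ (*-congʳ (≈-trans (*-congʳ (⁻¹-inverseʳ (>⇒≉0 (w>0 X)))) (*-identityˡ _))))) ⟩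
        ∑⊆ Ω (λ X → point H X * (μ X ⁻¹ * point H X))
          ≈⟨ ∑-initial H (λ X → μ X ⁻¹ * point H X) ⟩
        μ H ⁻¹ * point H H
          ≈⟨ ≈-trans (*-congˡ (≈-reflexive (point-refl H))) (*-identityʳ _) ⟩
        μ H ⁻¹ ∎

      module _ {π : Distribution n} (stationary : IsStationary P π) {ε : Carrier} (0<ε : 0# < ε)
        (m : ℕ) (enough : ∀ H → Z * μ H ⁻¹ ≤ 2# ^ m * sq ε) where

        -- By Cauchy-Schwarz the squared distance is at most Z times the variance of the density.
        -- That variance starts below `μ H ⁻¹` and is halved in each of m blocks of N steps, which
        -- is what `enough` is calibrated for.
        closeAt : ∀ H → totalVariation (iterate P (m ℕ.* N) H) π ≤ ε
        closeAt H = begin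
          ½ * ∑ (λ S → abs (iterate P T H S - π S))
            -- The factor ½ in the total variation is given away.
            ≤⟨ *-monoˡ-≤ (≤-trans (Sub.nonNeg Ω λ X _ → *-nonNeg (proj₁ (w>0 X)) (abs≥0 _)) (≤-reflexive (≈-sym ∑abs))) ½≤1 ⟩
          1# * ∑ (λ S → abs (iterate P T H S - π S))
            ≈⟨ ≈-trans (*-identityˡ _) ∑abs ⟩
          ∑⊆ Ω (λ S → μ S * abs (h S))
            ≤⟨ sq-cancel-≤ 0<ε squared ⟩
          ε ∎
          where
          T = m ℕ.* N
          h : Subset n → Carrier
          h S = density H T S - Z ⁻¹

          abs≥0 : ∀ x → 0# ≤ abs x
          abs≥0 x = cases (total 0# x)
            where
            cases : 0# ≤ x ⊎ x ≤ 0# → 0# ≤ abs x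
            cases (inj₁ q) = ≤-trans q (Max.x≤x⊔y x (- x))
            cases (inj₂ q) = ≤-trans (0≤-x q) (Max.x≤y⊔x x (- x))

          ∑abs : ∑ (λ S → abs (iterate P T H S - π S)) ≈ ∑⊆ Ω (λ S → μ S * abs (h S))
          ∑abs = ≈-trans (∑≈∑⊆ (λ S → abs (iterate P T H S - π S))) (Sub.cong Ω λ S _ → ≈-trans
            (abs-cong (≈-trans (+-cong (iterate≈ H T S) (-‿cong (stationary-unique stationary S)))
              (solve 3 (λ m g z → m :* g :- m :* z := m :* (g :- z)) ≈-refl (μ S) (density H T S) (Z ⁻¹))))
            (abs-* (h S) (proj₁ (w>0 S))))

          squared : sq (∑⊆ Ω (λ S → μ S * abs (h S))) ≤ sq ε
          squared = *-cancelʳ-≤ (^-pos m 0<2) (begin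
            sq (∑⊆ Ω (λ S → μ S * abs (h S))) * 2# ^ m
              ≤⟨ *-monoˡ-≤ (proj₁ (^-pos m 0<2)) (cauchySchwarz (λ S → abs (h S))) ⟩
            Z * ∑⊆ Ω (λ S → μ S * sq (abs (h S))) * 2# ^ m
              ≈⟨ *-congʳ (*-congˡ (Sub.cong Ω λ S _ → *-congˡ (sq-abs (h S)))) ⟩
            Z * deviation (density H T) (Z ⁻¹) * 2# ^ m
              ≈⟨ *-congʳ (*-congˡ (deviation-cong (λ _ → ≈-refl) (≈-sym (mean-density H T)))) ⟩
            Z * V (density H T) * 2# ^ m
              ≈⟨ solve 3 (λ z v q → z :* v :* q := z :* (q :* v)) ≈-refl Z (V (density H T)) (2# ^ m) ⟩
            Z * (2# ^ m * V (density H T))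
              ≤⟨ *-monoʳ-≤ (proj₁ Z>0) (halving-iterated (λ t → V (density H t)) N (λ t → V-antitone _) (λ t → contraction _) m) ⟩
            Z * V (density H 0)
              ≤⟨ *-monoʳ-≤ (proj₁ Z>0) (V₀ H) ⟩
            Z * μ H ⁻¹
              ≤⟨ enough H ⟩
            2# ^ m * sq ε
              ≈⟨ *-comm _ _ ⟩
            sq ε * 2# ^ m ∎)

        mixingTime : Σ[ τ ∈ ℕ ] IsMixingTime P π ε τ × τ ℕ.≤ m ℕ.* N
        mixingTime = max 0 (List.map hit (subsets n)) , (hit , (λ H → proj₁ (proj₂ (search H))) , refl) ,
          max≤v⁺ ℕ.z≤n (Allₚ.map⁺ (All.universal (λ H → proj₂ (proj₂ (search H))) (subsets n)))
          where
          Close : Subset n → ℕ → Set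
          Close H t = totalVariation (iterate P t H) π ≤ ε
          search : ∀ H → Σ[ t ∈ ℕ ] IsLeast (Close H) t × t ℕ.≤ m ℕ.* N
          search H = least (Close H) (λ t → totalVariation (iterate P t H) π ≤? ε) (m ℕ.* N) (closeAt H)
          hit : Subset n → ℕ
          hit H = proj₁ (search H)

-- Logarithms, real powers and the final constants.

module MixingBound (ℝ : CompleteOrderedField) where

  open import Data.Integer.Base using (+_)
  open Reals ℝ
  open Cube ℝ
  open Rank using (rank≤∣∣)
  open TreeDecompositions
  open Weights ℝ
  open Mixing ℝ
  open Chains ℝ

  *-cancelˡ-≤ : ∀ {z x y} → 0# < z → z * x ≤ z * y → x ≤ y
  *-cancelˡ-≤ 0<z p = *-cancelʳ-≤ 0<z (≤-trans (≤-reflexive (*-comm _ _)) (≤-trans p (≤-reflexive (*-comm _ _))))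

  discreteLog : ∀ {r} → 1# ≤ r → ∃[ k ] 2# ^ k ≤ r × r ≤ 2# ^ suc k
  discreteLog {r} 1≤r = let (m , r≤m) = archimedean r in go m (≤-trans r≤m (fromℕ≤2^ m))
    where
    go : ∀ m → r ≤ 2# ^ m → ∃[ k ] 2# ^ k ≤ r × r ≤ 2# ^ suc k
    go zero    p = 0 , 1≤r , ≤-trans p (1≤^ 1 1≤2)
    go (suc m) p with r ≤? 2# ^ m
    ... | yes q = go m q
    ... | no ¬q = m , proj₁ (≰⇒> ¬q) , p

  ceiling : ∀ x → 0# ≤ x → ∃[ N ] x ≤ fromℕ N × fromℕ N ≤ x + 1#
  ceiling x 0≤x = let (m , x≤m) = archimedean x in go m x≤m
    where
    go : ∀ m → x ≤ fromℕ m → ∃[ N ] x ≤ fromℕ N × fromℕ N ≤ x + 1#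
    go zero    p = 0 , p , +-nonNeg 0≤x 0≤1
    go (suc m) p with x ≤? fromℕ m
    ... | yes q = go m q
    ... | no ¬q = suc m , p , ≤-trans (≤-reflexive (≈-sym (fromℕ-suc m))) (+-monoˡ-≤ 1# (proj₁ (≰⇒> ¬q)))

  bernoulli : ∀ {δ} → 0# ≤ δ → ∀ k → 1# + fromℕ k * δ ≤ (1# + δ) ^ k
  bernoulli {δ} 0≤δ zero = ≤-reflexive (≈-trans (+-congˡ (zeroˡ δ)) (+-identityʳ 1#))
  bernoulli {δ} 0≤δ (suc k) = begin
    1# + fromℕ (suc k) * δ                  ≈⟨ +-congˡ (≈-trans (*-congʳ (≈-sym (fromℕ-suc k))) (≈-trans (distribʳ _ _ _) (+-congˡ (*-identityˡ δ)))) ⟩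
    1# + (fromℕ k * δ + δ)                  ≈⟨ +-assoc _ _ _ ⟨
    1# + fromℕ k * δ + δ                    ≈⟨ +-congˡ (*-identityʳ δ) ⟨
    1# + fromℕ k * δ + δ * 1#               ≤⟨ +-mono-≤ (bernoulli 0≤δ k) (*-monoʳ-≤ 0≤δ (1≤^ k (x≤x+y 0≤δ))) ⟩
    (1# + δ) ^ k + δ * (1# + δ) ^ k         ≈⟨ +-congʳ (*-identityˡ _) ⟨
    1# * (1# + δ) ^ k + δ * (1# + δ) ^ k    ≈⟨ distribʳ _ _ _ ⟨
    (1# + δ) ^ suc k                        ∎

  -- Rounding the logarithm of Λ to an integer is useful only once Λ has been raised to a power that
  -- reaches 2; Bernoulli's inequality provides one.
  large-power : ∀ {Λ} → 1# < Λ → ∃[ q ] 2# ≤ Λ ^ suc q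
  large-power {Λ} 1<Λ = let (k , δ⁻¹≤k) = archimedean (δ ⁻¹) in k , (begin
    2#                          ≈⟨ +-congˡ (+-identityʳ 1#) ⟩
    1# + 1#                     ≈⟨ +-congˡ (⁻¹-inverseˡ 0<δ) ⟨
    1# + δ ⁻¹ * δ               ≤⟨ +-monoʳ-≤ 1# (*-monoˡ-≤ (proj₁ 0<δ) (≤-trans δ⁻¹≤k (fromℕ-mono-≤ (ℕₚ.n≤1+n k)))) ⟩
    1# + fromℕ (suc k) * δ      ≤⟨ bernoulli (proj₁ 0<δ) (suc k) ⟩
    (1# + δ) ^ suc k            ≈⟨ ^-congˡ (suc k) (≈-trans (+-comm 1# δ) (x-z+z≈x Λ 1#)) ⟩
    Λ ^ suc k                   ∎)
    where
    δ = Λ - 1#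
    0<δ : 0# < δ
    0<δ = x<y⇒0<y-x 1<Λ

  -- A rational p / (1 + q) with log₂ Λ / 4 ≤ p / (1 + q) ≤ log₂ Λ.
  roughLog : ∀ {Λ} → 1# ≤ Λ → ∃[ p ] ∃[ q ] 2# ^ p ≤ Λ ^ suc q × Λ ^ suc q ≤ 2# ^ (4 ℕ.* p)
  roughLog {Λ} 1≤Λ with Λ ≤? 1#
  ... | yes Λ≤1 = 0 , 0 , 1≤^ 1 1≤Λ , ≤-trans (≤-reflexive (*-identityʳ Λ)) Λ≤1
  ... | no ¬p = let (q , 2≤) = large-power (≰⇒> ¬p) in fromDiscrete q 2≤ (discreteLog (1≤^ (suc q) 1≤Λ))
    where
    fromDiscrete : ∀ q → 2# ≤ Λ ^ suc q → ∃[ k ] 2# ^ k ≤ Λ ^ suc q × Λ ^ suc q ≤ 2# ^ suc k →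
      ∃[ p ] ∃[ q ] 2# ^ p ≤ Λ ^ suc q × Λ ^ suc q ≤ 2# ^ (4 ℕ.* p)
    -- With p the rounded logarithm k, the upper bound needs k + 1 ≤ 4 k, which fails only for k =
    -- 0; there p = 1 works because the power is at least 2.
    fromDiscrete q 2≤ (zero , _ , le) = 1 , q , ≤-trans (≤-reflexive (*-identityʳ 2#)) 2≤ ,
      ≤-trans le (^-monoʳ-≤ {2#} {1} {4} 1≤2 (ℕ.s≤s ℕ.z≤n))
    fromDiscrete q 2≤ (suc k , ge , le) = suc k , q , ge , ≤-trans le (^-monoʳ-≤ 1≤2
      (ℕₚ.≤-trans (ℕₚ.≤-trans (ℕ.s≤s (ℕ.s≤s (ℕₚ.m≤n*m k 4))) (ℕₚ.+-monoˡ-≤ (4 ℕ.* k) {2} {4} (ℕ.s≤s (ℕ.s≤s ℕ.z≤n)))) (ℕₚ.≤-reflexive (≡.sym (ℕₚ.*-suc 4 k)))))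

  log₂-≥ : ∀ {r} (0<r : 0# < r) p q → 2# ^ p ≤ r ^ suc q → fromℕ p ≤ log₂ r 0<r * fromℕ (suc q)
  log₂-≥ {r} 0<r p q le = begin
    fromℕ p                     ≈⟨ s*q ⟨
    s * fromℕ (suc q)           ≤⟨ *-monoˡ-≤ (fromℕ-nonNeg (suc q)) (proj₁ (proj₂ (log₂-sup r 0<r))
      (p , 0 , q , ≈-trans (+-identityʳ _) s*q , ≤-trans le (≤-reflexive (≈-sym (*-identityʳ _))))) ⟩
    log₂ r 0<r * fromℕ (suc q)  ∎
    where
    s = fromℕ p * fromℕ (suc q) ⁻¹
    s*q : s * fromℕ (suc q) ≈ fromℕ p
    s*q = ≈-trans (*-assoc _ _ _) (≈-trans (*-congˡ (⁻¹-inverseˡ (0<fromℕ-suc q))) (*-identityʳ _))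

  -- As the logarithm is a supremum, bounding it from above goes by contradiction: if it exceeded
  -- -p/(1+q), some rational z in `Log₂Below r` would exceed it too, and clearing denominators
  -- refutes this by comparing integer powers of two.
  log₂-≤ : ∀ {r} (0<r : 0# < r) p q → 2# ^ p * r ^ suc q ≤ 1# → fromℕ p ≤ - log₂ r 0<r * fromℕ (suc q)
  log₂-≤ {r} 0<r p q le with fromℕ p ≤? - log₂ r 0<r * fromℕ (suc q)
  ... | yes done = done
  ... | no ¬done = ⊥-elim (absurd (proj₂ (proj₂ (log₂-sup r 0<r)) -s<log))
    where
    y = fromℕ (suc q)
    0<y : 0# < y
    0<y = 0<fromℕ-suc q
    s = fromℕ p * y ⁻¹
    s*y : s * y ≈ fromℕ p
    s*y = ≈-trans (*-assoc _ _ _) (≈-trans (*-congˡ (⁻¹-inverseˡ 0<y)) (*-identityʳ _))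
    -s<log : - s < log₂ r 0<r
    -s<log = ≰⇒> λ log≤-s → ¬done (begin
      fromℕ p             ≈⟨ s*y ⟨
      s * y               ≈⟨ *-congʳ (solve 1 (λ s → s := :- (:- s)) ≈-refl s) ⟩
      - (- s) * y         ≤⟨ *-monoˡ-≤ (proj₁ 0<y) (0≤y-x⇒x≤y (≤-trans (x≤y⇒0≤y-x log≤-s) (≤-reflexive
                               (solve 2 (λ l s → :- s :- l := :- l :- (:- (:- s))) ≈-refl (log₂ r 0<r) s)))) ⟩
      - log₂ r 0<r * y    ∎)

    absurd : ¬ (∃[ z ] Log₂Below r z × - s < z)
    absurd (z , (a , b , q′ , eq , below) , -s<z) = <⇒≱ -s<z (*-cancelʳ-≤ (*-pos 0<y 0<y′) (begin
      z * (y * y′)                              ≈⟨ solve 4 (λ z y y′ b → z :* (y :* y′) := (z :* y′ :+ b) :* y :- b :* y) ≈-refl z y y′ (fromℕ b) ⟩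
      (z * y′ + fromℕ b) * y - fromℕ b * y      ≈⟨ +-congʳ (*-congʳ eq) ⟩
      fromℕ a * y - fromℕ b * y                 ≈⟨ solve 3 (λ a b c → a :- b := (a :+ c) :- b :- c) ≈-refl (fromℕ a * y) (fromℕ b * y) (fromℕ p * y′) ⟩
      (fromℕ a * y + fromℕ p * y′) - fromℕ b * y - fromℕ p * y′
                                                ≤⟨ +-monoˡ-≤ _ (+-monoˡ-≤ _ exponents) ⟩
      fromℕ b * y - fromℕ b * y - fromℕ p * y′  ≈⟨ +-congʳ (-‿inverseʳ _) ⟩
      0# - fromℕ p * y′                         ≈⟨ +-congˡ (-‿cong (*-congʳ (≈-sym s*y))) ⟩
      0# - s * y * y′                           ≈⟨ solve 3 (λ s y y′ → con (+ 0) :- s :* y :* y′ := (:- s) :* (y :* y′)) ≈-refl s y y′ ⟩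
      - s * (y * y′)                            ∎))
      where
      y′ = fromℕ (suc q′)
      0<y′ : 0# < y′
      0<y′ = 0<fromℕ-suc q′

      -- `below` is raised to the power 1 + q and `le` to the power 1 + q′; r then has the same
      -- exponent in both and drops out.
      powers : 2# ^ (a ℕ.* suc q ℕ.+ p ℕ.* suc q′) ≤ 2# ^ (b ℕ.* suc q)
      powers = begin
        2# ^ (a ℕ.* suc q ℕ.+ p ℕ.* suc q′)                         ≈⟨ ^-homo-* 2# (a ℕ.* suc q) (p ℕ.* suc q′) ⟩
        2# ^ (a ℕ.* suc q) * 2# ^ (p ℕ.* suc q′)                    ≈⟨ *-cong (^-assocʳ 2# a (suc q)) (^-assocʳ 2# p (suc q′)) ⟨
        (2# ^ a) ^ suc q * (2# ^ p) ^ suc q′                        ≤⟨ *-monoˡ-≤ (^-nonNeg (suc q′) (^-nonNeg p (proj₁ 0<2))) (^-monoˡ-≤ (suc q) (^-nonNeg a (proj₁ 0<2)) below) ⟩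
        (r ^ suc q′ * 2# ^ b) ^ suc q * (2# ^ p) ^ suc q′           ≈⟨ *-congʳ (^-distrib-* (r ^ suc q′) (2# ^ b) (suc q)) ⟩
        (r ^ suc q′) ^ suc q * (2# ^ b) ^ suc q * (2# ^ p) ^ suc q′ ≈⟨ *-congʳ (*-congʳ (≈-trans (^-assocʳ r (suc q′) (suc q)) (≈-trans (^-congʳ r (ℕₚ.*-comm (suc q′) (suc q))) (≈-sym (^-assocʳ r (suc q) (suc q′)))))) ⟩
        (r ^ suc q) ^ suc q′ * (2# ^ b) ^ suc q * (2# ^ p) ^ suc q′ ≈⟨ solve 3 (λ r b p → r :* b :* p := (p :* r) :* b) ≈-refl _ _ _ ⟩
        (2# ^ p) ^ suc q′ * (r ^ suc q) ^ suc q′ * (2# ^ b) ^ suc q ≈⟨ *-congʳ (^-distrib-* (2# ^ p) (r ^ suc q) (suc q′)) ⟨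
        (2# ^ p * r ^ suc q) ^ suc q′ * (2# ^ b) ^ suc q            ≤⟨ *-monoˡ-≤ (^-nonNeg (suc q) (^-nonNeg b (proj₁ 0<2))) (^-monoˡ-≤ (suc q′) (*-nonNeg (^-nonNeg p (proj₁ 0<2)) (^-nonNeg (suc q) (proj₁ 0<r))) le) ⟩
        1# ^ suc q′ * (2# ^ b) ^ suc q                              ≈⟨ *-congʳ (1^ (suc q′)) ⟩
        1# * (2# ^ b) ^ suc q                                       ≈⟨ *-identityˡ _ ⟩
        (2# ^ b) ^ suc q                                            ≈⟨ ^-assocʳ 2# b (suc q) ⟩
        2# ^ (b ℕ.* suc q)                                          ∎
        where
        1^ : ∀ k → 1# ^ k ≈ 1#
        1^ zero    = ≈-refl
        1^ (suc k) = ≈-trans (*-identityˡ _) (1^ k)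

      exponents : fromℕ a * y + fromℕ p * y′ ≤ fromℕ b * y
      exponents = begin
        fromℕ a * y + fromℕ p * y′                        ≈⟨ +-cong (×1-homo-* a (suc q)) (×1-homo-* p (suc q′)) ⟨
        fromℕ (a ℕ.* suc q) + fromℕ (p ℕ.* suc q′)        ≈⟨ ×-homo-+ 1# (a ℕ.* suc q) (p ℕ.* suc q′) ⟨
        fromℕ (a ℕ.* suc q ℕ.+ p ℕ.* suc q′)              ≤⟨ fromℕ-mono-≤ (2^-cancel-≤ {a ℕ.* suc q ℕ.+ p ℕ.* suc q′} {b ℕ.* suc q} powers) ⟩
        fromℕ (b ℕ.* suc q)                               ≈⟨ ×1-homo-* b (suc q) ⟩
        fromℕ b * y                                       ∎

  -- Λ = max r r⁻¹ and l = log₂ Λ.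
  record Amplitude (r l : Carrier) : Set where
    field
      Λ up lo  : Carrier
      1≤Λ      : 1# ≤ Λ
      up*lo    : up * lo ≈ Λ * Λ
      r^≤up    : ∀ δ → δ ℕ.≤ 2 → r ^ δ ≤ up
      1≤lo*r^  : ∀ δ → δ ℕ.≤ 2 → 1# ≤ lo * r ^ δ
      Λ-log    : ∀ p q → 2# ^ p ≤ Λ ^ suc q → fromℕ p ≤ l * fromℕ (suc q)

  amplitude : ∀ {r} (0<r : 0# < r) → Amplitude r (abs (log₂ r 0<r))
  amplitude {r} 0<r with total 1# r
  ... | inj₁ 1≤r = record
    { Λ = r ; up = r * r ; lo = 1# ; 1≤Λ = 1≤r ; up*lo = *-identityʳ _
    ; r^≤up = λ δ δ≤2 → ≤-trans (^-monoʳ-≤ 1≤r δ≤2) (≤-reflexive (*-congˡ (*-identityʳ r)))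
    ; 1≤lo*r^ = λ δ _ → ≤-trans (1≤^ δ 1≤r) (≤-reflexive (≈-sym (*-identityˡ _)))
    ; Λ-log = λ p q le → ≤-trans (log₂-≥ 0<r p q le) (*-monoˡ-≤ (fromℕ-nonNeg (suc q)) (Max.x≤x⊔y _ _))
    }
  ... | inj₂ r≤1 = record
    { Λ = r ⁻¹ ; up = 1# ; lo = r ⁻¹ * r ⁻¹ ; 1≤Λ = 1≤r⁻¹ ; up*lo = *-identityˡ _
    ; r^≤up = λ δ _ → r^≤1 δ
    ; 1≤lo*r^ = 1≤lo
    ; Λ-log = λ p q le → ≤-trans (log₂-≤ 0<r p q (begin
        2# ^ p * r ^ suc q            ≤⟨ *-monoˡ-≤ (^-nonNeg (suc q) (proj₁ 0<r)) le ⟩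
        (r ⁻¹) ^ suc q * r ^ suc q    ≈⟨ inverse^ (suc q) ⟩
        1#                            ∎)) (*-monoˡ-≤ (fromℕ-nonNeg (suc q)) (Max.x≤y⊔x _ _))
    }
    where
    1≤r⁻¹ : 1# ≤ r ⁻¹
    1≤r⁻¹ = begin
      1#        ≈⟨ ⁻¹-inverseʳ (>⇒≉0 0<r) ⟨
      r * r ⁻¹  ≤⟨ *-monoˡ-≤ (proj₁ (⁻¹-pos 0<r)) r≤1 ⟩
      1# * r ⁻¹ ≈⟨ *-identityˡ _ ⟩
      r ⁻¹      ∎
    r^≤1 : ∀ δ → r ^ δ ≤ 1#
    r^≤1 zero    = ≤-refl
    r^≤1 (suc δ) = ≤-trans (*-mono-≤ (proj₁ 0<r) (^-nonNeg δ (proj₁ 0<r)) r≤1 (r^≤1 δ)) (≤-reflexive (*-identityˡ 1#))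
    inverse^ : ∀ δ → (r ⁻¹) ^ δ * r ^ δ ≈ 1#
    inverse^ zero    = *-identityˡ 1#
    inverse^ (suc δ) = ≈-trans (solve 4 (λ i a r b → (i :* a) :* (r :* b) := (i :* r) :* (a :* b)) ≈-refl _ _ _ _)
      (≈-trans (*-cong (⁻¹-inverseˡ 0<r) (inverse^ δ)) (*-identityˡ 1#))
    1≤lo : ∀ δ → δ ℕ.≤ 2 → 1# ≤ r ⁻¹ * r ⁻¹ * r ^ δ
    1≤lo δ δ≤2 = begin
      1#                        ≈⟨ inverse^ δ ⟨
      (r ⁻¹) ^ δ * r ^ δ        ≤⟨ *-monoˡ-≤ (^-nonNeg δ (proj₁ 0<r)) (^-monoʳ-≤ 1≤r⁻¹ δ≤2) ⟩
      (r ⁻¹) ^ 2 * r ^ δ        ≈⟨ *-congʳ (*-congˡ (*-identityʳ _)) ⟩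
      r ⁻¹ * r ⁻¹ * r ^ δ       ∎

  binaryLength : ∀ n .{{_ : NonZero n}} → ∃[ ℓ ] 2 ℕ.^ ℓ ℕ.≤ n × n ℕ.< 2 ℕ.^ suc ℓ
  binaryLength n = go n (n<2^n n)
    where
    n<2^n : ∀ n → n ℕ.< 2 ℕ.^ n
    n<2^n zero    = ℕ.s≤s ℕ.z≤n
    n<2^n (suc n) = ℕₚ.≤-trans (ℕ.s≤s (n<2^n n)) (ℕₚ.≤-trans (ℕₚ.+-monoˡ-≤ (2 ℕ.^ n) (ℕₚ.m^n>0 2 n))
      (ℕₚ.≤-reflexive (≡.cong (2 ℕ.^ n ℕ.+_) (≡.sym (ℕₚ.+-identityʳ (2 ℕ.^ n))))))
    go : ∀ m → n ℕ.< 2 ℕ.^ m → ∃[ ℓ ] 2 ℕ.^ ℓ ℕ.≤ n × n ℕ.< 2 ℕ.^ suc ℓ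
    go zero    p = ⊥-elim (ℕₚ.<⇒≱ p (ℕₚ.n≢0⇒n>0 (ℕ.≢-nonZero⁻¹ n)))
    go (suc m) p with n ℕₚ.<? 2 ℕ.^ m
    ... | yes q = go m q
    ... | no ¬q = m , ℕₚ.≮⇒≥ ¬q , p

  fromℕ-2^ : ∀ ℓ → fromℕ (2 ℕ.^ ℓ) ≈ 2# ^ ℓ
  fromℕ-2^ zero    = +-identityʳ 1#
  fromℕ-2^ (suc ℓ) = ≈-trans (×1-homo-* 2 (2 ℕ.^ ℓ)) (*-congˡ (fromℕ-2^ ℓ))

  ∑⊆-const : ∀ n c → ∑⊆ (⊤ˢ {n}) (λ _ → c) ≈ 2# ^ n * c
  ∑⊆-const zero    c = ≈-sym (*-identityˡ c)
  ∑⊆-const (suc n) c = ≈-trans (+-cong (∑⊆-const n c) (∑⊆-const n c)) (≈-trans (≈-sym (2*x≈x+x _)) (≈-sym (*-assoc _ _ _)))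

  -- 1 ≤ c * Q expresses c⁻¹ ≤ Q without division.
  module Extremal {a b Q : Carrier} (0<a : 0# < a) (0<b : 0# < b) (1≤Q : 1# ≤ Q)
    (a≤Q : a ≤ Q) (b≤Q : b ≤ Q) (1≤aQ : 1# ≤ a * Q) (1≤bQ : 1# ≤ b * Q) where

    monomial≤ : ∀ {n} i j → i ℕ.+ j ℕ.≤ n → a ^ i * b ^ j ≤ Q ^ n
    monomial≤ {n} i j i+j≤n = begin
      a ^ i * b ^ j    ≤⟨ *-mono-≤ (^-nonNeg i (proj₁ 0<a)) (^-nonNeg j (proj₁ 0<b)) (^-monoˡ-≤ i (proj₁ 0<a) a≤Q) (^-monoˡ-≤ j (proj₁ 0<b) b≤Q) ⟩
      Q ^ i * Q ^ j    ≈⟨ ^-homo-* Q i j ⟨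
      Q ^ (i ℕ.+ j)    ≤⟨ ^-monoʳ-≤ 1≤Q i+j≤n ⟩
      Q ^ n            ∎

    1≤monomial : ∀ {n} i j → i ℕ.+ j ℕ.≤ n → 1# ≤ a ^ i * b ^ j * Q ^ n
    1≤monomial {n} i j i+j≤n = begin
      1#                                ≈⟨ *-identityˡ 1# ⟨
      1# * 1#                           ≤⟨ *-mono-≤ 0≤1 0≤1 (1≤^ i 1≤aQ) (1≤^ j 1≤bQ) ⟩
      (a * Q) ^ i * (b * Q) ^ j         ≈⟨ *-cong (^-distrib-* a Q i) (^-distrib-* b Q j) ⟩
      (a ^ i * Q ^ i) * (b ^ j * Q ^ j) ≈⟨ solve 4 (λ a q b r → (a :* q) :* (b :* r) := (a :* b) :* (q :* r)) ≈-refl _ _ _ _ ⟩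
      (a ^ i * b ^ j) * (Q ^ i * Q ^ j) ≈⟨ *-congˡ (^-homo-* Q i j) ⟨
      a ^ i * b ^ j * Q ^ (i ℕ.+ j)     ≤⟨ *-monoʳ-≤ (*-nonNeg (^-nonNeg i (proj₁ 0<a)) (^-nonNeg j (proj₁ 0<b))) (^-monoʳ-≤ 1≤Q i+j≤n) ⟩
      a ^ i * b ^ j * Q ^ n             ∎

  module Main {x y : Carrier} (1<x : 1# < x) (1<y : 1# < y) {l : Carrier}
    (amp : Amplitude ((x - 1#) / (y - 1#)) l) (tw : ℕ) where
    open Interlace 1<x 1<y using (a; b; r; 0<a; 0<b; module OnGraph)
    open Amplitude amp

    K : ℕ
    K = suc tw

    Γ : Carrier
    Γ = Λ * Λ

    1≤Γ : 1# ≤ Γ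
    1≤Γ = ≤-trans (≤-reflexive (≈-sym (*-identityˡ 1#))) (*-mono-≤ 0≤1 0≤1 1≤Λ 1≤Λ)

    height : Carrier → ℕ
    height c = proj₁ (archimedean c)

    A₁ A₂ A₃ A₄ A : ℕ
    A₁ = height a
    A₂ = height b
    A₃ = height (a ⁻¹)
    A₄ = height (b ⁻¹)
    A  = A₁ ℕ.+ A₂ ℕ.+ (A₃ ℕ.+ A₄)

    -- A power of two above a, b and their inverses, so that the ratio of extreme weights is bounded
    -- by a power of two with exponent linear in n.
    Q : Carrier
    Q = 2# ^ A

    ≤Q : ∀ c → height c ℕ.≤ A → c ≤ Q
    ≤Q c p = ≤-trans (proj₂ (archimedean c)) (≤-trans (fromℕ-mono-≤ p) (fromℕ≤2^ A))

    1≤cQ : ∀ {c} → 0# < c → height (c ⁻¹) ℕ.≤ A → 1# ≤ c * Q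
    1≤cQ {c} 0<c p = ≤-trans (≤-reflexive (≈-sym (⁻¹-inverseʳ (>⇒≉0 0<c)))) (*-monoʳ-≤ (proj₁ 0<c) (≤Q (c ⁻¹) p))

    open Extremal {a} {b} {Q} 0<a 0<b (1≤^ A 1≤2)
      (≤Q a (ℕₚ.≤-trans (ℕₚ.m≤m+n A₁ A₂) (ℕₚ.m≤m+n (A₁ ℕ.+ A₂) (A₃ ℕ.+ A₄))))
      (≤Q b (ℕₚ.≤-trans (ℕₚ.m≤n+m A₂ A₁) (ℕₚ.m≤m+n (A₁ ℕ.+ A₂) (A₃ ℕ.+ A₄))))
      (1≤cQ 0<a (ℕₚ.≤-trans (ℕₚ.m≤m+n A₃ A₄) (ℕₚ.m≤n+m (A₃ ℕ.+ A₄) (A₁ ℕ.+ A₂))))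
      (1≤cQ 0<b (ℕₚ.≤-trans (ℕₚ.m≤n+m A₄ A₃) (ℕₚ.m≤n+m (A₃ ℕ.+ A₄) (A₁ ℕ.+ A₂))))

    -- The total weight is at most 2^n Q^n and `μ H ⁻¹` at most Q^n, together 2^(B n).
    B : ℕ
    B = 1 ℕ.+ (A ℕ.+ A)

    -- The 5 absorbs the rounding of 4 n C to an integer, B + 4 comes from the number m of halvings,
    -- and `Γ ^ K` from the summand 1 in the treedepth bound K (1 + ℓ).
    constant : Carrier
    constant = fromℕ 5 * (fromℕ B + fromℕ 4) * Γ ^ K

    -- `pow` being a supremum, one admissible rational exponent suffices: 2 + 8 K p/(1+q) with p and
    -- q from `roughLog`. It is admissible because p/(1+q) is at most l. It is large enough because
    -- Λ is at most 2^(4p/(1+q)), so that Γ^(ℓ K) is at most (2^ℓ)^(8 K p/(1+q)), and 2^ℓ is at most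
    -- n.
    pow-≥ : ∀ n .{{_ : NonZero n}} ℓ → 2 ℕ.^ ℓ ℕ.≤ n →
      fromℕ n * fromℕ n * Γ ^ (ℓ ℕ.* K) ≤ pow (fromℕ n) (1≤fromℕ n) (fromℕ 2 + fromℕ 8 * fromℕ K * l)
    pow-≥ n ℓ 2^ℓ≤n = let (p , q , 2^p≤ , ≤2^4p) = roughLog 1≤Λ in
      proj₁ (proj₂ (pow-sup ν (1≤fromℕ n) t))
        ( 2 ℕ.* suc q ℕ.+ 8 ℕ.* K ℕ.* p , 0 , q , exponents p q (Λ-log p q 2^p≤)
        , *-nonNeg (*-nonNeg (fromℕ-nonNeg n) (fromℕ-nonNeg n)) (^-nonNeg (ℓ ℕ.* K) (≤-trans 0≤1 1≤Γ))
        , ≤-trans (≤-reflexive (*-identityʳ _)) (powers p q ≤2^4p))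
      where
      ν = fromℕ n
      t = fromℕ 2 + fromℕ 8 * fromℕ K * l

      exponents : ∀ p q → fromℕ p ≤ l * fromℕ (suc q) →
        fromℕ (2 ℕ.* suc q ℕ.+ 8 ℕ.* K ℕ.* p) ≤ t * fromℕ (suc q) + fromℕ 0
      exponents p q le = begin
        fromℕ (2 ℕ.* suc q ℕ.+ 8 ℕ.* K ℕ.* p)
          ≈⟨ ≈-trans (×-homo-+ 1# (2 ℕ.* suc q) (8 ℕ.* K ℕ.* p)) (+-cong (×1-homo-* 2 (suc q)) (≈-trans (×1-homo-* (8 ℕ.* K) p) (*-congʳ (×1-homo-* 8 K)))) ⟩
        fromℕ 2 * fromℕ (suc q) + fromℕ 8 * fromℕ K * fromℕ p
          ≤⟨ +-monoʳ-≤ _ (*-monoʳ-≤ (*-nonNeg (fromℕ-nonNeg 8) (fromℕ-nonNeg K)) le) ⟩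
        fromℕ 2 * fromℕ (suc q) + fromℕ 8 * fromℕ K * (l * fromℕ (suc q))
          ≈⟨ solve 4 (λ t c k y → t :* y :+ c :* (k :* y) := (t :+ c :* k) :* y :+ con (+ 0)) ≈-refl (fromℕ 2) (fromℕ 8 * fromℕ K) l (fromℕ (suc q)) ⟩
        (fromℕ 2 + fromℕ 8 * fromℕ K * l) * fromℕ (suc q) + fromℕ 0 ∎

      powers : ∀ p q → Λ ^ suc q ≤ 2# ^ (4 ℕ.* p) →
        (ν * ν * Γ ^ (ℓ ℕ.* K)) ^ suc q ≤ ν ^ (2 ℕ.* suc q ℕ.+ 8 ℕ.* K ℕ.* p)
      powers p q le = begin
        (ν * ν * Γ ^ (ℓ ℕ.* K)) ^ suc q
          ≈⟨ ^-distrib-* (ν * ν) (Γ ^ (ℓ ℕ.* K)) (suc q) ⟩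
        (ν * ν) ^ suc q * (Γ ^ (ℓ ℕ.* K)) ^ suc q
          ≈⟨ *-cong (≈-trans (^-congˡ (suc q) (*-congˡ (≈-sym (*-identityʳ ν)))) (^-assocʳ ν 2 (suc q)))
               (≈-trans (^-assocʳ Γ (ℓ ℕ.* K) (suc q)) (≈-trans (^-congʳ Γ (ℕₚ.*-comm (ℓ ℕ.* K) (suc q))) (≈-sym (^-assocʳ Γ (suc q) (ℓ ℕ.* K))))) ⟩
        ν ^ (2 ℕ.* suc q) * (Γ ^ suc q) ^ (ℓ ℕ.* K)
          ≤⟨ *-monoʳ-≤ (^-nonNeg (2 ℕ.* suc q) (fromℕ-nonNeg n)) (^-monoˡ-≤ (ℓ ℕ.* K) (^-nonNeg (suc q) (≤-trans 0≤1 1≤Γ)) Γ≤) ⟩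
        ν ^ (2 ℕ.* suc q) * (2# ^ (8 ℕ.* p)) ^ (ℓ ℕ.* K)
          ≈⟨ *-congˡ (≈-trans (^-assocʳ 2# (8 ℕ.* p) (ℓ ℕ.* K)) (≈-trans (^-congʳ 2# (rearrange p)) (≈-sym (^-assocʳ 2# ℓ (8 ℕ.* K ℕ.* p))))) ⟩
        ν ^ (2 ℕ.* suc q) * (2# ^ ℓ) ^ (8 ℕ.* K ℕ.* p)
          ≤⟨ *-monoʳ-≤ (^-nonNeg (2 ℕ.* suc q) (fromℕ-nonNeg n)) (^-monoˡ-≤ (8 ℕ.* K ℕ.* p) (^-nonNeg ℓ (proj₁ 0<2))
               (≤-trans (≤-reflexive (≈-sym (fromℕ-2^ ℓ))) (fromℕ-mono-≤ 2^ℓ≤n))) ⟩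
        ν ^ (2 ℕ.* suc q) * ν ^ (8 ℕ.* K ℕ.* p)
          ≈⟨ ^-homo-* ν (2 ℕ.* suc q) (8 ℕ.* K ℕ.* p) ⟨
        ν ^ (2 ℕ.* suc q ℕ.+ 8 ℕ.* K ℕ.* p) ∎
        where
        Γ≤ : Γ ^ suc q ≤ 2# ^ (8 ℕ.* p)
        Γ≤ = begin
          (Λ * Λ) ^ suc q                      ≈⟨ ^-distrib-* Λ Λ (suc q) ⟩
          Λ ^ suc q * Λ ^ suc q                ≤⟨ *-mono-≤ (^-nonNeg (suc q) (≤-trans 0≤1 1≤Λ)) (^-nonNeg (suc q) (≤-trans 0≤1 1≤Λ)) le le ⟩
          2# ^ (4 ℕ.* p) * 2# ^ (4 ℕ.* p)      ≈⟨ ^-homo-* 2# (4 ℕ.* p) (4 ℕ.* p) ⟨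
          2# ^ (4 ℕ.* p ℕ.+ 4 ℕ.* p)           ≡⟨ ≡.cong (2# ^_) (≡.sym (ℕₚ.*-distribʳ-+ p 4 4)) ⟩
          2# ^ (8 ℕ.* p)                       ∎
        rearrange : ∀ p → 8 ℕ.* p ℕ.* (ℓ ℕ.* K) ≡ ℓ ℕ.* (8 ℕ.* K ℕ.* p)
        rearrange p = ℕSolver.+-*-Solver.solve 3 (λ p l k → ℕSolver.+-*-Solver.con 8 :*′ p :*′ (l :*′ k) :=′ l :*′ (ℕSolver.+-*-Solver.con 8 :*′ k :*′ p)) refl p ℓ K
          where open ℕSolver.+-*-Solver using () renaming (_:*_ to _:*′_; _:=_ to _:=′_)

    instance
      l≡l : l ≡ l
      l≡l = refl

    -- The copy l′ of l is instantiated by unification: comparing real powers by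
    -- conversion would unfold their construction.
    bound : ∀ {l′} {{_ : l′ ≡ l}} (n : ℕ) .{{_ : NonZero n}} (G : Graph n) → HasTreeWidth G tw →
      (π : Distribution n) → IsStationary (flipChain (interlaceWeight x y) G) π →
      (ε : Carrier) (0<ε : 0# < ε) → ε ≤ ½ →
      Σ[ τ ∈ ℕ ] (IsMixingTime (flipChain (interlaceWeight x y) G) π ε τ
        × fromℕ τ ≤ constant * (pow (fromℕ n) (1≤fromℕ n) (fromℕ 2 + fromℕ 8 * fromℕ (suc tw) * l′) * log₂ (1# / ε) (/-pos 0<1 0<ε)))
    bound {{refl}} n G ((decomposition , width≡tw) , _) π stationary ε 0<ε ε≤½ =
      let (τ , mixing , τ≤) = mixed in τ , mixing , (begin
        fromℕ τ
          ≤⟨ fromℕ-mono-≤ τ≤ ⟩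
        fromℕ (m ℕ.* N)
          ≈⟨ ×1-homo-* m N ⟩
        fromℕ m * fromℕ N
          ≤⟨ *-mono-≤ (fromℕ-nonNeg m) (fromℕ-nonNeg N) m≤ N≤ ⟩
        ((fromℕ B + fromℕ 4) * (ν * ℒ)) * (fromℕ 5 * (ν * C))
          ≈⟨ *-congˡ (*-congˡ (*-congˡ C≈)) ⟩
        ((fromℕ B + fromℕ 4) * (ν * ℒ)) * (fromℕ 5 * (ν * (Γ ^ K * Γ ^ (ℓ ℕ.* K))))
          ≈⟨ solve 6 (λ b v l f g h → (b :* (v :* l)) :* (f :* (v :* (g :* h))) := f :* b :* g :* ((v :* v :* h) :* l)) ≈-refl (fromℕ B + fromℕ 4) ν ℒ (fromℕ 5) (Γ ^ K) (Γ ^ (ℓ ℕ.* K)) ⟩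
        constant * ((ν * ν * Γ ^ (ℓ ℕ.* K)) * ℒ)
          ≤⟨ *-monoʳ-≤ 0≤constant (*-monoˡ-≤ (≤-trans 0≤1 1≤ℒ) (pow-≥ n ℓ 2^ℓ≤n)) ⟩
        constant * (pow ν (1≤fromℕ n) (fromℕ 2 + fromℕ 8 * fromℕ K * l) * ℒ) ∎)
      where
      open OnGraph G using (μ; μ>0; μ-multiplicative; μ-addVertex; ρ; isRank)

      ν = fromℕ n
      1≤ν = 1≤fromℕ n

      ℓ : ℕ
      ℓ = proj₁ (binaryLength n)
      2^ℓ≤n : 2 ℕ.^ ℓ ℕ.≤ n
      2^ℓ≤n = proj₁ (proj₂ (binaryLength n))

      C : Carrier
      C = (up * lo) ^ (suc ℓ ℕ.* K)

      C≈ : C ≈ Γ ^ K * Γ ^ (ℓ ℕ.* K)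
      C≈ = ≈-trans (^-congˡ (suc ℓ ℕ.* K) up*lo) (^-homo-* Γ K (ℓ ℕ.* K))

      1≤C : 1# ≤ C
      1≤C = ≤-trans (1≤^ (suc ℓ ℕ.* K) 1≤Γ) (≤-reflexive (^-congˡ (suc ℓ ℕ.* K) (≈-sym up*lo)))

      gap : Poincaré (⊤ˢ {n}) μ C
      gap = Factorising.poincaré G μ μ>0 (λ {U} {V} → μ-multiplicative {U} {V}) {b} {r} {up} {lo} 0<b μ-addVertex r^≤up 1≤lo*r^
        (subst (λ k → Treedepth G (suc ℓ ℕ.* suc k) ⊤ˢ) width≡tw (treedepth decomposition (suc ℓ) ⊤ˢ
          (subst (ℕ._< 2 ℕ.^ suc ℓ) (≡.sym (∣⊤∣≡n n)) (proj₂ (proj₂ (binaryLength n))))))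

      open Chain (interlaceWeight x y) G μ>0 using (γ; n⁻¹; 0<n; Z>0; module Gap)

      -- As γ is 1/(4n), the condition C ≤ N γ asks for N of at least 4 n C.
      4νC : Carrier
      4νC = fromℕ 4 * (ν * C)

      1≤νC : 1# ≤ ν * C
      1≤νC = ≤-trans (≤-reflexive (≈-sym (*-identityˡ 1#))) (*-mono-≤ 0≤1 0≤1 1≤ν 1≤C)

      0≤νC : 0# ≤ ν * C
      0≤νC = ≤-trans 0≤1 1≤νC

      ceil = ceiling 4νC (*-nonNeg (fromℕ-nonNeg 4) 0≤νC)

      N : ℕ
      N = proj₁ ceil

      N≥ : 4νC ≤ fromℕ N
      N≥ = proj₁ (proj₂ ceil)

      N≤ : fromℕ N ≤ fromℕ 5 * (ν * C)
      N≤ = begin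
        fromℕ N              ≤⟨ proj₂ (proj₂ ceil) ⟩
        4νC + 1#             ≤⟨ +-monoʳ-≤ 4νC 1≤νC ⟩
        4νC + ν * C          ≈⟨ solve 1 (λ z → con (+ 4) :* z :+ z := con (+ 5) :* z) ≈-refl (ν * C) ⟩
        fromℕ 5 * (ν * C)    ∎

      instance
        N≢0 : NonZero N
        N≢0 = ℕ.>-nonZero (fromℕ-cancel-≤ (begin
          fromℕ 1             ≈⟨ +-identityʳ 1# ⟩
          1#                  ≤⟨ 1≤νC ⟩
          ν * C               ≈⟨ *-identityˡ _ ⟨
          1# * (ν * C)        ≤⟨ *-monoˡ-≤ 0≤νC (1≤fromℕ 4) ⟩
          4νC                 ≤⟨ N≥ ⟩
          fromℕ N             ∎))

      C≤Nγ : C ≤ fromℕ N * γ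
      C≤Nγ = begin
        C                                       ≈⟨ *-identityʳ C ⟨
        C * 1#                                  ≈⟨ *-congˡ (≈-trans (*-cong (⁻¹-inverseʳ (>⇒≉0 0<n)) (*-cong (⁻¹-inverseʳ (>⇒≉0 0<2)) (⁻¹-inverseʳ (>⇒≉0 0<2))))
                                                     (≈-trans (*-identityˡ _) (*-identityˡ _))) ⟨
        C * (ν * n⁻¹ * ((2# * ½) * (2# * ½)))   ≈⟨ solve 4 (λ c v i h → c :* (v :* i :* ((con (+ 2) :* h) :* (con (+ 2) :* h))) := con (+ 4) :* (v :* c) :* (i :* (h :* h))) ≈-refl C ν n⁻¹ ½ ⟩
        4νC * γ                                 ≤⟨ *-monoˡ-≤ (*-nonNeg (proj₁ (⁻¹-pos 0<n)) (*-nonNeg 0≤½ 0≤½)) N≥ ⟩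
        fromℕ N * γ                             ∎

      R : Carrier
      R = 1# / ε

      0<R : 0# < R
      0<R = /-pos 0<1 0<ε

      ℒ : Carrier
      ℒ = log₂ R 0<R

      ε*R : ε * R ≈ 1#
      ε*R = ≈-trans (*-congˡ (*-identityˡ _)) (⁻¹-inverseʳ (>⇒≉0 0<ε))

      2≤R : 2# ≤ R
      2≤R = *-cancelˡ-≤ 0<ε (begin
        ε * 2#   ≤⟨ *-monoˡ-≤ (proj₁ 0<2) ε≤½ ⟩
        ½ * 2#   ≈⟨ ⁻¹-inverseˡ 0<2 ⟩
        1#       ≈⟨ ε*R ⟨
        ε * R    ∎)

      log≥ : ∀ k → 2# ^ k ≤ R → fromℕ k ≤ ℒ
      log≥ k le = begin
        fromℕ k            ≤⟨ log₂-≥ 0<R k 0 (≤-trans le (≤-reflexive (≈-sym (*-identityʳ R)))) ⟩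
        ℒ * fromℕ 1        ≈⟨ ≈-trans (*-congˡ (+-identityʳ 1#)) (*-identityʳ ℒ) ⟩
        ℒ                  ∎

      -- The hypothesis ε ≤ ½ enters here, through `2≤R`; it lets the logarithm absorb all additive
      -- constants.
      1≤ℒ : 1# ≤ ℒ
      1≤ℒ = ≤-trans (≤-reflexive (≈-sym (+-identityʳ 1#))) (log≥ 1 (≤-trans (≤-reflexive (*-identityʳ 2#)) 2≤R))

      discrete = discreteLog (≤-trans 1≤2 2≤R)

      j : ℕ
      j = suc (proj₁ discrete)

      1≤2^jε : 1# ≤ 2# ^ j * ε
      1≤2^jε = begin
        1#           ≈⟨ ε*R ⟨
        ε * R        ≤⟨ *-monoʳ-≤ (proj₁ 0<ε) (proj₂ (proj₂ discrete)) ⟩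
        ε * 2# ^ j   ≈⟨ *-comm _ _ ⟩
        2# ^ j * ε   ∎

      -- B n halvings bring down the initial variance, and 2 j more reach the square of ε, where 2^j
      -- is at least 1/ε.
      m : ℕ
      m = B ℕ.* n ℕ.+ (j ℕ.+ j)

      j≤ : fromℕ j ≤ ℒ + ℒ
      j≤ = ≤-trans (≤-reflexive (≈-sym (fromℕ-suc (proj₁ discrete)))) (+-mono-≤ (log≥ (proj₁ discrete) (proj₁ (proj₂ discrete))) 1≤ℒ)

      m≤ : fromℕ m ≤ (fromℕ B + fromℕ 4) * (ν * ℒ)
      m≤ = begin
        fromℕ m                                          ≈⟨ ≈-trans (×-homo-+ 1# (B ℕ.* n) (j ℕ.+ j)) (+-cong (×1-homo-* B n) (×-homo-+ 1# j j)) ⟩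
        fromℕ B * ν + (fromℕ j + fromℕ j)                ≤⟨ +-mono-≤ (*-monoʳ-≤ (fromℕ-nonNeg B) (≤-trans (≤-reflexive (≈-sym (*-identityʳ ν))) (*-monoʳ-≤ (fromℕ-nonNeg n) 1≤ℒ))) (+-mono-≤ j≤ j≤) ⟩
        fromℕ B * (ν * ℒ) + ((ℒ + ℒ) + (ℒ + ℒ))          ≈⟨ +-congˡ (solve 1 (λ l → (l :+ l) :+ (l :+ l) := con (+ 4) :* l) ≈-refl ℒ) ⟩
        fromℕ B * (ν * ℒ) + fromℕ 4 * ℒ                  ≤⟨ +-monoʳ-≤ _ (*-monoʳ-≤ (fromℕ-nonNeg 4) (≤-trans (≤-reflexive (≈-sym (*-identityˡ ℒ))) (*-monoˡ-≤ (≤-trans 0≤1 1≤ℒ) 1≤ν))) ⟩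
        fromℕ B * (ν * ℒ) + fromℕ 4 * (ν * ℒ)            ≈⟨ distribʳ _ _ _ ⟨
        (fromℕ B + fromℕ 4) * (ν * ℒ)                    ∎

      0≤constant : 0# ≤ constant
      0≤constant = *-nonNeg (*-nonNeg (fromℕ-nonNeg 5) (+-nonNeg (fromℕ-nonNeg B) (fromℕ-nonNeg 4))) (^-nonNeg K (≤-trans 0≤1 1≤Γ))

      degree : ∀ S → ρ S ℕ.+ (∣ S ∣ ∸ ρ S) ℕ.≤ n
      degree S = ℕₚ.≤-trans (ℕₚ.≤-reflexive (ℕₚ.m+[n∸m]≡n (rank≤∣∣ G (isRank S)))) (∣p∣≤n S)

      Qⁿ = Q ^ n

      0≤Qⁿ : 0# ≤ Qⁿ
      0≤Qⁿ = ^-nonNeg n (^-nonNeg A (proj₁ 0<2))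

      enough : ∀ H → ∑⊆ (⊤ˢ {n}) μ * μ H ⁻¹ ≤ 2# ^ m * sq ε
      enough H = begin
        ∑⊆ (⊤ˢ {n}) μ * μ H ⁻¹
          ≤⟨ *-mono-≤ (proj₁ Z>0) (proj₁ (⁻¹-pos (μ>0 H)))
               (≤-trans (∑⊆-mono (⊤ˢ {n}) (λ S _ → monomial≤ (ρ S) (∣ S ∣ ∸ ρ S) (degree S))) (≤-reflexive (∑⊆-const n Qⁿ))) inverse≤ ⟩
        2# ^ n * Qⁿ * Qⁿ
          ≈⟨ *-identityʳ _ ⟨
        2# ^ n * Qⁿ * Qⁿ * 1#
          ≤⟨ *-monoʳ-≤ (*-nonNeg (*-nonNeg (^-nonNeg n (proj₁ 0<2)) 0≤Qⁿ) 0≤Qⁿ) 1≤ ⟩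
        2# ^ n * Qⁿ * Qⁿ * ((2# ^ j * ε) * (2# ^ j * ε))
          ≈⟨ solve 4 (λ t q j e → t :* q :* q :* ((j :* e) :* (j :* e)) := (t :* (q :* q)) :* (j :* j) :* (e :* e)) ≈-refl (2# ^ n) Qⁿ (2# ^ j) ε ⟩
        (2# ^ n * (Qⁿ * Qⁿ)) * (2# ^ j * 2# ^ j) * sq ε
          ≈⟨ *-congʳ (≈-sym 2^m) ⟩
        2# ^ m * sq ε ∎
        where
        1≤ : 1# ≤ (2# ^ j * ε) * (2# ^ j * ε)
        1≤ = ≤-trans (≤-reflexive (≈-sym (*-identityˡ 1#))) (*-mono-≤ 0≤1 0≤1 1≤2^jε 1≤2^jε)
        inverse≤ : μ H ⁻¹ ≤ Qⁿ
        inverse≤ = *-cancelˡ-≤ (μ>0 H) (≤-trans (≤-reflexive (⁻¹-inverseʳ (>⇒≉0 (μ>0 H)))) (1≤monomial (ρ H) (∣ H ∣ ∸ ρ H) (degree H)))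
        Qⁿ≈ : 2# ^ (A ℕ.* n) ≈ Qⁿ
        Qⁿ≈ = ≈-sym (^-assocʳ 2# A n)
        2^m : 2# ^ m ≈ (2# ^ n * (Qⁿ * Qⁿ)) * (2# ^ j * 2# ^ j)
        2^m = begin-equality
          2# ^ (B ℕ.* n ℕ.+ (j ℕ.+ j))                    ≈⟨ ^-homo-* 2# (B ℕ.* n) (j ℕ.+ j) ⟩
          2# ^ (B ℕ.* n) * 2# ^ (j ℕ.+ j)                 ≈⟨ *-cong (^-homo-* 2# n ((A ℕ.+ A) ℕ.* n)) (^-homo-* 2# j j) ⟩
          (2# ^ n * 2# ^ ((A ℕ.+ A) ℕ.* n)) * (2# ^ j * 2# ^ j)
            ≈⟨ *-congʳ (*-congˡ (≈-trans (^-congʳ 2# (ℕₚ.*-distribʳ-+ n A A)) (≈-trans (^-homo-* 2# (A ℕ.* n) (A ℕ.* n)) (*-cong Qⁿ≈ Qⁿ≈)))) ⟩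
          (2# ^ n * (Qⁿ * Qⁿ)) * (2# ^ j * 2# ^ j)        ∎

      mixed : Σ[ τ ∈ ℕ ] IsMixingTime (flipChain (interlaceWeight x y) G) π ε τ × τ ℕ.≤ m ℕ.* N
      mixed = Gap.mixingTime gap N C≤Nγ stationary 0<ε m enough

corollary10 :
  (ℝ : CompleteOrderedField) →
  let open RealOperations ℝ
      open Chains ℝ
  in
  (x y : Carrier) (1<x : 1# < x) (1<y : 1# < y) (tw : ℕ) →
  Σ[ C ∈ Carrier ]
    ((n : ℕ) .{{_ : NonZero n}} (G : Graph n) → HasTreeWidth G tw →
     (π : Distribution n) → IsStationary (flipChain (interlaceWeight x y) G) π →
     (ε : Carrier) (0<ε : 0# < ε) → ε ≤ ½ →
     Σ[ τ ∈ ℕ ]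
       (IsMixingTime (flipChain (interlaceWeight x y) G) π ε τ
        × fromℕ τ ≤ C * (pow (fromℕ n) (1≤fromℕ n)
                           (fromℕ 2 + fromℕ 8 * fromℕ (suc tw)
                              * abs (log₂ ((x - 1#) / (y - 1#)) (ratio-pos 1<x 1<y)))
                         * log₂ (1# / ε) (/-pos 0<1 0<ε))))
corollary10 ℝ x y 1<x 1<y tw = constant , bound
  where
  open MixingBound ℝ
  open Main 1<x 1<y (amplitude (Chains.ratio-pos ℝ 1<x 1<y)) tw
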